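{- (i) $\mathrm{ES}(6,2\mathcal{C}_{\ge3})=[10,12]$. (ii) For every integer $n\ge 7$, $$\mathrm{ES}(n,2\mathcal{C}_{\ge3})=[n+5,2n-2]\cup\{n+2t: t\in[3,n-3]\}.$$ Equivalently, for $n\ge7$ and $m\in[n+5,3n-6]$, there is an $n$-vertex $2\mathcal{C}_{\ge3}$-saturated graph with $m$ edges if and only if $m\in[n+5,2n-2]$ or $m-n$ is even.
   Context: All graphs are finite and simple. For integers $a\le b$, $[a,b]=\{a,a+1,\dots,b\}$. For a family $\mathcal{H}$ of graphs, a graph $G$ is $\mathcal{H}$-saturated if $G$ contains no subgraph isomorphic to a member of $\mathcal{H}$, but for every pair of non-adjacent vertices $u,v$ the graph $G+uv$ contains a subgraph isomorphic to some member of $\mathcal{H}$. The saturation spectrum $\mathrm{ES}(n,\mathcal{H})$ is the set of all numbers of edges $|E(G)|$ over all $n$-vertex $\mathcal{H}$-saturated graphs $G$. $k\mathcal{C}_{\ge3}$ is the family of all vertex-disjoint unions of $k$ (not necessarily distinct) cycles (of length at least $3$); so a graph is $2\mathcal{C}_{\ge3}$-saturated iff it has no two vertex-disjoint cycles but adding any non-edge creates two vertex-disjoint cycles. -}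

module Defs where

open import Data.Bool using (Bool; true; false; _∨_; if_then_else_)
open import Data.Nat using (ℕ; zero; suc; _+_; _<?_)
open import Data.Fin using (Fin; zero; suc; toℕ; inject₁; fromℕ; _≟_)
open import Data.Product using (Σ; _×_; _,_; ∃-syntax)
open import Data.Empty using (⊥)
open import Relation.Nullary using (¬_; Dec; yes; no)
open import Relation.Nullary.Decidable using (⌊_⌋)
open import Relation.Binary.PropositionalEquality using (_≡_; _≢_)
open import Function.Definitions using (Injective)
open import Data.Bool using (_∧_)

record Graph (n : ℕ) : Set where
  field
    adj    : Fin n → Fin n → Bool
    sym    : ∀ i j → adj i j ≡ adj j i
    irrefl : ∀ i → adj i i ≡ false
open Graph public

ΣFin : (n : ℕ) → (Fin n → ℕ) → ℕ
ΣFin zero    f = 0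
ΣFin (suc n) f = f zero + ΣFin n (λ i → f (suc i))

edgeCount : ∀ {n} → Graph n → ℕ
edgeCount {n} G =
  ΣFin n (λ i → ΣFin n (λ j →
    if ⌊ toℕ i <? toℕ j ⌋ then (if adj G i j then 1 else 0) else 0))

record Cycle {n : ℕ} (G : Graph n) : Set where
  field
    len₋₃  : ℕ
    vert   : Fin (suc (suc (suc len₋₃))) → Fin n
    inj    : Injective _≡_ _≡_ vert
    step   : ∀ (i : Fin (suc (suc len₋₃))) → adj G (vert (inject₁ i)) (vert (suc i)) ≡ true
    close  : adj G (vert (fromℕ (suc (suc len₋₃)))) (vert zero) ≡ true
open Cycle public

-- G contains a subgraph isomorphic to a member of 2C_{≥3}:
-- two vertex-disjoint cycles.
HasTwoDisjointCycles : ∀ {n} → Graph n → Set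
HasTwoDisjointCycles G =
  Σ (Cycle G) λ C → Σ (Cycle G) λ D →
    ∀ i j → vert C i ≢ vert D j

eqb : ∀ {n} → Fin n → Fin n → Bool
eqb x y = ⌊ x ≟ y ⌋

addEdge : ∀ {n} (G : Graph n) (u v : Fin n) → u ≢ v → Graph n
addEdge {n} G u v u≢v = record
  { adj = λ x y → adj G x y ∨ ((eqb x u ∧ eqb y v) ∨ (eqb x v ∧ eqb y u))
  ; sym = symP
  ; irrefl = irr
  }
  where
  open import Relation.Binary.PropositionalEquality using (refl; cong₂; trans) renaming (sym to ≡sym)
  open import Data.Empty using (⊥-elim)
  open import Data.Bool.Properties using (∨-comm)
  symP : ∀ x y → (adj G x y ∨ ((eqb x u ∧ eqb y v) ∨ (eqb x v ∧ eqb y u)))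
               ≡ (adj G y x ∨ ((eqb y u ∧ eqb x v) ∨ (eqb y v ∧ eqb x u)))
  symP x y with x ≟ u | y ≟ v | x ≟ v | y ≟ u
  ... | a | b | c | d rewrite Graph.sym G x y with a | b | c | d
  ... | yes _ | yes _ | yes _ | yes _ = refl
  ... | yes _ | yes _ | yes _ | no _ = refl
  ... | yes _ | yes _ | no _ | yes _ = refl
  ... | yes _ | yes _ | no _ | no _ = ∨-comm-helper
    where
    ∨-comm-helper : _
    ∨-comm-helper = cong₂ _∨_ refl (∨-comm true false)
  ... | yes _ | no _ | yes _ | yes _ = refl
  ... | yes _ | no _ | yes _ | no _ = refl
  ... | yes _ | no _ | no _ | yes _ = refl
  ... | yes _ | no _ | no _ | no _ = refl
  ... | no _ | yes _ | yes _ | yes _ = refl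
  ... | no _ | yes _ | yes _ | no _ = refl
  ... | no _ | yes _ | no _ | yes _ = refl
  ... | no _ | yes _ | no _ | no _ = refl
  ... | no _ | no _ | yes _ | yes _ = cong₂ _∨_ refl (∨-comm false true)
  ... | no _ | no _ | yes _ | no _ = refl
  ... | no _ | no _ | no _ | yes _ = refl
  ... | no _ | no _ | no _ | no _ = refl
  irr : ∀ x → (adj G x x ∨ ((eqb x u ∧ eqb x v) ∨ (eqb x v ∧ eqb x u))) ≡ false
  irr x rewrite Graph.irrefl G x with x ≟ u | x ≟ v
  ... | yes p | yes q = ⊥-elim (u≢v (trans (≡sym p) q))
  ... | yes _ | no _ = refl
  ... | no _ | yes _ = refl
  ... | no _ | no _ = refl

Saturated : ∀ {n} → Graph n → Set
Saturated {n} G =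
  ¬ HasTwoDisjointCycles G ×
  (∀ (u v : Fin n) (u≢v : u ≢ v) → adj G u v ≡ false →
     HasTwoDisjointCycles (addEdge G u v u≢v))

InES : ℕ → ℕ → Set
InES n m = Σ (Graph n) λ G → Saturated G × edgeCount G ≡ m

{-# OPTIONS --safe #-}
-- Suppressing a vertex of degree one, or one of degree two whose neighbours are
-- not adjacent, keeps a graph saturated and lowers both n and m by one.  The heart
-- of the proof is that every other saturated graph on at least six vertices has a
-- universal vertex.  To see this one removes a short cycle, or two vertices that
-- meet all cycles, and studies the remaining forest F from its ends: a vertex q all
-- but one of whose neighbours in F are leaves.  If q and its leaves lie on a cycle
-- with a removed vertex t, then the rest of the graph without t is a forest, and an
-- edge count forces t to be adjacent to everything.  In the exceptional case three
-- vertices meet every edge, and saturation makes those three universal.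
--
-- Given a universal vertex h, every cycle C of G - h covers all edges of G - h,
-- because an edge avoiding C would form a triangle with h.  Hence G - h is a tree
-- (m = 2n - 3), or a cycle with pendant vertices (m = 2n - 2), or is obtained from
-- an edge uv by joining all other vertices to u and v (m = 3n - 6).
--
-- Conversely, vertices of degree two on a fixed edge of the wheel with five spokes,
-- or vertices of degree three on a fixed triangle, followed by leaves at a single
-- vertex, realise all the claimed values.
module Submission where

open import Defs renaming (sym to adj-sym; step to vert-step; inj to vert-inj; close to vert-close)
open import Data.Bool using (Bool; true; false; not; _∧_; _∨_; if_then_else_)
open import Data.Bool.Properties using (∧-comm; ∨-zeroʳ) renaming (_≟_ to _≟ᵇ_)
open import Data.Empty using (⊥; ⊥-elim)
open import Data.Fin using (Fin; zero; suc; _≟_; toℕ; fromℕ; inject₁; inject≤; punchIn; punchOut)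
open import Data.Fin.Properties using (any?; all?; toℕ-injective; toℕ-inject₁; toℕ-inject≤; toℕ-fromℕ; toℕ<n; inject≤-injective; injective⇒≤; punchInᵢ≢i; punchIn-injective; punchIn-punchOut)
open import Data.Fin.Relation.Unary.Top using (view; ‵fromℕ; ‵inject₁)
open import Data.Fin.Subset using (Subset)
open import Data.Fin.Subset.Properties using (anySubset?)
open import Data.List using (List; []; _∷_; length)
import Data.List.Membership.DecPropositional
import Data.List.Membership.Propositional as List
open import Data.List.Relation.Unary.All using (All; []; _∷_)
import Data.List.Relation.Unary.All as All
open import Data.List.Relation.Unary.AllPairs using ([]; _∷_)
open import Data.List.Relation.Unary.Any using (here; there)
open import Data.List.Relation.Unary.Unique.Propositional using (Unique)
open import Data.Nat using (ℕ; zero; suc; _+_; _*_; _∸_; _≤_; _<_; z≤n; s≤s; _≤?_; _<?_)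
open import Data.Nat.Properties hiding (_≟_)
import Data.Nat.Properties as ℕ
open import Data.Nat.Tactic.RingSolver using (solve-∀)
open import Data.Product using (Σ; ∃; _×_; _,_; proj₁; proj₂)
open import Data.Sum using (_⊎_; inj₁; inj₂)
open import Data.Vec using (Vec; []; _∷_; lookup; zipWith; replicate; tabulate)
import Data.Vec as Vec
open import Data.Vec.Properties using (lookup∘tabulate)
open import Function using (_∘_)
open import Function.Bundles using (_⇔_; mk⇔)
open import Relation.Binary.Definitions using (tri<; tri≈; tri>)
open import Relation.Binary.PropositionalEquality using (_≡_; _≢_; refl; sym; trans; cong; cong₂; subst; subst₂; ≢-sym; module ≡-Reasoning)
open import Relation.Nullary using (Dec; yes; no; ¬_; contradiction)
open import Relation.Nullary.Decidable using (True; toWitness; decidable-stable; ⌊_⌋; does; _×-dec_; _⊎-dec_; _→-dec_; ¬?)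

-- The argument runs on counting: cycles become vertex sets of minimum degree two, a forest is a set
-- containing none, and most structural claims reduce to linear inequalities between |V| and doubled
-- |E| in which the degree conditions leave no slack.
--
-- Irreducible graphs split in two. If some vertex has degree two, its neighbours are adjacent and
-- meet all cycles. Otherwise all degrees are at least three, and a leaf of the forest left by a
-- short cycle has two neighbours on that cycle.
--
-- The small orders shape the statement. For a universal vertex joined to a tree, m = 2n - 3 reaches
-- n + 5 only from n = 8 on, which is why the tree must be shown to have at least seven vertices.
-- The wheel on six vertices has 10 = n + 4 edges, so n = 6 is exceptional; no saturated graph on
-- seven vertices suppresses to this wheel, and n + 4 disappears from then on.
--
-- Shortest cycles are obtained only under double negation. Membership in the spectrum is decidable,
-- which removes it at the end.

-- Linear arithmetic over ℕ by explicit certificate: the hypotheses are summed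
-- with the given weights and the goal follows by comparing coefficients.

infixl 6 _:+_
infixl 7 _:*_

data Lin (k : ℕ) : Set where
  con  : ℕ → Lin k
  var  : Fin k → Lin k
  _:+_ : Lin k → Lin k → Lin k
  _:*_ : ℕ → Lin k → Lin k

⟦_⟧ : ∀ {k} → Lin k → Vec ℕ k → ℕ
⟦ con c ⟧ ρ = c
⟦ var i ⟧ ρ = lookup ρ i
⟦ e :+ f ⟧ ρ = ⟦ e ⟧ ρ + ⟦ f ⟧ ρ
⟦ c :* e ⟧ ρ = c * ⟦ e ⟧ ρ

Coeffs : ℕ → Set
Coeffs k = ℕ × Vec ℕ k

dot : ∀ {k} → Vec ℕ k → Vec ℕ k → ℕ
dot [] [] = 0
dot (c ∷ cs) (x ∷ ρ) = c * x + dot cs ρ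

eval : ∀ {k} → Coeffs k → Vec ℕ k → ℕ
eval (c , cs) ρ = c + dot cs ρ

unit : ∀ {k} → Fin k → Vec ℕ k
unit zero = 1 ∷ replicate _ 0
unit (suc i) = 0 ∷ unit i

_⊞_ : ∀ {k} → Coeffs k → Coeffs k → Coeffs k
(c , cs) ⊞ (e , es) = c + e , zipWith _+_ cs es

_⊠_ : ∀ {k} → ℕ → Coeffs k → Coeffs k
m ⊠ (c , cs) = m * c , Vec.map (m *_) cs

coeffs : ∀ {k} → Lin k → Coeffs k
coeffs (con c) = c , replicate _ 0
coeffs (var i) = 0 , unit i
coeffs (e :+ f) = coeffs e ⊞ coeffs f
coeffs (c :* e) = c ⊠ coeffs e

dot-zero : ∀ {k} (ρ : Vec ℕ k) → dot (replicate k 0) ρ ≡ 0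
dot-zero [] = refl
dot-zero (x ∷ ρ) = dot-zero ρ

dot-unit : ∀ {k} (i : Fin k) (ρ : Vec ℕ k) → dot (unit i) ρ ≡ lookup ρ i
dot-unit zero (x ∷ ρ) = trans (cong₂ _+_ (+-identityʳ x) (dot-zero ρ)) (+-identityʳ x)
dot-unit (suc i) (x ∷ ρ) = dot-unit i ρ

dot-+ : ∀ {k} (cs es ρ : Vec ℕ k) → dot (zipWith _+_ cs es) ρ ≡ dot cs ρ + dot es ρ
dot-+ [] [] [] = refl
dot-+ (c ∷ cs) (e ∷ es) (x ∷ ρ) = trans (cong ((c + e) * x +_) (dot-+ cs es ρ)) (lem c e x _ _)
  where
  lem : ∀ c e x u v → (c + e) * x + (u + v) ≡ c * x + u + (e * x + v)
  lem = solve-∀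

dot-* : ∀ {k} m (cs ρ : Vec ℕ k) → dot (Vec.map (m *_) cs) ρ ≡ m * dot cs ρ
dot-* m [] [] = sym (*-zeroʳ m)
dot-* m (c ∷ cs) (x ∷ ρ) = trans (cong (m * c * x +_) (dot-* m cs ρ)) (lem m c x _)
  where
  lem : ∀ m c x u → m * c * x + m * u ≡ m * (c * x + u)
  lem = solve-∀

eval-⊞ : ∀ {k} (p q : Coeffs k) ρ → eval (p ⊞ q) ρ ≡ eval p ρ + eval q ρ
eval-⊞ (c , cs) (e , es) ρ = trans (cong (c + e +_) (dot-+ cs es ρ)) (lem c e _ _)
  where
  lem : ∀ c e u v → c + e + (u + v) ≡ c + u + (e + v)
  lem = solve-∀

eval-⊠ : ∀ {k} m (p : Coeffs k) ρ → eval (m ⊠ p) ρ ≡ m * eval p ρ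
eval-⊠ m (c , cs) ρ = trans (cong (m * c +_) (dot-* m cs ρ)) (sym (*-distribˡ-+ m c _))

eval-coeffs : ∀ {k} (e : Lin k) ρ → eval (coeffs e) ρ ≡ ⟦ e ⟧ ρ
eval-coeffs (con c) ρ = trans (cong (c +_) (dot-zero ρ)) (+-identityʳ c)
eval-coeffs (var i) ρ = dot-unit i ρ
eval-coeffs (e :+ f) ρ = trans (eval-⊞ (coeffs e) (coeffs f) ρ) (cong₂ _+_ (eval-coeffs e ρ) (eval-coeffs f ρ))
eval-coeffs (c :* e) ρ = trans (eval-⊠ c (coeffs e) ρ) (cong (c *_) (eval-coeffs e ρ))

data _≼_ : ∀ {k} → Vec ℕ k → Vec ℕ k → Set where
  []  : [] ≼ []
  _∷_ : ∀ {k c e} {cs es : Vec ℕ k} → c ≤ e → cs ≼ es → (c ∷ cs) ≼ (e ∷ es)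

_≼?_ : ∀ {k} (cs es : Vec ℕ k) → Dec (cs ≼ es)
[] ≼? [] = yes []
(c ∷ cs) ≼? (e ∷ es) with c ≤? e | cs ≼? es
... | yes p | yes q = yes (p ∷ q)
... | no ¬p | _ = no λ { (p ∷ _) → ¬p p }
... | _ | no ¬q = no λ { (_ ∷ q) → ¬q q }

dot-mono : ∀ {k} {cs es : Vec ℕ k} → cs ≼ es → ∀ ρ → dot cs ρ ≤ dot es ρ
dot-mono [] [] = z≤n
dot-mono (p ∷ ps) (x ∷ ρ) = +-mono-≤ (*-monoˡ-≤ x p) (dot-mono ps ρ)

Hyp : ℕ → Set
Hyp k = ℕ × Lin k × Lin k

sumˡ sumʳ : ∀ {k} → List (Hyp k) → Coeffs k
sumˡ [] = 0 , replicate _ 0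
sumˡ ((w , l , r) ∷ hs) = (w ⊠ coeffs l) ⊞ sumˡ hs
sumʳ [] = 0 , replicate _ 0
sumʳ ((w , l , r) ∷ hs) = (w ⊠ coeffs r) ⊞ sumʳ hs

Assuming : ∀ {k} → List (Hyp k) → Vec ℕ k → Set → Set
Assuming [] ρ P = P
Assuming ((w , l , r) ∷ hs) ρ P = ⟦ l ⟧ ρ ≤ ⟦ r ⟧ ρ → Assuming hs ρ P

assuming-map : ∀ {k} (hs : List (Hyp k)) ρ {P Q : Set} → (P → Q) → Assuming hs ρ P → Assuming hs ρ Q
assuming-map [] ρ f p = f p
assuming-map (h ∷ hs) ρ f p x = assuming-map hs ρ f (p x)

hyps-≤ : ∀ {k} (hs : List (Hyp k)) ρ → Assuming hs ρ (eval (sumˡ hs) ρ ≤ eval (sumʳ hs) ρ)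
hyps-≤ [] ρ = ≤-refl
hyps-≤ ((w , l , r) ∷ hs) ρ h = assuming-map hs ρ step (hyps-≤ hs ρ)
  where
  scaled : ∀ e → eval (w ⊠ coeffs e) ρ ≡ w * ⟦ e ⟧ ρ
  scaled e = trans (eval-⊠ w (coeffs e) ρ) (cong (w *_) (eval-coeffs e ρ))
  step : eval (sumˡ hs) ρ ≤ eval (sumʳ hs) ρ → _
  step q = subst₂ _≤_
    (sym (trans (eval-⊞ (w ⊠ coeffs l) (sumˡ hs) ρ) (cong (_+ eval (sumˡ hs) ρ) (scaled l))))
    (sym (trans (eval-⊞ (w ⊠ coeffs r) (sumʳ hs) ρ) (cong (_+ eval (sumʳ hs) ρ) (scaled r))))
    (+-mono-≤ (*-monoʳ-≤ w h) q)

-- Since ℕ has no subtraction, the weighted goal is added crosswise: the right sides of the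
-- hypotheses plus `l` must be dominated, coefficient by coefficient, by their left sides plus `r`.
-- Cancelling the sum of the left sides and then the factor `suc m` leaves the goal.
Certifies : ∀ {k} → List (Hyp k) → Hyp k → Set
Certifies hs (m , l , r) =
  let p = sumʳ hs ⊞ (suc m ⊠ coeffs l)
      q = sumˡ hs ⊞ (suc m ⊠ coeffs r)
  in proj₁ p ≤ proj₁ q × proj₂ p ≼ proj₂ q

certifies? : ∀ {k} (hs : List (Hyp k)) g → Dec (Certifies hs g)
certifies? hs (m , l , r) = (_ ≤? _) ×-dec (_ ≼? _)

abstract
  -- The weight of the goal is one more than the number given.
  linear : ∀ {k} (ρ : Vec ℕ k) (hs : List (Hyp k)) (g : Hyp k) → {True (certifies? hs g)} →
           Assuming hs ρ (⟦ proj₁ (proj₂ g) ⟧ ρ ≤ ⟦ proj₂ (proj₂ g) ⟧ ρ)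
  linear ρ hs (m , l , r) {cert} = assuming-map hs ρ step (hyps-≤ hs ρ)
    where
    scaled : ∀ p e → eval (p ⊞ (suc m ⊠ coeffs e)) ρ ≡ eval p ρ + suc m * ⟦ e ⟧ ρ
    scaled p e = trans (eval-⊞ p (suc m ⊠ coeffs e) ρ)
      (cong (eval p ρ +_) (trans (eval-⊠ (suc m) (coeffs e) ρ) (cong (suc m *_) (eval-coeffs e ρ))))
    compare : eval (sumʳ hs ⊞ (suc m ⊠ coeffs l)) ρ ≤ eval (sumˡ hs ⊞ (suc m ⊠ coeffs r)) ρ
    compare = +-mono-≤ (proj₁ (toWitness cert)) (dot-mono (proj₂ (toWitness cert)) ρ)
    step : eval (sumˡ hs) ρ ≤ eval (sumʳ hs) ρ → ⟦ l ⟧ ρ ≤ ⟦ r ⟧ ρ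
    step q = *-cancelˡ-≤ (suc m) (+-cancelˡ-≤ (eval (sumˡ hs) ρ) _ _
      (≤-trans (+-monoˡ-≤ _ q)
        (subst₂ _≤_ (scaled (sumʳ hs) l) (scaled (sumˡ hs) r) compare)))

x₀ : ∀ {k} → Lin (1 + k)
x₀ = var zero
x₁ : ∀ {k} → Lin (2 + k)
x₁ = var (suc zero)
x₂ : ∀ {k} → Lin (3 + k)
x₂ = var (suc (suc zero))
x₃ : ∀ {k} → Lin (4 + k)
x₃ = var (suc (suc (suc zero)))
x₄ : ∀ {k} → Lin (5 + k)
x₄ = var (suc (suc (suc (suc zero))))
x₅ : ∀ {k} → Lin (6 + k)
x₅ = var (suc (suc (suc (suc (suc zero)))))
x₆ : ∀ {k} → Lin (7 + k)
x₆ = var (suc (suc (suc (suc (suc (suc zero))))))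

absurd : ∀ {A : Set} → 1 ≤ 0 → A
absurd ()

-- Finite sums, vertex sets and cardinalities.

module VertexSets where

  -- Finite sums

  Σ-cong : ∀ n {f g : Fin n → ℕ} → (∀ i → f i ≡ g i) → ΣFin n f ≡ ΣFin n g
  Σ-cong zero h = refl
  Σ-cong (suc n) h = cong₂ _+_ (h zero) (Σ-cong n (h ∘ suc))

  Σ-mono : ∀ n {f g : Fin n → ℕ} → (∀ i → f i ≤ g i) → ΣFin n f ≤ ΣFin n g
  Σ-mono zero h = z≤n
  Σ-mono (suc n) h = +-mono-≤ (h zero) (Σ-mono n (h ∘ suc))

  +-interchange : ∀ a b c d → a + b + (c + d) ≡ a + c + (b + d)
  +-interchange = solve-∀

  Σ-+ : ∀ n (f g : Fin n → ℕ) → ΣFin n (λ i → f i + g i) ≡ ΣFin n f + ΣFin n g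
  Σ-+ zero f g = refl
  Σ-+ (suc n) f g = trans (cong (f zero + g zero +_) (Σ-+ n (f ∘ suc) (g ∘ suc)))
    (+-interchange (f zero) (g zero) (ΣFin n (f ∘ suc)) (ΣFin n (g ∘ suc)))

  Σ-* : ∀ n k (f : Fin n → ℕ) → ΣFin n (λ i → k * f i) ≡ k * ΣFin n f
  Σ-* zero k f = sym (*-zeroʳ k)
  Σ-* (suc n) k f = trans (cong (k * f zero +_) (Σ-* n k (f ∘ suc))) (sym (*-distribˡ-+ k (f zero) _))

  Σ-zero : ∀ n → ΣFin n (λ _ → 0) ≡ 0
  Σ-zero zero = refl
  Σ-zero (suc n) = Σ-zero n

  Σ-one : ∀ n → ΣFin n (λ _ → 1) ≡ n
  Σ-one zero = refl
  Σ-one (suc n) = cong suc (Σ-one n)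

  Σ-swap : ∀ m n (f : Fin m → Fin n → ℕ) →
           ΣFin m (λ i → ΣFin n (f i)) ≡ ΣFin n (λ j → ΣFin m (λ i → f i j))
  Σ-swap zero n f = sym (Σ-zero n)
  Σ-swap (suc m) n f = trans (cong (ΣFin n (f zero) +_) (Σ-swap m n (f ∘ suc))) (sym (Σ-+ n _ _))

  Σ-punch : ∀ {n} v (f : Fin (suc n) → ℕ) → ΣFin (suc n) f ≡ f v + ΣFin n (f ∘ punchIn v)
  Σ-punch zero f = refl
  Σ-punch {suc n} (suc v) f = trans (cong (f zero +_) (Σ-punch v (f ∘ suc)))
    (lem (f zero) (f (suc v)) _)
    where
    lem : ∀ a b c → a + (b + c) ≡ b + (a + c)
    lem = solve-∀

  Σ-≥ : ∀ n (f : Fin n → ℕ) i → f i ≤ ΣFin n f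
  Σ-≥ (suc n) f zero = m≤m+n _ _
  Σ-≥ (suc n) f (suc i) = ≤-trans (Σ-≥ n (f ∘ suc) i) (m≤n+m _ (f zero))

  -- Vertex sets

  χ : Bool → ℕ
  χ true = 1
  χ false = 0

  χ≤1 : ∀ b → χ b ≤ 1
  χ≤1 true = ≤-refl
  χ≤1 false = z≤n

  true≢false : ∀ {b : Bool} → b ≡ true → b ≡ false → ⊥
  true≢false refl ()

  ¬true : ∀ {b : Bool} → ¬ (b ≡ true) → b ≡ false
  ¬true {true} h = ⊥-elim (h refl)
  ¬true {false} h = refl

  record VSet (n : ℕ) : Set where
    constructor set
    field has : Fin n → Bool
  open VSet public

  infix 4 _∈_ _∉_ _⊆_ _∈?_

  record _∈_ {n} (v : Fin n) (X : VSet n) : Set where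
    constructor mem
    field true? : has X v ≡ true
  open _∈_ public

  _∉_ : ∀ {n} → Fin n → VSet n → Set
  v ∉ X = ¬ (v ∈ X)

  _∈?_ : ∀ {n} (v : Fin n) (X : VSet n) → Dec (v ∈ X)
  v ∈? X with has X v in eq
  ... | true = yes (mem eq)
  ... | false = no λ p → true≢false (true? p) eq

  _⊆_ : ∀ {n} → VSet n → VSet n → Set
  X ⊆ Y = ∀ {v} → v ∈ X → v ∈ Y

  Disjoint : ∀ {n} → VSet n → VSet n → Set
  Disjoint X Y = ∀ {v} → v ∈ X → v ∈ Y → ⊥

  infixl 7 _∩_
  infixl 6 _∪_ _∖_ _-_

  abstract
    sep : ∀ {n} {P : Fin n → Set} → (∀ v → Dec (P v)) → VSet n
    sep P? = set λ v → does (P? v)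

    sep⁻ : ∀ {n} {P : Fin n → Set} (P? : ∀ v → Dec (P v)) {v} → v ∈ sep P? → P v
    sep⁻ P? {v} (mem h) with P? v
    ... | yes p = p

    sep⁺ : ∀ {n} {P : Fin n → Set} (P? : ∀ v → Dec (P v)) {v} → P v → v ∈ sep P?
    sep⁺ P? {v} p with P? v in eq
    ... | yes _ = mem (cong does eq)
    ... | no ¬p = contradiction p ¬p

    full : ∀ {n} → VSet n
    full = set λ _ → true

    ∈full : ∀ {n} {v : Fin n} → v ∈ full
    ∈full = mem refl

    _∩_ _∪_ _∖_ : ∀ {n} → VSet n → VSet n → VSet n
    X ∩ Y = sep (λ v → (v ∈? X) ×-dec (v ∈? Y))
    X ∪ Y = sep (λ v → (v ∈? X) ⊎-dec (v ∈? Y))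
    X ∖ Y = sep (λ v → (v ∈? X) ×-dec ¬? (v ∈? Y))

    ｛_｝ : ∀ {n} → Fin n → VSet n
    ｛ x ｝ = sep (_≟ x)

    ∩⁻ : ∀ {n} {X Y : VSet n} {v} → v ∈ X ∩ Y → v ∈ X × v ∈ Y
    ∩⁻ {X = X} {Y} = sep⁻ (λ v → (v ∈? X) ×-dec (v ∈? Y))
    ∩⁺ : ∀ {n} {X Y : VSet n} {v} → v ∈ X → v ∈ Y → v ∈ X ∩ Y
    ∩⁺ {X = X} {Y} p q = sep⁺ (λ v → (v ∈? X) ×-dec (v ∈? Y)) (p , q)
    ∪⁻ : ∀ {n} {X Y : VSet n} {v} → v ∈ X ∪ Y → v ∈ X ⊎ v ∈ Y
    ∪⁻ {X = X} {Y} = sep⁻ (λ v → (v ∈? X) ⊎-dec (v ∈? Y))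
    ∪ˡ : ∀ {n} {X Y : VSet n} → X ⊆ X ∪ Y
    ∪ˡ {X = X} {Y} p = sep⁺ (λ v → (v ∈? X) ⊎-dec (v ∈? Y)) (inj₁ p)
    ∪ʳ : ∀ {n} {X Y : VSet n} → Y ⊆ X ∪ Y
    ∪ʳ {X = X} {Y} p = sep⁺ (λ v → (v ∈? X) ⊎-dec (v ∈? Y)) (inj₂ p)
    ∖⁻ : ∀ {n} {X Y : VSet n} {v} → v ∈ X ∖ Y → v ∈ X × v ∉ Y
    ∖⁻ {X = X} {Y} = sep⁻ (λ v → (v ∈? X) ×-dec ¬? (v ∈? Y))
    ∖⁺ : ∀ {n} {X Y : VSet n} {v} → v ∈ X → v ∉ Y → v ∈ X ∖ Y
    ∖⁺ {X = X} {Y} p q = sep⁺ (λ v → (v ∈? X) ×-dec ¬? (v ∈? Y)) (p , q)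

    ∈｛｝ : ∀ {n} {x v : Fin n} → v ∈ ｛ x ｝ → v ≡ x
    ∈｛｝ {x = x} = sep⁻ (_≟ x)

    x∈｛x｝ : ∀ {n} (x : Fin n) → x ∈ ｛ x ｝
    x∈｛x｝ x = sep⁺ (_≟ x) refl

  _-_ : ∀ {n} → VSet n → Fin n → VSet n
  X - x = X ∖ ｛ x ｝

  -⁻ : ∀ {n} {X : VSet n} {x v} → v ∈ X - x → v ∈ X × v ≢ x
  -⁻ {x = x} h with ∖⁻ h
  ... | p , q = p , λ { refl → q (x∈｛x｝ x) }

  -⁺ : ∀ {n} {X : VSet n} {x v} → v ∈ X → v ≢ x → v ∈ X - x
  -⁺ p q = ∖⁺ p (q ∘ ∈｛｝)

  -⊆ : ∀ {n} {X : VSet n} {x} → X - x ⊆ X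
  -⊆ = proj₁ ∘ -⁻

  ∖⊆ : ∀ {n} {X Y : VSet n} → X ∖ Y ⊆ X
  ∖⊆ = proj₁ ∘ ∖⁻

  Nonempty : ∀ {n} → VSet n → Set
  Nonempty X = ∃ (_∈ X)

  nonempty? : ∀ {n} (X : VSet n) → Dec (Nonempty X)
  nonempty? X = any? (_∈? X)

  -- Stated as an identity of characteristic functions, so that `sum`, `card`, `d` and `D` all
  -- become additive over the two parts at once.
  Split : ∀ {n} → VSet n → VSet n → VSet n → Set
  Split X A B = ∀ v → χ (has X v) ≡ χ (has A v) + χ (has B v)

  ∉⇒0 : ∀ {n} {X : VSet n} {v} → v ∉ X → χ (has X v) ≡ 0
  ∉⇒0 h = cong χ (¬true (h ∘ mem))

  ∈⇒1 : ∀ {n} {X : VSet n} {v} → v ∈ X → χ (has X v) ≡ 1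
  ∈⇒1 h = cong χ (true? h)

  split : ∀ {n} {X A B : VSet n} → (∀ {v} → v ∈ X → v ∈ A ⊎ v ∈ B) → A ⊆ X → B ⊆ X → Disjoint A B → Split X A B
  split {X = X} {A} {B} cover A⊆X B⊆X dis v with v ∈? A | v ∈? B
  ... | yes a | yes b = ⊥-elim (dis a b)
  ... | yes a | no ¬b = trans (∈⇒1 (A⊆X a)) (sym (cong₂ _+_ (∈⇒1 a) (∉⇒0 ¬b)))
  ... | no ¬a | yes b = trans (∈⇒1 (B⊆X b)) (sym (cong₂ _+_ (∉⇒0 ¬a) (∈⇒1 b)))
  ... | no ¬a | no ¬b = trans (∉⇒0 x∉X) (sym (cong₂ _+_ (∉⇒0 ¬a) (∉⇒0 ¬b)))
    where
    x∉X : v ∉ X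
    x∉X p with cover p
    ... | inj₁ a = ¬a a
    ... | inj₂ b = ¬b b

  ∈-or-∖ : ∀ {n} {X A : VSet n} {v} → v ∈ X → v ∈ A ⊎ v ∈ X ∖ A
  ∈-or-∖ {A = A} {v} p with v ∈? A
  ... | yes q = inj₁ q
  ... | no q = inj₂ (∖⁺ p q)

  split-∖ : ∀ {n} {X A : VSet n} → A ⊆ X → Split X A (X ∖ A)
  split-∖ A⊆X = split ∈-or-∖ A⊆X ∖⊆ (λ p q → proj₂ (∖⁻ q) p)

  split-remove : ∀ {n} {X : VSet n} {x} → x ∈ X → Split X ｛ x ｝ (X - x)
  split-remove {X = X} {x} p = split-∖ (λ q → subst (_∈ X) (sym (∈｛｝ q)) p)

  split-∪ : ∀ {n} {A B : VSet n} → Disjoint A B → Split (A ∪ B) A B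
  split-∪ = split ∪⁻ ∪ˡ ∪ʳ

  abstract
    sum : ∀ {n} → VSet n → (Fin n → ℕ) → ℕ
    sum {n} X f = ΣFin n (λ v → χ (has X v) * f v)

    card : ∀ {n} → VSet n → ℕ
    card {n} X = ΣFin n (λ v → χ (has X v))

    sum-def : ∀ {n} (X : VSet n) f → sum X f ≡ ΣFin n (λ v → χ (has X v) * f v)
    sum-def X f = refl

    card-def : ∀ {n} (X : VSet n) → card X ≡ ΣFin n (λ v → χ (has X v))
    card-def X = refl

    sum-split : ∀ {n} {X A B : VSet n} → Split X A B → ∀ f → sum X f ≡ sum A f + sum B f
    sum-split {n} {X} {A} {B} s f = trans
      (Σ-cong n (λ v → trans (cong (_* f v) (s v)) (*-distribʳ-+ (f v) (χ (has A v)) (χ (has B v)))))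
      (Σ-+ n _ _)

    sum-mono : ∀ {n} {X : VSet n} {f g : Fin n → ℕ} → (∀ {v} → v ∈ X → f v ≤ g v) → sum X f ≤ sum X g
    sum-mono {n} {X} {f} {g} h = Σ-mono n pointwise
      where
      pointwise : ∀ v → χ (has X v) * f v ≤ χ (has X v) * g v
      pointwise v with has X v in eq
      ... | true = *-monoʳ-≤ 1 (h (mem eq))
      ... | false = z≤n

    sum-+ : ∀ {n} (X : VSet n) f g → sum X (λ v → f v + g v) ≡ sum X f + sum X g
    sum-+ {n} X f g = trans (Σ-cong n (λ v → *-distribˡ-+ (χ (has X v)) (f v) (g v))) (Σ-+ n _ _)

    sum-const : ∀ {n} (X : VSet n) k → sum X (λ _ → k) ≡ k * card X
    sum-const {n} X k = trans (Σ-cong n (λ v → *-comm (χ (has X v)) k)) (Σ-* n k _)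

    sum-｛｝ : ∀ {n} (x : Fin n) f → sum ｛ x ｝ f ≡ f x
    sum-｛｝ {suc n} x f = trans (Σ-punch x (λ v → χ (has ｛ x ｝ v) * f v))
      (trans (cong₂ _+_ (trans (cong (_* f x) (∈⇒1 (x∈｛x｝ x))) (+-identityʳ (f x)))
        (trans (Σ-cong n off) (Σ-zero n))) (+-identityʳ (f x)))
      where
      off : ∀ j → χ (has ｛ x ｝ (punchIn x j)) * f (punchIn x j) ≡ 0
      off j = cong (_* f (punchIn x j)) (∉⇒0 {X = ｛ x ｝} (λ p → punchInᵢ≢i x j (∈｛｝ p)))

    card≡sum : ∀ {n} (X : VSet n) → card X ≡ sum X (λ _ → 1)
    card≡sum {n} X = Σ-cong n (λ v → sym (*-identityʳ (χ (has X v))))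

    card-split : ∀ {n} {X A B : VSet n} → Split X A B → card X ≡ card A + card B
    card-split {n} s = trans (Σ-cong n s) (Σ-+ n _ _)

    card-mono : ∀ {n} {X Y : VSet n} → X ⊆ Y → card X ≤ card Y
    card-mono {n} {X} {Y} h = Σ-mono n pointwise
      where
      pointwise : ∀ v → χ (has X v) ≤ χ (has Y v)
      pointwise v with has X v in eq
      ... | false = z≤n
      ... | true = ≤-reflexive (sym (∈⇒1 (h (mem eq))))

    card-full : ∀ n → card (full {n}) ≡ n
    card-full n = Σ-one n

    card-witness : ∀ {n} {X : VSet n} → 1 ≤ card X → Nonempty X
    card-witness {n} {X} h with nonempty? X
    ... | yes p = p
    ... | no ¬p = contradiction (subst (1 ≤_) (trans (Σ-cong n (λ v → ∉⇒0 {X = X} (λ q → ¬p (v , q)))) (Σ-zero n)) h) λ ()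

  sum-cong : ∀ {n} {X : VSet n} {f g : Fin n → ℕ} → (∀ {v} → v ∈ X → f v ≡ g v) → sum X f ≡ sum X g
  sum-cong h = ≤-antisym (sum-mono (≤-reflexive ∘ h)) (sum-mono (≤-reflexive ∘ sym ∘ h))

  sum-≥ : ∀ {n} {X : VSet n} {f} k → (∀ {v} → v ∈ X → k ≤ f v) → k * card X ≤ sum X f
  sum-≥ {X = X} k h = ≤-trans (≤-reflexive (sym (sum-const X k))) (sum-mono h)

  sum-≤ : ∀ {n} {X : VSet n} {f} k → (∀ {v} → v ∈ X → f v ≤ k) → sum X f ≤ k * card X
  sum-≤ {X = X} k h = ≤-trans (sum-mono h) (≤-reflexive (sum-const X k))

  sum-remove : ∀ {n} {X : VSet n} {x} → x ∈ X → ∀ f → sum X f ≡ f x + sum (X - x) f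
  sum-remove {X = X} {x} p f = trans (sum-split (split-remove p) f) (cong (_+ sum (X - x) f) (sum-｛｝ x f))

  card-｛｝ : ∀ {n} (x : Fin n) → card ｛ x ｝ ≡ 1
  card-｛｝ x = trans (card≡sum ｛ x ｝) (sum-｛｝ x _)

  card-remove : ∀ {n} {X : VSet n} {x} → x ∈ X → card X ≡ 1 + card (X - x)
  card-remove {X = X} {x} p = trans (card-split (split-remove p)) (cong (_+ card (X - x)) (card-｛｝ x))

  card-∪｛｝ : ∀ {n} {X : VSet n} {x} → x ∉ X → card (X ∪ ｛ x ｝) ≡ card X + 1
  card-∪｛｝ {X = X} {x} p = trans (card-split (split-∪ λ { q r → p (subst (_∈ X) (∈｛｝ r) q) })) (cong (card X +_) (card-｛｝ x))

  card-≥1 : ∀ {n} {X : VSet n} {x} → x ∈ X → 1 ≤ card X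
  card-≥1 p = subst (1 ≤_) (sym (card-remove p)) (s≤s z≤n)

  card-witness≢ : ∀ {n} {X : VSet n} → 2 ≤ card X → ∀ p → ∃ λ v → v ∈ X × v ≢ p
  card-witness≢ {X = X} h p with p ∈? X
  ... | no q with card-witness (≤-trans (s≤s z≤n) h)
  ...   | v , r = v , r , λ { refl → q r }
  card-witness≢ {X = X} h p | yes q with card-witness (≤-pred (subst (2 ≤_) (card-remove q) h))
  ...   | v , r = v , -⁻ r

  card-unique : ∀ {n} {X : VSet n} {xs} → Unique xs → All (_∈ X) xs → length xs ≤ card X
  card-unique [] [] = z≤n
  card-unique {X = X} {x ∷ xs} (x∉xs ∷ u) (p ∷ ps) = subst (suc (length xs) ≤_) (sym (card-remove p))
    (s≤s (card-unique u (All.zipWith (λ (q , r) → -⁺ q (r ∘ sym)) (ps , x∉xs))))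

  card-⊆-≡ : ∀ {n} {X Y : VSet n} → X ⊆ Y → card Y ≤ card X → Y ⊆ X
  card-⊆-≡ {X = X} {Y} X⊆Y h {v} p with v ∈? X
  ... | yes q = q
  ... | no q = contradiction (subst (_≤ card X) (card-remove p) h)
    (≤⇒≯ (card-mono (λ r → -⁺ (X⊆Y r) λ { refl → q r })))

  -- The other elements already contribute `k` each, so the total leaves no room for an excess at
  -- `v`.
  sum-tight-≥ : ∀ {n} {X : VSet n} {f} k → (∀ {v} → v ∈ X → k ≤ f v) → sum X f ≤ k * card X →
                ∀ {v} → v ∈ X → f v ≤ k
  sum-tight-≥ {X = X} {f} k h s {v} p = +-cancelʳ-≤ (k * card (X - v)) (f v) k
    (≤-trans (+-monoʳ-≤ (f v) (sum-≥ k (h ∘ -⊆)))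
    (subst₂ _≤_ (sum-remove p f) (trans (cong (k *_) (card-remove p)) (*-suc k _)) s))

  sum-tight-≤ : ∀ {n} {X : VSet n} {f} k → (∀ {v} → v ∈ X → f v ≤ k) → k * card X ≤ sum X f →
                ∀ {v} → v ∈ X → k ≤ f v
  sum-tight-≤ {X = X} {f} k h s {v} p = +-cancelʳ-≤ (k * card (X - v)) k (f v)
    (≤-trans (subst₂ _≤_ (trans (cong (k *_) (card-remove p)) (*-suc k _)) (sum-remove p f) s)
    (+-monoʳ-≤ (f v) (sum-≤ k (h ∘ -⊆))))

open VertexSets

-- Degrees into vertex sets, edge counts and forests.

module Counting {n : ℕ} (G : Graph n) where

  N : Fin n → VSet n
  N v = set (adj G v)

  infix 4 _~_ _≁_ _~?_

  _~_ _≁_ : Fin n → Fin n → Set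
  u ~ v = v ∈ N u
  u ≁ v = ¬ (u ~ v)

  _~?_ : ∀ u v → Dec (u ~ v)
  u ~? v = v ∈? N u

  ~sym : ∀ {u v} → u ~ v → v ~ u
  ~sym {u} {v} (mem p) = mem (trans (adj-sym G v u) p)

  ~irrefl : ∀ {v} → v ≁ v
  ~irrefl {v} (mem p) = true≢false p (irrefl G v)

  ~⇒≢ : ∀ {u v} → u ~ v → u ≢ v
  ~⇒≢ p refl = ~irrefl p

  e : Fin n → Fin n → ℕ
  e u v = χ (adj G u v)

  e≡1 : ∀ {u v} → u ~ v → e u v ≡ 1
  e≡1 = ∈⇒1

  e≡0 : ∀ {u v} → u ≁ v → e u v ≡ 0
  e≡0 {u} = ∉⇒0 {X = N u}

  e≤1 : ∀ u v → e u v ≤ 1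
  e≤1 u v = χ≤1 (adj G u v)

  d : Fin n → VSet n → ℕ
  d v X = card (N v ∩ X)

  d-split : ∀ {X A B} → Split X A B → ∀ v → d v X ≡ d v A + d v B
  d-split {X} {A} {B} s v = card-split λ u → pointwise u (s u)
    where
    same : ∀ {Y} u → v ~ u → χ (has (N v ∩ Y) u) ≡ χ (has Y u)
    same {Y} u p with u ∈? Y
    ... | yes q = trans (∈⇒1 (∩⁺ p q)) (sym (∈⇒1 q))
    ... | no ¬q = trans (∉⇒0 {X = N v ∩ Y} (¬q ∘ proj₂ ∘ ∩⁻)) (sym (∉⇒0 ¬q))
    none : ∀ {Y} u → v ≁ u → χ (has (N v ∩ Y) u) ≡ 0
    none {Y} u p = ∉⇒0 {X = N v ∩ Y} (p ∘ proj₁ ∘ ∩⁻)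
    pointwise : ∀ u → χ (has X u) ≡ χ (has A u) + χ (has B u) →
                χ (has (N v ∩ X) u) ≡ χ (has (N v ∩ A) u) + χ (has (N v ∩ B) u)
    pointwise u h with v ~? u
    ... | yes p = trans (same u p) (trans h (sym (cong₂ _+_ (same u p) (same u p))))
    ... | no ¬p = trans (none u ¬p) (sym (cong₂ _+_ (none {A} u ¬p) (none {B} u ¬p)))

  d-mono : ∀ {X Y} → X ⊆ Y → ∀ v → d v X ≤ d v Y
  d-mono X⊆Y v = card-mono λ p → ∩⁺ (proj₁ (∩⁻ p)) (X⊆Y (proj₂ (∩⁻ p)))

  d≤card : ∀ v X → d v X ≤ card X
  d≤card v X = card-mono (proj₂ ∘ ∩⁻)

  d-unique : ∀ {v X us} → Unique us → All (v ~_) us → All (_∈ X) us → length us ≤ d v X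
  d-unique u p q = card-unique u (All.zipWith (λ (a , b) → ∩⁺ a b) (p , q))

  d≥1 : ∀ {v u X} → v ~ u → u ∈ X → 1 ≤ d v X
  d≥1 p q = card-≥1 (∩⁺ p q)

  d≥2 : ∀ {v u w X} → u ≢ w → v ~ u → v ~ w → u ∈ X → w ∈ X → 2 ≤ d v X
  d≥2 u≢w p q r s = d-unique ((u≢w ∷ []) ∷ [] ∷ []) (p ∷ q ∷ []) (r ∷ s ∷ [])

  d-witness : ∀ {v X} → 1 ≤ d v X → ∃ λ u → v ~ u × u ∈ X
  d-witness h with card-witness h
  ... | u , p = u , ∩⁻ p

  d-witness≢ : ∀ {v X} → 2 ≤ d v X → ∀ p → ∃ λ u → v ~ u × u ∈ X × u ≢ p
  d-witness≢ h p with card-witness≢ h p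
  ... | u , q , r = u , proj₁ (∩⁻ q) , proj₂ (∩⁻ q) , r

  d≤1⇒≡ : ∀ {v u w X} → d v X ≤ 1 → v ~ u → v ~ w → u ∈ X → w ∈ X → u ≡ w
  d≤1⇒≡ {u = u} {w} h p q r s with u ≟ w
  ... | yes eq = eq
  ... | no u≢w = contradiction (≤-trans (d≥2 u≢w p q r s) h) λ { (s≤s ()) }

  ≁⇒d≤0 : ∀ {v X} → (∀ {u} → u ∈ X → v ≁ u) → d v X ≤ 0
  ≁⇒d≤0 {v} {X} h with 1 ≤? d v X
  ... | yes p = let (u , q , r) = d-witness p in contradiction q (h r)
  ... | no ¬p = ≤-pred (≰⇒> ¬p)

  d-｛｝ : ∀ v x → d v ｛ x ｝ ≡ e v x
  d-｛｝ v x with v ~? x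
  ... | yes p = trans (≤-antisym (≤-trans (d≤card v _) (≤-reflexive (card-｛｝ x))) (d≥1 p (x∈｛x｝ x))) (sym (e≡1 p))
  ... | no ¬p = trans (n≤0⇒n≡0 (≁⇒d≤0 λ q r → ¬p (subst (v ~_) (∈｛｝ q) r))) (sym (e≡0 ¬p))

  d-remove : ∀ {X x} → x ∈ X → ∀ v → d v X ≡ e v x + d v (X - x)
  d-remove {X} {x} p v = trans (d-split (split-remove p) v) (cong (_+ d v (X - x)) (d-｛｝ v x))

  d-self : ∀ {X x} → d x (X - x) ≡ d x X
  d-self {X} {x} = ≤-antisym (d-mono -⊆ x)
    (card-mono λ p → ∩⁺ (proj₁ (∩⁻ p)) (-⁺ (proj₂ (∩⁻ p)) λ { refl → ~irrefl (proj₁ (∩⁻ p)) }))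

  d-≁- : ∀ {X x v} → v ≁ x → d v (X - x) ≡ d v X
  d-≁- {X} {x} {v} h = ≤-antisym (d-mono -⊆ v)
    (card-mono λ p → ∩⁺ (proj₁ (∩⁻ p)) (-⁺ (proj₂ (∩⁻ p)) λ { refl → h (proj₁ (∩⁻ p)) }))

  d-∪｛｝ : ∀ {X x} → x ∉ X → ∀ v → d v (X ∪ ｛ x ｝) ≡ d v X + e v x
  d-∪｛｝ {X} {x} p v = trans (d-split (split-∪ λ { q r → p (subst (_∈ X) (∈｛｝ r) q) }) v) (cong (d v X +_) (d-｛｝ v x))

  d<card : ∀ {v X} → v ∈ X → suc (d v X) ≤ card X
  d<card {v} {X} p = ≤-trans (s≤s (≤-trans (≤-reflexive (sym d-self)) (d≤card v (X - v)))) (≤-reflexive (sym (card-remove p)))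

  -- Counts adjacent ordered pairs in `X × Y`; in particular `D X X` is twice the number of edges
  -- inside `X`.
  D : VSet n → VSet n → ℕ
  D X Y = sum X (λ v → d v Y)

  D-splitʳ : ∀ {Y A B} → Split Y A B → ∀ X → D X Y ≡ D X A + D X B
  D-splitʳ {Y} {A} {B} s X = trans (sum-cong (λ {v} _ → d-split s v)) (sum-+ X (λ v → d v A) (λ v → d v B))

  D-splitˡ : ∀ {X A B} → Split X A B → ∀ Y → D X Y ≡ D A Y + D B Y
  D-splitˡ s Y = sum-split s (λ v → d v Y)

  abstract
    d-def : ∀ u Y → d u Y ≡ ΣFin n (λ v → e u v * χ (has Y v))
    d-def u Y = trans (card-def (N u ∩ Y)) (Σ-cong n pointwise)
      where
      pointwise : ∀ v → χ (has (N u ∩ Y) v) ≡ e u v * χ (has Y v)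
      pointwise v with u ~? v | v ∈? Y
      ... | no ¬p | _ = trans (∉⇒0 {X = N u ∩ Y} (¬p ∘ proj₁ ∘ ∩⁻)) (sym (cong (_* χ (has Y v)) (e≡0 ¬p)))
      ... | yes p | yes q = trans (∈⇒1 (∩⁺ p q)) (sym (cong₂ _*_ (e≡1 p) (∈⇒1 q)))
      ... | yes p | no ¬q = trans (∉⇒0 {X = N u ∩ Y} (¬q ∘ proj₂ ∘ ∩⁻)) (sym (cong₂ _*_ (e≡1 p) (∉⇒0 ¬q)))

    D-def : ∀ X Y → D X Y ≡ ΣFin n (λ u → ΣFin n (λ v → χ (has X u) * (e u v * χ (has Y v))))
    D-def X Y = trans (sum-def X _) (Σ-cong n λ u →
      trans (cong (χ (has X u) *_) (d-def u Y)) (sym (Σ-* n (χ (has X u)) _)))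

    D-sym : ∀ X Y → D X Y ≡ D Y X
    D-sym X Y = trans (D-def X Y) (trans (Σ-swap n n _)
      (trans (Σ-cong n λ v → Σ-cong n λ u →
        trans (lem (χ (has X u)) (e u v) (χ (has Y v))) (cong (λ b → χ (has Y v) * (χ b * χ (has X u))) (adj-sym G u v)))
      (sym (D-def Y X))))
      where
      lem : ∀ a b c → a * (b * c) ≡ c * (b * a)
      lem = solve-∀

  D-full : D full full ≡ ΣFin n (λ u → ΣFin n (e u))
  D-full = trans (D-def full full) (Σ-cong n λ u → Σ-cong n λ v →
    trans (cong₂ (λ a b → a * (e u v * b)) (∈⇒1 (∈full {v = u})) (∈⇒1 (∈full {v = v})))
      (trans (+-identityʳ _) (*-identityʳ _)))

  D-｛｝ˡ : ∀ x Y → D ｛ x ｝ Y ≡ d x Y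
  D-｛｝ˡ x Y = sum-｛｝ x _

  D-｛｝ʳ : ∀ X x → D X ｛ x ｝ ≡ d x X
  D-｛｝ʳ X x = trans (D-sym X ｛ x ｝) (D-｛｝ˡ x X)

  D-split : ∀ {X A B} → Split X A B → D X X ≡ D A A + 2 * D A B + D B B
  D-split {X} {A} {B} s = trans (D-splitˡ s X) (trans (cong₂ _+_ (D-splitʳ s A) (D-splitʳ s B))
    (trans (cong (λ z → D A A + D A B + (z + D B B)) (D-sym B A)) (lem (D A A) (D A B) (D B B))))
    where
    lem : ∀ a b c → a + b + (b + c) ≡ a + 2 * b + c
    lem = solve-∀

  D-remove : ∀ {X x} → x ∈ X → D X X ≡ 2 * d x X + D (X - x) (X - x)
  D-remove {X} {x} p = trans (D-split (split-remove p)) (cong (_+ D (X - x) (X - x))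
    (trans (cong₂ (λ a b → a + 2 * b) (trans (D-｛｝ˡ x _) (trans (d-｛｝ x x) (e≡0 ~irrefl))) (trans (D-｛｝ˡ x _) d-self)) refl))

  D-∪｛｝ : ∀ {X x} → x ∉ X → D (X ∪ ｛ x ｝) (X ∪ ｛ x ｝) ≡ D X X + 2 * d x X
  D-∪｛｝ {X} {x} p = trans (D-split (split-∪ λ { q r → p (subst (_∈ X) (∈｛｝ r) q) }))
    (trans (cong₂ (λ a b → D X X + 2 * a + b) (D-｛｝ʳ X x) (trans (D-｛｝ˡ x _) (trans (d-｛｝ x x) (e≡0 ~irrefl)))) (+-identityʳ _))

  d≤D : ∀ {x X Y} → x ∈ X → d x Y ≤ D X Y
  d≤D p = subst (_ ≤_) (sym (sum-remove p _)) (m≤m+n _ _)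

  -- Every vertex set of minimum degree at least two contains a cycle, so
  -- dense sets take the place of cycles throughout.
  Dense : VSet n → Set
  Dense X = ∀ {v} → v ∈ X → 2 ≤ d v X

  record Cyc (X : VSet n) : Set where
    constructor cyc
    field
      core  : VSet n
      inside : core ⊆ X
      some  : Nonempty core
      dense : Dense core

  Forest : VSet n → Set
  Forest X = ¬ Cyc X

  Cyc-mono : ∀ {X Y} → X ⊆ Y → Cyc X → Cyc Y
  Cyc-mono h (cyc Z i s dn) = cyc Z (h ∘ i) s dn

  Forest-mono : ∀ {X Y} → X ⊆ Y → Forest Y → Forest X
  Forest-mono h f = f ∘ Cyc-mono h

  dense-or-leaf : ∀ X → Dense X ⊎ ∃ λ v → v ∈ X × d v X ≤ 1
  dense-or-leaf X with any? (λ v → (v ∈? X) ×-dec (d v X ≤? 1))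
  ... | yes p = inj₂ p
  ... | no ¬p = inj₁ λ {v} q → ≰⇒> λ h → ¬p (v , q , h)

  forest-leaf : ∀ {X v} → Forest X → v ∈ X → ∃ λ x → x ∈ X × d x X ≤ 1
  forest-leaf {X} {v} f p with dense-or-leaf X
  ... | inj₁ h = contradiction (cyc X (λ q → q) (v , p) h) f
  ... | inj₂ l = l

  card-induction : ∀ (P : VSet n → Set) → (∀ X → (∀ {x} → x ∈ X → P (X - x)) → P X) → ∀ X → P X
  card-induction P step X = go (card X) X ≤-refl
    where
    go : ∀ k X → card X ≤ k → P X
    go zero X h = step X λ p → contradiction (≤-trans (card-≥1 p) h) λ ()
    go (suc k) X h = step X λ p → go k _ (≤-pred (subst (_≤ suc k) (card-remove p) h))

  -- A vertex of degree at most one lies in no dense subset. Stripping such vertices therefore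
  -- either stops at a dense set or exhausts `X`.
  cyc? : ∀ X → Dec (Cyc X)
  cyc? = card-induction _ step
    where
    step : ∀ X → (∀ {x} → x ∈ X → Dec (Cyc (X - x))) → Dec (Cyc X)
    step X ih with nonempty? X | dense-or-leaf X
    ... | no ¬p | _ = no λ (cyc Y i (v , q) _) → ¬p (v , i q)
    ... | yes p | inj₁ h = yes (cyc X (λ q → q) p h)
    ... | yes _ | inj₂ (x , q , h) with ih q
    ...   | yes c = yes (Cyc-mono -⊆ c)
    ...   | no ¬c = no λ (cyc Y i s dn) → ¬c (cyc Y (λ r → -⁺ (i r) λ { refl →
              contradiction (≤-trans (dn r) (≤-trans (d-mono i x) h)) λ { (s≤s ()) } }) s dn)

  -- The bound |E| ≤ |V| - 1, doubled: removing a vertex of degree at most one costs at most 2 on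
  -- the left and exactly 2 on the right.
  forest-edges : ∀ X → Forest X → Nonempty X → D X X + 2 ≤ 2 * card X
  forest-edges = card-induction _ step
    where
    step : ∀ X → (∀ {x} → x ∈ X → Forest (X - x) → Nonempty (X - x) → D (X - x) (X - x) + 2 ≤ 2 * card (X - x)) →
           Forest X → Nonempty X → D X X + 2 ≤ 2 * card X
    step X ih f (v , p) with forest-leaf f p
    ... | x , q , h with nonempty? (X - x)
    ...   | yes ne = subst₂ (λ a b → a + 2 ≤ 2 * b) (sym (D-remove q)) (sym (card-remove q))
              (linear (d x X ∷ D (X - x) (X - x) ∷ card (X - x) ∷ [])
                ((2 , x₀ , con 1) ∷ (1 , x₁ :+ con 2 , 2 :* x₂) ∷ [])
                (0 , 2 :* x₀ :+ x₁ :+ con 2 , 2 :* (con 1 :+ x₂)) h (ih q (Forest-mono -⊆ f) ne))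
    ...   | no ¬ne = ≤-trans (≤-reflexive (cong (_+ 2) D≡0)) (*-monoʳ-≤ 2 (card-≥1 q))
      where
      only : ∀ {u} → u ∈ X → u ≡ x
      only {u} r with u ≟ x
      ... | yes eq = eq
      ... | no u≢x = contradiction (u , -⁺ r u≢x) ¬ne
      D≡0 : D X X ≡ 0
      D≡0 = n≤0⇒n≡0 (sum-≤ 0 λ r → ≁⇒d≤0 λ s t → ~irrefl (subst₂ _~_ (only r) (only s) t))

  -- Contrapositive of `forest-edges`. As `D X X` is even, the slack of one only spares later parity
  -- arguments.
  many-edges : ∀ {X} → Nonempty X → 2 * card X ≤ D X X + 1 → Cyc X
  many-edges {X} ne h with cyc? X
  ... | yes c = c
  ... | no f = absurd (linear (D X X ∷ card X ∷ []) ((1 , x₀ :+ con 2 , 2 :* x₁) ∷ (1 , 2 :* x₁ , x₀ :+ con 1) ∷ []) (0 , con 1 , con 0) (forest-edges X f ne) h)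

  -- If every vertex other than `p` had degree at least two, the edge bound for the forest `X - p`
  -- would force two edges at `p`, and `X` itself would be dense.
  forest-leaf≢ : ∀ {X} p → Forest X → Nonempty (X - p) → ∃ λ x → x ∈ X × x ≢ p × d x X ≤ 1
  forest-leaf≢ {X} p f ne with any? (λ x → (x ∈? X) ×-dec (¬? (x ≟ p) ×-dec (d x X ≤? 1)))
  ... | yes l = l
  ... | no ¬l with p ∈? X
  ...   | no p∉X = let (x , q , h) = forest-leaf f (-⊆ (proj₂ ne)) in contradiction (x , q , (λ x≡p → p∉X (subst (_∈ X) x≡p q)) , h) ¬l
  ...   | yes p∈X = contradiction (cyc X (λ q → q) (p , p∈X) dn) f
    where
    big : ∀ {v} → v ∈ X - p → 2 ≤ d v X
    big {v} q = ≰⇒> λ h → ¬l (v , -⊆ q , proj₂ (-⁻ q) , h)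
    dp : 2 ≤ d p X
    dp = linear (d p X ∷ D (X - p) (X - p) ∷ card (X - p) ∷ [])
      ((1 , x₁ :+ con 2 , 2 :* x₂) ∷ (1 , 2 :* x₂ , x₀ :+ x₁) ∷ []) (0 , con 2 , x₀)
      (forest-edges (X - p) (Forest-mono -⊆ f) ne)
      (subst (2 * card (X - p) ≤_) (trans (D-splitʳ (split-remove p∈X) (X - p)) (cong (_+ D (X - p) (X - p)) (trans (D-｛｝ʳ _ p) d-self))) (sum-≥ 2 big))
    dn : Dense X
    dn {v} q with v ≟ p
    ... | yes refl = dp
    ... | no v≢p = big (-⁺ q v≢p)

  dense-card : ∀ {X} → Dense X → Nonempty X → 3 ≤ card X
  dense-card dn (v , p) = ≤-trans (s≤s (dn p)) (d<card p)

-- Saturation expressed through vertex sets.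

module Pairs {n : ℕ} (G : Graph n) where
  open Counting G public

  TwoCycles : Set
  TwoCycles = ∃ λ X → ∃ λ Y → Cyc X × Cyc Y × Disjoint X Y

  δ : Fin n → Fin n → ℕ
  δ x u = χ (eqb x u)

  δ-refl : ∀ x → δ x x ≡ 1
  δ-refl x with x ≟ x
  ... | yes _ = refl
  ... | no ¬p = contradiction refl ¬p

  δ-≢ : ∀ {x u} → x ≢ u → δ x u ≡ 0
  δ-≢ {x} {u} h with x ≟ u
  ... | yes p = contradiction p h
  ... | no _ = refl

  -- A u–v path P (as a set of minimum degree two once uv is added or doubled)
  -- and a cycle Q avoiding it.  For u = v it just says that Q avoids u.
  record PathCyc (u v : Fin n) : Set where
    field
      P Q   : VSet n
      u∈P   : u ∈ P
      v∈P   : v ∈ P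
      deg   : ∀ {x} → x ∈ P → 2 ≤ d x P + (δ x u + δ x v)
      dense : Dense Q
      some  : Nonempty Q
      apart : Disjoint P Q

  record Sat : Set where
    field
      no-two : ¬ TwoCycles
      path   : ∀ {u v} → u ≢ v → u ≁ v → PathCyc u v

Σ-δ : ∀ {n} (v : Fin n) (f : Fin n → ℕ) → ΣFin n (λ y → χ (eqb y v) * f y) ≡ f v
Σ-δ {suc n} v f = trans (Σ-punch v (λ y → χ (eqb y v) * f y))
  (trans (cong₂ _+_ at-v (trans (Σ-cong n off-v) (Σ-zero n))) (+-identityʳ (f v)))
  where
  at-v : χ (eqb v v) * f v ≡ f v
  at-v with v ≟ v
  ... | yes _ = +-identityʳ (f v)
  ... | no ¬p = contradiction refl ¬p
  off-v : ∀ j → χ (eqb (punchIn v j) v) * f (punchIn v j) ≡ 0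
  off-v j with punchIn v j ≟ v
  ... | yes p = contradiction p (punchInᵢ≢i v j)
  ... | no _ = refl

-- Cycles as vertex sequences versus dense sets.

module _ {n : ℕ} (G : Graph n) where
  open Pairs G

  cycle-set : Cycle G → VSet n
  cycle-set C = sep λ v → any? (λ i → vert C i ≟ v)

  on-cycle : ∀ (C : Cycle G) i → vert C i ∈ cycle-set C
  on-cycle C i = sep⁺ (λ v → any? (λ i → vert C i ≟ v)) (i , refl)

  cycle-dense : ∀ C → Dense (cycle-set C)
  cycle-dense C {v} p with sep⁻ (λ v → any? (λ i → vert C i ≟ v)) p
  ... | i , refl = at i
    where
    two : ∀ i j k → j ≢ k → vert C i ~ vert C j → vert C i ~ vert C k → 2 ≤ d (vert C i) (cycle-set C)
    two i j k j≢k q r = d≥2 (j≢k ∘ vert-inj C) q r (on-cycle C j) (on-cycle C k)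
    at : ∀ i → 2 ≤ d (vert C i) (cycle-set C)
    at zero = two _ (suc zero) (fromℕ _) (λ ()) (mem (vert-step C zero)) (~sym (mem (vert-close C)))
    at (suc j) with view j
    ... | ‵fromℕ = two _ (inject₁ (fromℕ _)) zero (λ ()) (~sym (mem (vert-step C (fromℕ _)))) (mem (vert-close C))
    ... | ‵inject₁ j′ = two _ (inject₁ (inject₁ j′)) (suc (suc j′)) apart
            (~sym (mem (vert-step C (inject₁ j′)))) (mem (vert-step C (suc j′)))
      where
      apart : inject₁ (inject₁ j′) ≢ suc (suc j′)
      apart h = m≢1+m+n (toℕ j′) (trans (sym (trans (toℕ-inject₁ (inject₁ j′)) (toℕ-inject₁ j′))) (trans (cong toℕ h) (cong suc (+-comm 1 (toℕ j′)))))

  -- A path stored with its newest vertex at index zero, where it is extended.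
  record Trail (X : VSet n) (k : ℕ) : Set where
    field
      at    : Fin (suc k) → Fin n
      inj   : ∀ {i j} → at i ≡ at j → i ≡ j
      link  : ∀ {i j} → toℕ j ≡ suc (toℕ i) → at i ~ at j
      within : ∀ i → at i ∈ X
  open Trail

  extend : ∀ {X k} (t : Trail X k) {z} → z ~ at t zero → z ∈ X → (∀ i → at t i ≢ z) → Trail X (suc k)
  extend t {z} p q new = record { at = f ; inj = f-inj ; link = f-link ; within = f-in }
    where
    f : _
    f zero = z
    f (suc i) = at t i
    f-inj : ∀ {i j} → f i ≡ f j → i ≡ j
    f-inj {zero} {zero} _ = refl
    f-inj {zero} {suc j} h = contradiction (sym h) (new j)
    f-inj {suc i} {zero} h = contradiction h (new i)
    f-inj {suc i} {suc j} h = cong suc (inj t h)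
    f-link : ∀ {i j} → toℕ j ≡ suc (toℕ i) → f i ~ f j
    f-link {zero} {suc zero} h = p
    f-link {suc i} {suc j} h = link t (suc-injective h)
    f-in : ∀ i → f i ∈ _
    f-in zero = q
    f-in (suc i) = within t i

  InCycle : VSet n → Cycle G → Set
  InCycle X C = ∀ i → vert C i ∈ X

  close-trail : ∀ {X k} (t : Trail X k) i {l} → toℕ i ≡ 2 + l → at t i ~ at t zero → Σ (Cycle G) (InCycle X)
  close-trail {X} {k} t i {l} eq p = record
    { len₋₃ = l ; vert = f ; inj = λ h → inject≤-injective le le _ _ (inj t h)
    ; step = λ j → true? (link t (trans (toℕ-inject≤ (suc j) le) (cong suc (sym (trans (toℕ-inject≤ (inject₁ j) le) (toℕ-inject₁ j))))))
    ; close = true? (subst (_~ at t zero) (cong (at t) (toℕ-injective (trans eq (sym (trans (toℕ-inject≤ (fromℕ (2 + l)) le) (toℕ-fromℕ (2 + l))))))) p) } , λ j → within t (inject≤ j le)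
    where
    le : 3 + l ≤ suc k
    le = subst (_≤ suc k) (cong suc eq) (toℕ<n i)
    f : Fin (3 + l) → Fin n
    f j = at t (inject≤ j le)

  -- The newest vertex has a neighbour in `X` other than its predecessor: if it is already on the
  -- path, a cycle closes, otherwise the path grows. The fuel `m` cannot run out, because a path has
  -- at most `n` distinct vertices.
  grow : ∀ {X} → Dense X → ∀ m k → n ≤ m + suc k → Trail X (suc k) → Σ (Cycle G) (InCycle X)
  grow dn zero k h t = contradiction (≤-trans (injective⇒≤ (inj t)) h) (<⇒≱ ≤-refl)
  grow dn (suc m) k h t with d-witness≢ (dn (within t zero)) (at t (suc zero))
  ... | z , p , q , z≢ with any? (λ i → at t i ≟ z)
  ...   | yes (zero , refl) = contradiction p ~irrefl
  ...   | yes (suc zero , refl) = contradiction refl z≢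
  ...   | yes (suc (suc i) , refl) = close-trail t (suc (suc i)) refl (~sym p)
  ...   | no new = grow dn m (suc k) (subst (n ≤_) (sym (+-suc m (suc k))) h)
                     (extend t (~sym p) q λ i r → new (i , r))

  dense⇒cycle : ∀ {X} → Dense X → Nonempty X → Σ (Cycle G) (InCycle X)
  dense⇒cycle {X} dn (v , p) with d-witness≢ (dn p) v
  ... | z , q , r , z≢v = grow dn n 0 (m≤m+n n 1) (extend start (~sym q) r λ { zero h → z≢v (sym h) })
    where
    start : Trail X 0
    start = record { at = λ _ → v ; inj = λ { {zero} {zero} _ → refl } ; link = λ { {zero} {zero} () } ; within = λ _ → p }

  two-cycles : TwoCycles → HasTwoDisjointCycles G
  two-cycles (X , Y , cyc A i s dn , cyc B j t dm , dis) with dense⇒cycle dn s | dense⇒cycle dm t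
  ... | C , c | E , f = C , E , λ k l h → dis (i (c k)) (j (subst (_∈ B) (sym h) (f l)))

  two-cycles⁻ : HasTwoDisjointCycles G → TwoCycles
  two-cycles⁻ (C , E , dis) = cycle-set C , cycle-set E , whole C , whole E , apart
    where
    whole : ∀ C → Cyc (cycle-set C)
    whole C = cyc (cycle-set C) (λ p → p) (_ , on-cycle C zero) (cycle-dense C)
    apart : Disjoint (cycle-set C) (cycle-set E)
    apart p q with sep⁻ (λ v → any? (λ i → vert C i ≟ v)) p | sep⁻ (λ v → any? (λ i → vert E i ≟ v)) q
    ... | i , refl | j , h = dis i j (sym h)

  module _ {u v : Fin n} (u≢v : u ≢ v) (u≁v : u ≁ v) where
    G⁺ : Graph n
    G⁺ = addEdge G u v u≢v

    module P⁺ = Pairs G⁺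

    -- The count is additive because `u ≁ v` and `u ≢ v`: no pair is both an old and a new edge, and
    -- none is new in both orientations.
    e⁺ : ∀ x y → P⁺.e x y ≡ e x y + (δ x u * δ y v + δ x v * δ y u)
    e⁺ x y with adj G x y in eq | x ≟ u | y ≟ v | x ≟ v | y ≟ u
    ... | true  | yes refl | yes refl | _ | _ = contradiction (mem eq) u≁v
    ... | true  | yes refl | no _ | yes refl | _ = contradiction refl u≢v
    ... | true  | yes _ | no _ | no _ | _ = refl
    ... | true  | no _ | yes _ | no _ | _ = refl
    ... | true  | no _ | _ | yes refl | yes refl = contradiction (~sym (mem eq)) u≁v
    ... | true  | no _ | _ | yes _ | no _ = refl
    ... | true  | no _ | no _ | no _ | _ = refl
    ... | false | yes refl | _ | yes refl | _ = contradiction refl u≢v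
    ... | false | yes _ | yes _ | no _ | _ = refl
    ... | false | yes _ | no _ | no _ | _ = refl
    ... | false | no _ | _ | yes _ | yes _ = refl
    ... | false | no _ | _ | yes _ | no _ = refl
    ... | false | no _ | _ | no _ | _ = refl

    d⁺ : ∀ x X → P⁺.d x X ≡ d x X + (δ x u * χ (has X v) + δ x v * χ (has X u))
    d⁺ x X = begin
      P⁺.d x X                                ≡⟨ P⁺.d-def x X ⟩
      ΣFin n (λ y → P⁺.e x y * c y)           ≡⟨ Σ-cong n (λ y → trans (cong (_* c y) (e⁺ x y)) (lem (e x y) (δ x u) (δ y v) (δ x v) (δ y u) (c y))) ⟩
      ΣFin n (λ y → e x y * c y + (δ x u * (δ y v * c y) + δ x v * (δ y u * c y)))
        ≡⟨ Σ-+ n _ _ ⟩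
      ΣFin n (λ y → e x y * c y) + ΣFin n (λ y → δ x u * (δ y v * c y) + δ x v * (δ y u * c y))
        ≡⟨ cong₂ _+_ (sym (d-def x X)) (Σ-+ n _ _) ⟩
      d x X + (ΣFin n (λ y → δ x u * (δ y v * c y)) + ΣFin n (λ y → δ x v * (δ y u * c y)))
        ≡⟨ cong (d x X +_) (cong₂ _+_ (trans (Σ-* n (δ x u) _) (cong (δ x u *_) (Σ-δ v c))) (trans (Σ-* n (δ x v) _) (cong (δ x v *_) (Σ-δ u c)))) ⟩
      d x X + (δ x u * c v + δ x v * c u) ∎
      where
      open ≡-Reasoning
      c : Fin n → ℕ
      c y = χ (has X y)
      lem : ∀ a p q r s t → (a + (p * q + r * s)) * t ≡ a * t + (p * (q * t) + r * (s * t))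
      lem = solve-∀

    d⁺-both : ∀ {X} → u ∈ X → v ∈ X → ∀ x → P⁺.d x X ≡ d x X + (δ x u + δ x v)
    d⁺-both {X} a b x = trans (d⁺ x X) (cong₂ (λ r s → d x X + (r + s))
      (trans (cong (δ x u *_) (∈⇒1 b)) (*-identityʳ (δ x u))) (trans (cong (δ x v *_) (∈⇒1 a)) (*-identityʳ (δ x v))))

    pathcyc⇒two : PathCyc u v → P⁺.TwoCycles
    pathcyc⇒two pc = P , Q , P⁺.cyc P (λ p → p) (u , u∈P) P-dense , P⁺.cyc Q (λ p → p) some Q-dense , apart
      where
      open PathCyc pc
      P-dense : P⁺.Dense P
      P-dense {x} p = subst (2 ≤_) (sym (d⁺-both u∈P v∈P x)) (deg p)
      Q-dense : P⁺.Dense Q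
      Q-dense {x} p = ≤-trans (dense p) (subst (d x Q ≤_) (sym (d⁺ x Q)) (m≤m+n _ _))

    old : ∀ {Z} → ¬ (u ∈ Z × v ∈ Z) → P⁺.Dense Z → Dense Z
    old {Z} h dz {x} p = subst (2 ≤_) (trans (d⁺ x Z) (trans (cong (d x Z +_) (cong₂ _+_ first second)) (+-identityʳ _))) (dz p)
      where
      first : δ x u * χ (has Z v) ≡ 0
      first with x ≟ u
      ... | yes refl = cong (1 *_) (∉⇒0 {X = Z} (λ q → h (p , q)))
      ... | no _ = refl
      second : δ x v * χ (has Z u) ≡ 0
      second with x ≟ v
      ... | yes refl = cong (1 *_) (∉⇒0 {X = Z} (λ q → h (q , p)))
      ... | no _ = refl

    path-from : ∀ {P Q} → P⁺.Dense P → u ∈ P → v ∈ P → P⁺.Dense Q → Nonempty Q → Disjoint P Q → PathCyc u v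
    path-from {P} {Q} dp a b dq s dis = record
      { P = P ; Q = Q ; u∈P = a ; v∈P = b ; some = s ; apart = dis
      ; dense = old (λ (p , _) → dis a p) dq
      ; deg = λ {x} p → subst (2 ≤_) (d⁺-both a b x) (dp p) }

    -- If neither set contained both ends of the new edge, both would be dense already in `G`. The
    -- one containing both ends is the path; the other, being disjoint from it, does not use the new
    -- edge.
    two⇒pathcyc : ¬ TwoCycles → P⁺.TwoCycles → PathCyc u v
    two⇒pathcyc no-two (X , Y , P⁺.cyc A i s dn , P⁺.cyc B j t dm , dis) with (u ∈? A) ×-dec (v ∈? A) | (u ∈? B) ×-dec (v ∈? B)
    ... | yes (a , b) | _ = path-from dn a b dm t (λ p q → dis (i p) (j q))
    ... | no _ | yes (a , b) = path-from dm a b dn s (λ p q → dis (i q) (j p))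
    ... | no ¬a | no ¬b = ⊥-elim (no-two (X , Y , cyc A i s (old ¬a dn) , cyc B j t (old ¬b dm) , dis))

Sat⇒Saturated : ∀ {n} {G : Graph n} → Pairs.Sat G → Saturated G
Sat⇒Saturated {G = G} sat = no-two ∘ two-cycles⁻ G ,
  λ u v u≢v eq → let u≁v = λ p → true≢false (true? p) eq in
    two-cycles (G⁺ G u≢v u≁v) (pathcyc⇒two G u≢v u≁v (path u≢v u≁v))
  where open Pairs.Sat sat

Saturated⇒Sat : ∀ {n} {G : Graph n} → Saturated G → Pairs.Sat G
Saturated⇒Sat {G = G} (none , add) = record
  { no-two = no-two
  ; path = λ {u} {v} u≢v u≁v → two⇒pathcyc G u≢v u≁v no-two
      (two-cycles⁻ (G⁺ G u≢v u≁v) (add u v u≢v (¬true (u≁v ∘ mem)))) }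
  where
  no-two : ¬ Pairs.TwoCycles G
  no-two = none ∘ two-cycles G

-- `edgeCount` sees an edge at its increasing ordered pair only; adding the transposed sum recovers
-- all ordered pairs.
edges-D : ∀ {n} (G : Graph n) → 2 * edgeCount G ≡ Counting.D G full full
edges-D {n} G = begin
  2 * ΣFin n (λ i → ΣFin n (f i))
    ≡⟨ lem (ΣFin n (λ i → ΣFin n (f i))) ⟩
  ΣFin n (λ i → ΣFin n (f i)) + ΣFin n (λ i → ΣFin n (f i))
    ≡⟨ cong (ΣFin n (λ i → ΣFin n (f i)) +_) (Σ-swap n n f) ⟩
  ΣFin n (λ i → ΣFin n (f i)) + ΣFin n (λ j → ΣFin n (λ i → f i j))
    ≡⟨ sym (Σ-+ n _ _) ⟩
  ΣFin n (λ i → ΣFin n (f i) + ΣFin n (λ j → f j i))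
    ≡⟨ Σ-cong n (λ i → trans (sym (Σ-+ n (f i) (λ j → f j i))) (Σ-cong n (both i))) ⟩
  ΣFin n (λ i → ΣFin n (λ j → χ (has (full {n}) i) * (e i j * χ (has (full {n}) j))))
    ≡⟨ sym (D-def full full) ⟩
  D full full ∎
  where
  open ≡-Reasoning
  open Counting G
  lem : ∀ a → 2 * a ≡ a + a
  lem = solve-∀
  f : Fin n → Fin n → ℕ
  f i j = if ⌊ toℕ i <? toℕ j ⌋ then (if adj G i j then 1 else 0) else 0
  as-e : ∀ i j → (if adj G i j then 1 else 0) ≡ e i j
  as-e i j with adj G i j
  ... | true = refl
  ... | false = refl
  up : ∀ {i j} → toℕ i < toℕ j → f i j ≡ e i j
  up {i} {j} p with toℕ i <? toℕ j
  ... | yes _ = as-e i j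
  ... | no q = contradiction p q
  down : ∀ {i j} → ¬ (toℕ i < toℕ j) → f i j ≡ 0
  down {i} {j} p with toℕ i <? toℕ j
  ... | yes q = contradiction q p
  ... | no _ = refl
  value : ∀ i j → e i j ≡ χ (has (full {n}) i) * (e i j * χ (has (full {n}) j))
  value i j = sym (trans (cong₂ (λ a b → a * (e i j * b)) (∈⇒1 (∈full {v = i})) (∈⇒1 (∈full {v = j}))) (trans (+-identityʳ _) (*-identityʳ _)))
  both : ∀ i j → f i j + f j i ≡ χ (has (full {n}) i) * (e i j * χ (has (full {n}) j))
  both i j with <-cmp (toℕ i) (toℕ j)
  ... | tri< p _ q = trans (cong₂ _+_ (up p) (down q)) (trans (+-identityʳ _) (value i j))
  ... | tri> q _ p = trans (cong₂ _+_ (down q) (up p)) (trans (cong χ (adj-sym G j i)) (value i j))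
  ... | tri≈ p r q with toℕ-injective r
  ...   | refl = trans (cong₂ _+_ (down p) (down p)) (trans (sym (e≡0 {i} {i} ~irrefl)) (value i i))

_∈ˡ?_ : ∀ {n} (v : Fin n) xs → Dec (v List.∈ xs)
_∈ˡ?_ {n} = Data.List.Membership.DecPropositional._∈?_ (_≟_ {n})

abstract
  ⟦_⟧ˢ : ∀ {n} → List (Fin n) → VSet n
  ⟦ xs ⟧ˢ = sep (λ v → v ∈ˡ? xs)

  listed : ∀ {n} {xs : List (Fin n)} {v} → v ∈ ⟦ xs ⟧ˢ → v List.∈ xs
  listed {xs = xs} = sep⁻ (λ v → v ∈ˡ? xs)

  list : ∀ {n} {xs : List (Fin n)} {v} → v List.∈ xs → v ∈ ⟦ xs ⟧ˢ
  list {xs = xs} = sep⁺ (λ v → v ∈ˡ? xs)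

-- Short cycles, and the ends of a forest.

module Cycles {n : ℕ} (G : Graph n) where
  open Pairs G public

  private
    pattern 1st = here refl
    pattern 2nd = there (here refl)
    pattern 3rd = there (there (here refl))
    pattern 4th = there (there (there (here refl)))
    pattern 5th = there (there (there (there (here refl))))

  triangle : ∀ {x y z} → x ~ y → y ~ z → z ~ x → Cyc ⟦ x ∷ y ∷ z ∷ [] ⟧ˢ
  triangle {x} {y} {z} p q r = cyc _ (λ s → s) (x , list 1st) (dense ∘ listed)
    where
    dense : ∀ {v} → v List.∈ x ∷ y ∷ z ∷ [] → 2 ≤ d v ⟦ x ∷ y ∷ z ∷ [] ⟧ˢ
    dense 1st = d≥2 (~⇒≢ q) p (~sym r) (list 2nd) (list 3rd)
    dense 2nd = d≥2 (~⇒≢ r) q (~sym p) (list 3rd) (list 1st)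
    dense 3rd = d≥2 (~⇒≢ p) r (~sym q) (list 1st) (list 2nd)

  quad : ∀ {x y z w} → x ~ y → y ~ z → z ~ w → w ~ x → x ≢ z → y ≢ w → Cyc ⟦ x ∷ y ∷ z ∷ w ∷ [] ⟧ˢ
  quad {x} {y} {z} {w} p q r s x≢z y≢w = cyc _ (λ s → s) (x , list 1st) (dense ∘ listed)
    where
    dense : ∀ {v} → v List.∈ x ∷ y ∷ z ∷ w ∷ [] → 2 ≤ d v ⟦ x ∷ y ∷ z ∷ w ∷ [] ⟧ˢ
    dense 1st = d≥2 y≢w p (~sym s) (list 2nd) (list 4th)
    dense 2nd = d≥2 x≢z (~sym p) q (list 1st) (list 3rd)
    dense 3rd = d≥2 y≢w (~sym q) r (list 2nd) (list 4th)
    dense 4th = d≥2 x≢z s (~sym r) (list 1st) (list 3rd)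

  pent : ∀ {x y z w u} → x ~ y → y ~ z → z ~ w → w ~ u → u ~ x →
         x ≢ z → y ≢ w → z ≢ u → w ≢ x → u ≢ y → Cyc ⟦ x ∷ y ∷ z ∷ w ∷ u ∷ [] ⟧ˢ
  pent {x} {y} {z} {w} {u} p q r s t xz yw zu wx uy = cyc _ (λ s → s) (x , list 1st) (dense ∘ listed)
    where
    dense : ∀ {v} → v List.∈ x ∷ y ∷ z ∷ w ∷ u ∷ [] → 2 ≤ d v ⟦ x ∷ y ∷ z ∷ w ∷ u ∷ [] ⟧ˢ
    dense 1st = d≥2 uy (~sym t) p (list 5th) (list 2nd)
    dense 2nd = d≥2 xz (~sym p) q (list 1st) (list 3rd)
    dense 3rd = d≥2 yw (~sym q) r (list 2nd) (list 4th)
    dense 4th = d≥2 zu (~sym r) s (list 3rd) (list 5th)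
    dense 5th = d≥2 wx (~sym s) t (list 4th) (list 1st)

  all-in : ∀ {xs : List (Fin n)} {X : VSet n} → All (_∈ X) xs → ⟦ xs ⟧ˢ ⊆ X
  all-in h p = All.lookup h (listed p)

  cyc-in : ∀ {xs : List (Fin n)} {X : VSet n} → Cyc ⟦ xs ⟧ˢ → All (_∈ X) xs → Cyc X
  cyc-in c h = Cyc-mono (all-in h) c

  list-card : ∀ (xs : List (Fin n)) → card ⟦ xs ⟧ˢ ≤ length xs
  list-card [] = ≤-trans (≤-reflexive (card≡sum (⟦_⟧ˢ {n} []))) (sum-≤ {X = ⟦_⟧ˢ {n} []} 0 λ p → contradiction (listed p) λ ())
  list-card (x ∷ xs) = ≤-trans (card-mono {Y = ⟦ xs ⟧ˢ ∪ ｛ x ｝} cover)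
    (≤-trans (card-∪-≤ ⟦ xs ⟧ˢ) (s≤s (list-card xs)))
    where
    cover : ⟦ x ∷ xs ⟧ˢ ⊆ ⟦ xs ⟧ˢ ∪ ｛ x ｝
    cover p with listed p
    ... | here refl = ∪ʳ (x∈｛x｝ x)
    ... | there q = ∪ˡ (list q)
    card-∪-≤ : ∀ X → card (X ∪ ｛ x ｝) ≤ suc (card X)
    card-∪-≤ X with x ∈? X
    ... | yes p = m≤n⇒m≤1+n (card-mono λ q → [ q ]′)
      where
      [_]′ : ∀ {v} → v ∈ X ∪ ｛ x ｝ → v ∈ X
      [ q ]′ with ∪⁻ q
      ... | inj₁ r = r
      ... | inj₂ r = subst (_∈ X) (sym (∈｛｝ r)) p
    ... | no p = ≤-reflexive (trans (card-∪｛｝ p) (+-comm _ 1))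

  module NoTwo (no-two : ¬ TwoCycles) where
    clash : ∀ {X Y} → Cyc X → Cyc Y → Disjoint X Y → ⊥
    clash c c′ dis = no-two (_ , _ , c , c′ , dis)

    clash-lists : ∀ {xs ys} → Cyc ⟦ xs ⟧ˢ → Cyc ⟦ ys ⟧ˢ → All (λ x → All (x ≢_) ys) xs → ⊥
    clash-lists c c′ h = clash c c′ λ p q → All.lookup (All.lookup h (listed p)) (listed q) refl

  -- Ends of a forest F: the vertices q that become leaves once the leaves of F are removed.

  module Ends (F : VSet n) where
    inner? : ∀ v → Dec (v ∈ F × 2 ≤ d v F)
    inner? v = (v ∈? F) ×-dec (2 ≤? d v F)

    F′ : VSet n
    F′ = sep inner?

    record End (q : Fin n) : Set where
      constructor end
      field
        q∈F : q ∈ F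
        big : 2 ≤ d q F
        few : d q F′ ≤ 1

    -- The cases are: `F′` is empty, `F′` is a single vertex, or `F′` has two vertices of degree at
    -- most one, as every forest on at least two vertices does.
    data Shape : Set where
      flat : (∀ {v} → v ∈ F → d v F ≤ 1) → Shape
      star : ∀ q → End q → (∀ {v} → v ∈ F → v ≢ q → d v F ≤ 1) → Shape
      ends : ∀ q r → q ≢ r → End q → End r → Shape

    small : ∀ {v} → v ∈ F → v ∉ F′ → d v F ≤ 1
    small {v} p q = ≤-pred (≰⇒> λ h → q (sep⁺ inner? (p , h)))

    shape : Forest F → Shape
    shape f with nonempty? F′
    ... | no ¬ne = flat λ p → small p λ q → ¬ne (_ , q)
    ... | yes (_ , p) with forest-leaf (Forest-mono (proj₁ ∘ sep⁻ inner?) f) p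
    ...   | q , q∈ , h with nonempty? (F′ - q)
    ...     | no ¬ne = star q (end (proj₁ (sep⁻ inner? q∈)) (proj₂ (sep⁻ inner? q∈)) h)
                (λ r v≢q → small r λ s → ¬ne (_ , -⁺ s v≢q))
    ...     | yes ne with forest-leaf≢ q (Forest-mono (proj₁ ∘ sep⁻ inner?) f) ne
    ...       | r , r∈ , r≢q , h′ = ends q r (≢-sym r≢q)
                  (end (proj₁ (sep⁻ inner? q∈)) (proj₂ (sep⁻ inner? q∈)) h)
                  (end (proj₁ (sep⁻ inner? r∈)) (proj₂ (sep⁻ inner? r∈)) h′)

    Leaf : Fin n → Fin n → Set
    Leaf q v = v ∈ F × q ~ v × d v F ≤ 1

    leaf? : ∀ q v → Dec (Leaf q v)
    leaf? q v = (v ∈? F) ×-dec ((q ~? v) ×-dec (d v F ≤? 1))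

    claw? : ∀ q v → Dec (v ≡ q ⊎ Leaf q v)
    claw? q v = (v ≟ q) ⊎-dec leaf? q v

    -- For an end `q`, at most one edge joins this set to the rest of `F`. It can be split off
    -- together with a removed vertex while the rest keeps nearly all its degrees.
    claw : Fin n → VSet n
    claw q = sep (claw? q)

    q∈claw : ∀ {q} → q ∈ claw q
    q∈claw {q} = sep⁺ (claw? q) (inj₁ refl)

    leaf∈claw : ∀ {q v} → Leaf q v → v ∈ claw q
    leaf∈claw {q} l = sep⁺ (claw? q) (inj₂ l)

    claw⁻ : ∀ {q v} → v ∈ claw q → v ≡ q ⊎ Leaf q v
    claw⁻ {q} = sep⁻ (claw? q)

    leaf-nbr : ∀ {q v u} → q ∈ F → Leaf q v → u ∈ F → v ~ u → u ≡ q
    leaf-nbr q∈F (v∈F , q~v , h) u∈F v~u = d≤1⇒≡ h v~u (~sym q~v) u∈F q∈F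

    module _ {q : Fin n} (E : End q) where
      open End E

      claw⊆F : claw q ⊆ F
      claw⊆F p with claw⁻ p
      ... | inj₁ refl = q∈F
      ... | inj₂ (r , _) = r

      -- A neighbour of `q` in `F` outside the claw is not a leaf, hence lies in `F′`, where `q` has
      -- at most one neighbour.
      d-rest : d q (F ∖ claw q) ≤ 1
      d-rest = ≤-trans (d-mono-nbr λ s r → let (a , b) = ∖⁻ r in sep⁺ inner? (a , ≰⇒> λ h → b (leaf∈claw (a , s , h)))) few
        where
        d-mono-nbr : ∀ {X Y} → (∀ {u} → q ~ u → u ∈ X → u ∈ Y) → d q X ≤ d q Y
        d-mono-nbr h = card-mono λ p → let (a , b) = ∩⁻ p in ∩⁺ a (h a b)

      boundary : D (F ∖ claw q) (claw q) ≡ d q (F ∖ claw q)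
      boundary = trans (D-sym _ (claw q)) (trans (sum-remove q∈claw _)
        (trans (cong (d q (F ∖ claw q) +_) (n≤0⇒n≡0 (sum-≤ 0 leaves))) (+-identityʳ _)))
        where
        leaves : ∀ {v} → v ∈ claw q - q → d v (F ∖ claw q) ≤ 0
        leaves p with claw⁻ (-⊆ p)
        ... | inj₁ v≡q = contradiction v≡q (proj₂ (-⁻ p))
        ... | inj₂ l = ≁⇒d≤0 λ r s → proj₂ (∖⁻ r) (subst (_∈ claw q) (sym (leaf-nbr q∈F l (∖⊆ r) s)) q∈claw)

      boundary≤1 : D (F ∖ claw q) (claw q) ≤ 1
      boundary≤1 = subst (_≤ 1) (sym boundary) d-rest

      outer : ∀ {k} → suc k ≤ d q F → k ≤ d q (F ∖ F′)
      outer h = +-cancelˡ-≤ 1 _ _ (≤-trans h (≤-trans (≤-reflexive (d-split (split-∖ (proj₁ ∘ sep⁻ inner?)) q)) (+-monoˡ-≤ (d q (F ∖ F′)) few)))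

      to-leaf : ∀ {v} → q ~ v → v ∈ F ∖ F′ → Leaf q v
      to-leaf p r = ∖⊆ r , p , small (∖⊆ r) (proj₂ (∖⁻ r))

      a-leaf : ∃ (Leaf q)
      a-leaf with d-witness (outer big)
      ... | v , p , r = v , to-leaf p r

      other-leaf : 3 ≤ d q F → ∀ l → ∃ λ v → Leaf q v × v ≢ l
      other-leaf h l with d-witness≢ (outer h) l
      ... | v , p , r , v≢l = v , to-leaf p r , v≢l

      other-leaf? : ∀ l → (∃ λ v → Leaf q v × v ≢ l) ⊎ d q F ≤ 2
      other-leaf? l with 3 ≤? d q F
      ... | yes h = inj₁ (other-leaf h l)
      ... | no ¬h = inj₂ (≤-pred (≰⇒> ¬h))

      leaf≢q : ∀ {v} → Leaf q v → v ≢ q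
      leaf≢q (_ , p , _) = ≢-sym (~⇒≢ p)

    claws-apart : ∀ {q r} → q ≢ r → End q → End r → Disjoint (claw q) (claw r)
    claws-apart q≢r E E′ p s with claw⁻ p | claw⁻ s
    ... | inj₁ refl | inj₁ refl = q≢r refl
    ... | inj₁ refl | inj₂ (_ , _ , h) = absurd (≤-pred (≤-trans (End.big E) h))
    ... | inj₂ (_ , _ , h) | inj₁ refl = absurd (≤-pred (≤-trans (End.big E′) h))
    ... | inj₂ l | inj₂ l′ = q≢r (leaf-nbr (End.q∈F E′) l′ (End.q∈F E) (~sym (proj₁ (proj₂ l))))

-- Two sources of universal vertices: covers by three vertices and tight edge counts.

module Covers {n : ℕ} (G : Graph n) (sat : Pairs.Sat G) where
  open Cycles G public
  open Sat sat public
  open NoTwo no-two public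

  Universal : Fin n → Set
  Universal h = ∀ v → v ≢ h → h ~ v

  three : ∀ a b c (v : Fin n) → (v ≡ a ⊎ v ≡ b ⊎ v ≡ c) ⊎ (v ≢ a × v ≢ b × v ≢ c)
  three a b c v with v ≟ a | v ≟ b | v ≟ c
  ... | yes p | _ | _ = inj₁ (inj₁ p)
  ... | no _ | yes p | _ = inj₁ (inj₂ (inj₁ p))
  ... | no _ | no _ | yes p = inj₁ (inj₂ (inj₂ p))
  ... | no p | no q | no r = inj₂ (p , q , r)

  Covering : Fin n → Fin n → Fin n → Set
  Covering a b c = ∀ {u v} → (u ≢ a × u ≢ b × u ≢ c) → (v ≢ a × v ≢ b × v ≢ c) → u ≁ v

  -- Suppose `a ≁ v`. The cycle `Q` avoids `a`, and a vertex outside the cover has neighbours only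
  -- in it, so `Q` must contain both `b` and `c`. The path `P` avoids these two, so the neighbour of
  -- `v` on `P` is either `a` or a vertex outside the cover, and both are impossible.
  covering⇒universal : ∀ {a b c} → b ≢ c → Covering a b c → Universal a
  covering⇒universal {a} {b} {c} b≢c cov v v≢a with a ~? v
  ... | yes p = p
  ... | no a≁v = ⊥-elim contra
    where
    open PathCyc (path (≢-sym v≢a) a≁v)
    Q≢a : ∀ {u} → u ∈ Q → u ≢ a
    Q≢a p refl = apart u∈P p
    other : ∀ {q} → (q ≢ a × q ≢ b × q ≢ c) → ∀ {w} → q ~ w → w ∈ Q → w ≡ b ⊎ w ≡ c
    other out {w} q~w w∈Q with three a b c w
    ... | inj₁ (inj₁ w≡a) = contradiction w≡a (Q≢a w∈Q)
    ... | inj₁ (inj₂ p) = p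
    ... | inj₂ out′ = contradiction q~w (cov out out′)
    from-out : ∀ {q} → q ∈ Q → (q ≢ a × q ≢ b × q ≢ c) → b ∈ Q × c ∈ Q
    from-out {q} q∈Q out with d-witness≢ (dense q∈Q) b | d-witness≢ (dense q∈Q) c
    ... | w , q~w , w∈Q , w≢b | u , q~u , u∈Q , u≢c with other out q~w w∈Q | other out q~u u∈Q
    ...   | inj₁ w≡b | _ = contradiction w≡b w≢b
    ...   | inj₂ _ | inj₂ u≡c = contradiction u≡c u≢c
    ...   | inj₂ refl | inj₁ refl = u∈Q , w∈Q
    from-one : ∀ {q z} → q ∈ Q → (∀ {w} → w ∈ Q → w ≢ q → w ≢ z → (w ≢ a × w ≢ b × w ≢ c)) → b ∈ Q × c ∈ Q
    from-one {q} {z} q∈Q h with d-witness≢ (dense q∈Q) z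
    ... | w , q~w , w∈Q , w≢z = from-out w∈Q (h w∈Q (≢-sym (~⇒≢ q~w)) w≢z)
    bc∈Q : b ∈ Q × c ∈ Q
    bc∈Q with some
    ... | q , q∈Q with three a b c q
    ...   | inj₂ out = from-out q∈Q out
    ...   | inj₁ (inj₁ q≡a) = contradiction q≡a (Q≢a q∈Q)
    ...   | inj₁ (inj₂ (inj₁ refl)) = from-one {z = c} q∈Q λ w∈Q w≢b w≢c → Q≢a w∈Q , w≢b , w≢c
    ...   | inj₁ (inj₂ (inj₂ refl)) = from-one {z = b} q∈Q λ w∈Q w≢c w≢b → Q≢a w∈Q , w≢b , w≢c
    P≢b : ∀ {u} → u ∈ P → u ≢ b
    P≢b p refl = apart p (proj₁ bc∈Q)
    P≢c : ∀ {u} → u ∈ P → u ≢ c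
    P≢c p refl = apart p (proj₂ bc∈Q)
    contra : ⊥
    contra with d-witness {v} {P} (≤-pred (subst (2 ≤_) (trans (cong (d v P +_) (cong₂ _+_ (δ-≢ v≢a) (δ-refl v))) (+-comm (d v P) 1)) (deg v∈P)))
    ... | w , v~w , w∈P with three a b c w
    ...   | inj₁ (inj₁ refl) = a≁v (~sym v~w)
    ...   | inj₁ (inj₂ (inj₁ w≡b)) = P≢b w∈P w≡b
    ...   | inj₁ (inj₂ (inj₂ w≡c)) = P≢c w∈P w≡c
    ...   | inj₂ out = cov (v≢a , P≢b v∈P , P≢c v∈P) out v~w

  -- As A ∪ X contains a cycle, B ∪ R is a forest; comparing its number of edges
  -- with the degrees in R leaves no slack.
  squeeze : ∀ {A B R X} → Cyc (A ∪ X) → Disjoint (A ∪ X) (B ∪ R) → Disjoint B R →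
            card B ≡ 2 → 2 ≤ D B B → Nonempty R → Forest R →
            (∀ {r} → r ∈ R → 3 ≤ d r R + d r X + (d r B + d r A)) →
            (∀ {r} → r ∈ R → d r A ≤ 1) → D R X ≤ 1 →
            1 ≤ D R X × (∀ {r} → r ∈ R → 1 ≤ d r A) × D R B ≤ 1
  squeeze {A} {B} {R} {X} c dis BR B₂ BB ne f deg RA RX =
    linear ρ ((1 , con 2 :+ 2 :* x₁ :+ x₀ :+ con 2 , con 4 :+ 2 :* x₄) ∷ (1 , x₀ :+ con 2 , 2 :* x₄) ∷ (2 , 3 :* x₄ , x₀ :+ x₂ :+ (x₁ :+ x₃)) ∷ (2 , x₃ , 1 :* x₄) ∷ [])
      (1 , con 1 , x₂) h₁ h₂ h₃ (sum-≤ 1 RA)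
    , sum-tight-≤ 1 RA (linear ρ ((1 , con 2 :+ 2 :* x₁ :+ x₀ :+ con 2 , con 4 :+ 2 :* x₄) ∷ (1 , x₀ :+ con 2 , 2 :* x₄) ∷ (2 , 3 :* x₄ , x₀ :+ x₂ :+ (x₁ :+ x₃)) ∷ (2 , x₂ , con 1) ∷ [])
      (1 , 1 :* x₄ , x₃) h₁ h₂ h₃ RX)
    , linear ρ ((1 , con 2 :+ 2 :* x₁ :+ x₀ :+ con 2 , con 4 :+ 2 :* x₄) ∷ (1 , 3 :* x₄ , x₀ :+ x₂ :+ (x₁ :+ x₃)) ∷ (1 , x₂ , con 1) ∷ (1 , x₃ , 1 :* x₄) ∷ [])
      (0 , x₁ , con 1) h₁ h₃ RX (sum-≤ 1 RA)
    where
    ρ = D R R ∷ D R B ∷ D R X ∷ D R A ∷ card R ∷ []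
    -- Edge bound for the forest `B ∪ R`: it has `card R + 2` vertices, and the edge inside `B` adds
    -- 2 to the doubled count.
    h₁ : 2 + 2 * D R B + D R R + 2 ≤ 4 + 2 * card R
    h₁ = ≤-trans (+-monoˡ-≤ 2 (≤-trans (+-monoˡ-≤ (D R R) (+-mono-≤ BB (≤-reflexive (cong (2 *_) (D-sym R B))))) (≤-reflexive (sym (D-split (split-∪ BR))))))
      (≤-trans (forest-edges (B ∪ R) (λ c′ → no-two (_ , _ , c , c′ , dis)) (_ , ∪ʳ (proj₂ ne)))
        (≤-reflexive (trans (cong (2 *_) (trans (card-split (split-∪ BR)) (cong (_+ card R) B₂))) (*-distribˡ-+ 2 2 (card R)))))
    h₂ : D R R + 2 ≤ 2 * card R
    h₂ = forest-edges R f ne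
    h₃ : 3 * card R ≤ D R R + D R X + (D R B + D R A)
    h₃ = ≤-trans (sum-≥ 3 deg) (≤-reflexive (trans (sum-+ R _ _) (cong₂ _+_ (sum-+ R _ _) (sum-+ R _ _))))

  pair : Fin n → Fin n → VSet n
  pair a b = ｛ a ｝ ∪ ｛ b ｝

  pair⁻ : ∀ {a b v} → v ∈ pair a b → v ≡ a ⊎ v ≡ b
  pair⁻ p with ∪⁻ p
  ... | inj₁ q = inj₁ (∈｛｝ q)
  ... | inj₂ q = inj₂ (∈｛｝ q)

  a∈pair : ∀ {a b} → a ∈ pair a b
  a∈pair = ∪ˡ (x∈｛x｝ _)

  b∈pair : ∀ {a b} → b ∈ pair a b
  b∈pair = ∪ʳ (x∈｛x｝ _)

  module _ {a b : Fin n} (a≢b : a ≢ b) where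
    d-pair : ∀ v → d v (pair a b) ≡ e v a + e v b
    d-pair v = trans (d-∪｛｝ (λ p → a≢b (sym (∈｛｝ p))) v) (cong (_+ e v b) (d-｛｝ v a))

    card-pair : card (pair a b) ≡ 2
    card-pair = trans (card-∪｛｝ (λ p → a≢b (sym (∈｛｝ p)))) (cong (_+ 1) (card-｛｝ a))

    D-pair : a ~ b → 2 ≤ D (pair a b) (pair a b)
    D-pair p = ≤-trans (≤-reflexive (sym (cong (1 *_) card-pair))) (sum-≥ 1 λ q → at (pair⁻ q))
      where
      at : ∀ {v} → v ≡ a ⊎ v ≡ b → 1 ≤ d v (pair a b)
      at (inj₁ refl) = d≥1 p b∈pair
      at (inj₂ refl) = d≥1 (~sym p) a∈pair

-- Minimum degree three: removing a triangle, and forests with two ends.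

module Triangles {n : ℕ} (G : Graph n) (sat : Pairs.Sat G) where
  open Covers G sat public

  module _ (F : VSet n) where
    open Ends F

    record Tri (a b c : Fin n) : Set where
      field
        ab    : a ~ b
        bc    : b ~ c
        ca    : c ~ a
        out   : ∀ {v} → v ∈ F → v ≢ a × v ≢ b × v ≢ c
        rest  : ∀ {v} → v ≢ a → v ≢ b → v ≢ c → v ∈ F
        deg₃  : ∀ {v} → v ∈ F → 3 ≤ d v F + (e v a + e v b + e v c)

    +-rot : ∀ x y z → x + y + z ≡ y + z + x
    +-rot = solve-∀

    +-flip : ∀ x y z → x + y + z ≡ y + x + z
    +-flip = solve-∀

    rotate : ∀ {a b c} → Tri a b c → Tri b c a
    rotate t = record
      { ab = bc ; bc = ca ; ca = ab ; out = λ p → let (x , y , z) = out p in y , z , x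
      ; rest = λ p q r → rest r p q ; deg₃ = λ {v} p → subst (λ k → 3 ≤ d v F + k) (+-rot (e v _) _ _) (deg₃ p) }
      where open Tri t

    flip : ∀ {a b c} → Tri a b c → Tri b a c
    flip t = record
      { ab = ~sym ab ; bc = ~sym ca ; ca = ~sym bc ; out = λ p → let (x , y , z) = out p in y , x , z
      ; rest = λ p q r → rest q p r ; deg₃ = λ {v} p → subst (λ k → 3 ≤ d v F + k) (+-flip (e v _) _ _) (deg₃ p) }
      where open Tri t

    -- `F` determines the set of the three removed vertices, so this existential expresses a
    -- statement up to renaming them; `rotate` and `flip` generate the renamings.
    Labels : (Fin n → Fin n → Fin n → Set) → Set
    Labels P = ∃ λ a → ∃ λ b → ∃ λ c → Tri a b c × P a b c

    module _ {a b c : Fin n} (t : Tri a b c) where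
      open Tri t

      two-labels : ∀ {l} → l ∈ F → d l F ≤ 1 → 2 ≤ e l a + e l b + e l c
      two-labels {l} p h = linear (d l F ∷ e l a + e l b + e l c ∷ []) ((1 , x₀ , con 1) ∷ (1 , con 3 , x₀ :+ x₁) ∷ [])
        (0 , con 2 , x₁) h (deg₃ p)

      pick-two : ∀ {l} → l ∈ F → d l F ≤ 1 → (l ~ a × l ~ b) ⊎ (l ~ b × l ~ c) ⊎ (l ~ c × l ~ a)
      pick-two {l} p h with l ~? a | l ~? b | l ~? c
      ... | yes x | yes y | _ = inj₁ (x , y)
      ... | _ | yes y | yes z = inj₂ (inj₁ (y , z))
      ... | yes x | _ | yes z = inj₂ (inj₂ (z , x))
      ... | no x | no y | _ = absurd (≤-pred (≤-trans (two-labels p h) (≤-trans (≤-reflexive (cong (_+ e l c) (cong₂ _+_ (e≡0 x) (e≡0 y)))) (e≤1 l c))))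
      ... | no x | _ | no z = absurd (≤-pred (≤-trans (two-labels p h) (≤-trans (≤-reflexive (trans (cong₂ (λ i k → i + e l b + k) (e≡0 x) (e≡0 z)) (+-identityʳ _))) (e≤1 l b))))
      ... | _ | no y | no z = absurd (≤-pred (≤-trans (two-labels p h) (≤-trans (≤-reflexive (trans (cong₂ (λ i k → e l a + i + k) (e≡0 y) (e≡0 z)) (trans (+-identityʳ _) (+-identityʳ _)))) (e≤1 l a))))

      one-label : ∀ {q} → q ∈ F → d q F ≤ 2 → q ~ a ⊎ q ~ b ⊎ q ~ c
      one-label {q} p h with q ~? a | q ~? b | q ~? c
      ... | yes x | _ | _ = inj₁ x
      ... | _ | yes y | _ = inj₂ (inj₁ y)
      ... | _ | _ | yes z = inj₂ (inj₂ z)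
      ... | no x | no y | no z = absurd (≤-pred (≤-pred (≤-trans (deg₃ p) (≤-trans (≤-reflexive
              (trans (cong (d q F +_) (cong₂ _+_ (cong₂ _+_ (e≡0 x) (e≡0 y)) (e≡0 z))) (+-identityʳ _))) h))))

      forest : Forest F
      forest f = clash (triangle ab bc ca) f λ p q → case (listed p) (out q)
        where
        case : ∀ {v} → v List.∈ a ∷ b ∷ c ∷ [] → v ≢ a × v ≢ b × v ≢ c → ⊥
        case (here p) (x , _ , _) = x p
        case (there (here p)) (_ , y , _) = y p
        case (there (there (here p))) (_ , _ , z) = z p

      -- The case `A` = {a}, `B` = {b, c} of `squeeze`. A cycle in `｛ a ｝ ∪ X` makes `b`, `c` and
      -- the rest of `F` a forest, which is too sparse for minimum degree three unless the whole
      -- rest is adjacent to `a`.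
      fills : ∀ {X} → X ⊆ F → Cyc (｛ a ｝ ∪ X) → D (F ∖ X) X ≤ 1 → Nonempty (F ∖ X) →
              1 ≤ D (F ∖ X) X × (∀ {r} → r ∈ F ∖ X → r ~ a) × D (F ∖ X) (pair b c) ≤ 1
      fills {X} X⊆F c′ h ne = finish (squeeze c′ dis BR (card-pair (~⇒≢ bc)) (D-pair (~⇒≢ bc) bc) ne
              (Forest-mono ∖⊆ forest) degs (λ {r} _ → ≤-trans (≤-reflexive (d-｛｝ r a)) (e≤1 r a)) h)
        where
        not-in-pair : ∀ {v} → v ∈ F → v ∉ pair b c
        not-in-pair p q with pair⁻ q
        ... | inj₁ refl = proj₁ (proj₂ (out p)) refl
        ... | inj₂ refl = proj₂ (proj₂ (out p)) refl
        BR : Disjoint (pair b c) (F ∖ X)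
        BR p q = not-in-pair (∖⊆ q) p
        dis : Disjoint (｛ a ｝ ∪ X) (pair b c ∪ (F ∖ X))
        dis p q with ∪⁻ p | ∪⁻ q
        ... | inj₂ x | inj₁ y = not-in-pair (X⊆F x) y
        ... | inj₂ x | inj₂ y = proj₂ (∖⁻ y) x
        ... | inj₁ x | inj₂ y = proj₁ (out (∖⊆ y)) (∈｛｝ x)
        ... | inj₁ x | inj₁ y with ∈｛｝ x | pair⁻ y
        ...   | refl | inj₁ r = ~⇒≢ ab r
        ...   | refl | inj₂ r = ~⇒≢ ca (sym r)
        degs : ∀ {r} → r ∈ F ∖ X → 3 ≤ d r (F ∖ X) + d r X + (d r (pair b c) + d r ｛ a ｝)
        degs {r} p = subst (3 ≤_) (cong₂ _+_ (trans (d-split (split-∖ X⊆F) r) (+-comm (d r X) _))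
          (trans (+-rot (e r a) (e r b) (e r c)) (cong₂ _+_ (sym (d-pair (~⇒≢ bc) r)) (sym (d-｛｝ r a))))) (deg₃ (∖⊆ p))
        label : ∀ r → 1 ≤ e r a → r ~ a
        label r h with r ~? a
        ... | yes p = p
        ... | no p = absurd (subst (1 ≤_) (e≡0 p) h)
        finish : 1 ≤ D (F ∖ X) X × (∀ {r} → r ∈ F ∖ X → 1 ≤ d r ｛ a ｝) × D (F ∖ X) (pair b c) ≤ 1 →
                 1 ≤ D (F ∖ X) X × (∀ {r} → r ∈ F ∖ X → r ~ a) × D (F ∖ X) (pair b c) ≤ 1
        finish (x , y , z) = x , (λ {r} p → label r (subst (1 ≤_) (d-｛｝ r a) (y p))) , z

      universal : (∀ {v} → v ∈ F → v ~ a) → Universal a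
      universal h v v≢a with three a b c v
      ... | inj₁ (inj₁ p) = contradiction p v≢a
      ... | inj₁ (inj₂ (inj₁ refl)) = ab
      ... | inj₁ (inj₂ (inj₂ refl)) = ~sym ca
      ... | inj₂ (p , q , r) = ~sym (h (rest p q r))

      apex-triangle : ∀ {x y} → x ~ y → x ~ a → y ~ a → ∀ {X} → x ∈ X → y ∈ X → Cyc (｛ a ｝ ∪ X)
      apex-triangle p q r x∈ y∈ = cyc-in (triangle (~sym q) p r) (∪ˡ (x∈｛x｝ a) ∷ ∪ʳ x∈ ∷ ∪ʳ y∈ ∷ [])

      apex-claw : ∀ {q l l′} → End q → Leaf q l → Leaf q l′ → l ≢ l′ → l ~ a → l′ ~ a → Cyc (｛ a ｝ ∪ claw q)
      apex-claw {q} E l l′ l≢l′ p p′ = cyc-in (quad (~sym p) (~sym (proj₁ (proj₂ l))) (proj₁ (proj₂ l′)) p′ (≢-sym (proj₁ (out (End.q∈F E)))) l≢l′)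
        (∪ˡ (x∈｛x｝ a) ∷ ∪ʳ (leaf∈claw l) ∷ ∪ʳ q∈claw ∷ ∪ʳ (leaf∈claw l′) ∷ [])

    -- Each leaf sees two of the three triangle vertices, and two such pairs always intersect.
    share : ∀ {a b c l l′} → Tri a b c → l ∈ F → d l F ≤ 1 → l′ ∈ F → d l′ F ≤ 1 → Labels λ x y z → l ~ x × l′ ~ x
    share t p h p′ h′ with pick-two t p h | pick-two t p′ h′
    ... | inj₁ (x , y) | inj₁ (x′ , y′) = _ , _ , _ , t , x , x′
    ... | inj₁ (x , y) | inj₂ (inj₁ (y′ , z′)) = _ , _ , _ , rotate t , y , y′
    ... | inj₁ (x , y) | inj₂ (inj₂ (z′ , x′)) = _ , _ , _ , t , x , x′
    ... | inj₂ (inj₁ (y , z)) | inj₁ (x′ , y′) = _ , _ , _ , rotate t , y , y′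
    ... | inj₂ (inj₁ (y , z)) | inj₂ (inj₁ (y′ , z′)) = _ , _ , _ , rotate t , y , y′
    ... | inj₂ (inj₁ (y , z)) | inj₂ (inj₂ (z′ , x′)) = _ , _ , _ , rotate (rotate t) , z , z′
    ... | inj₂ (inj₂ (z , x)) | inj₁ (x′ , y′) = _ , _ , _ , t , x , x′
    ... | inj₂ (inj₂ (z , x)) | inj₂ (inj₁ (y′ , z′)) = _ , _ , _ , rotate (rotate t) , z , z′
    ... | inj₂ (inj₂ (z , x)) | inj₂ (inj₂ (z′ , x′)) = _ , _ , _ , t , x , x′

    two : ∀ {a b c l} → Tri a b c → l ∈ F → d l F ≤ 1 → Labels λ x y z → l ~ x × l ~ y
    two t p h with pick-two t p h
    ... | inj₁ r = _ , _ , _ , t , r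
    ... | inj₂ (inj₁ r) = _ , _ , _ , rotate t , r
    ... | inj₂ (inj₂ r) = _ , _ , _ , rotate (rotate t) , r

    Rigid : Fin n → Set
    Rigid q = ∃ λ l → Leaf q l × Labels λ x y z → l ~ x × l ~ y × q ~ z

    -- Two leaves of `q` share a triangle vertex and close a quadrilateral with it. With a single
    -- leaf, `q` has degree at most two in `F` and sees a triangle vertex itself: if the leaf sees
    -- it too there is a triangle, otherwise the configuration is `Rigid`.
    apex-or-rigid : ∀ {a b c q} → Tri a b c → End q → (Labels λ x _ _ → Cyc (｛ x ｝ ∪ claw q)) ⊎ Rigid q
    apex-or-rigid {q = q} t E with a-leaf E
    ... | l , L@(l∈F , q~l , h) with other-leaf? E l
    ...   | inj₁ (l′ , L′@(l′∈F , _ , h′) , l′≢l) with share t l∈F h l′∈F h′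
    ...     | _ , _ , _ , t′ , p , p′ = inj₁ (_ , _ , _ , t′ , apex-claw t′ E L L′ (≢-sym l′≢l) p p′)
    apex-or-rigid {q = q} t E | l , L@(l∈F , q~l , h) | inj₂ dq with two t l∈F h
    ... | _ , _ , _ , t′ , p , p′ with one-label t′ (End.q∈F E) dq
    ...   | inj₁ r = inj₁ (_ , _ , _ , t′ , apex-triangle t′ q~l r p q∈claw (leaf∈claw L))
    ...   | inj₂ (inj₁ r) = inj₁ (_ , _ , _ , rotate t′ , apex-triangle (rotate t′) q~l r p′ q∈claw (leaf∈claw L))
    ...   | inj₂ (inj₂ r) = inj₂ (l , L , _ , _ , _ , t′ , p , p′ , r)

    -- Filling from the claw at `q` makes everything outside it adjacent to `a`, in particular `r`
    -- and a leaf of `r`. These form a triangle with `a`, so filling from the claw at `r` takes care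
    -- of the claw at `q`.
    apex-ends : ∀ {a b c q r} → Tri a b c → q ≢ r → End q → End r → Cyc (｛ a ｝ ∪ claw q) → Universal a
    apex-ends {a} {q = q} {r} t q≢r E E′ c = universal t λ {v} p → covered p
      where
      L = a-leaf E′
      in-rest : ∀ {v} → v ∈ claw r → v ∈ F ∖ claw q
      in-rest p = ∖⁺ (claw⊆F E′ p) λ s → claws-apart q≢r E E′ s p
      in-rest′ : ∀ {v} → v ∈ claw q → v ∈ F ∖ claw r
      in-rest′ p = ∖⁺ (claw⊆F E p) λ s → claws-apart q≢r E E′ p s
      R₁ = fills t (claw⊆F E) c (boundary≤1 E) (r , in-rest q∈claw)
      c′ : Cyc (｛ a ｝ ∪ claw r)
      c′ = apex-triangle t (proj₁ (proj₂ (proj₂ L))) (proj₁ (proj₂ R₁) (in-rest q∈claw))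
             (proj₁ (proj₂ R₁) (in-rest (leaf∈claw (proj₂ L)))) q∈claw (leaf∈claw (proj₂ L))
      R₂ = fills t (claw⊆F E′) c′ (boundary≤1 E′) (q , in-rest′ q∈claw)
      covered : ∀ {v} → v ∈ F → v ~ a
      covered p with ∈-or-∖ {A = claw q} p
      ... | inj₁ s = proj₁ (proj₂ R₂) (in-rest′ s)
      ... | inj₂ s = proj₁ (proj₂ R₁) s

    -- The claw at q together with any two of a, b, c contains a cycle, so the rest
    -- of F spans a forest with each of a, b, c and hence has at most one edge.
    rigid-ends : ∀ {q r} → q ≢ r → End q → End r → Rigid q → ⊥
    rigid-ends {q} {r} q≢r E E′ (l , L@(l∈F , q~l , l-leaf) , a , b , c , t , l~a , l~b , q~c) = last (one-label t r∈F dr≤2)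
      where
      open Tri t
      r∈F = End.q∈F E′
      q∈F = End.q∈F E
      R = F ∖ claw q
      L′ = proj₂ (a-leaf E′)
      m = proj₁ (a-leaf E′)
      m∈F = proj₁ L′
      in-rest : ∀ {v} → v ∈ claw r → v ∈ R
      in-rest p = ∖⁺ (claw⊆F E′ p) λ s → claws-apart q≢r E E′ s p
      r∈R = in-rest q∈claw
      m∈R = in-rest (leaf∈claw L′)
      R-apart : ∀ {v w} → v ∈ claw q → w ∈ R → v ≢ w
      R-apart p s refl = proj₂ (∖⁻ s) p
      module _ {x y z} (t′ : Tri x y z) where
        module T′ = Tri t′
        R∪ : Cyc (pair y z ∪ claw q) → Forest (R ∪ ｛ x ｝)
        R∪ c′ f = clash c′ f λ p s → dis (∪⁻ p) (∪⁻ s)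
          where
          dis : ∀ {v} → v ∈ pair y z ⊎ v ∈ claw q → v ∈ R ⊎ v ∈ ｛ x ｝ → ⊥
          dis (inj₁ p) (inj₁ s) with pair⁻ p
          ... | inj₁ refl = proj₁ (proj₂ (T′.out (∖⊆ s))) refl
          ... | inj₂ refl = proj₂ (proj₂ (T′.out (∖⊆ s))) refl
          dis (inj₂ p) (inj₁ s) = R-apart p s refl
          dis (inj₂ p) (inj₂ s) = proj₁ (T′.out (claw⊆F E p)) (∈｛｝ s)
          dis (inj₁ p) (inj₂ s) with pair⁻ p | ∈｛｝ s
          ... | inj₁ refl | eq = ~⇒≢ T′.ab (sym eq)
          ... | inj₂ refl | eq = ~⇒≢ T′.ca eq
        x∉R : x ∉ R
        x∉R p = proj₁ (T′.out (∖⊆ p)) refl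
        R-edges : Forest (R ∪ ｛ x ｝) → D R R + 2 * d x R ≤ 2 * card R
        R-edges f = +-cancelʳ-≤ 2 _ _ (≤-trans (≤-reflexive (cong (_+ 2) (sym (D-∪｛｝ x∉R))))
          (≤-trans (forest-edges (R ∪ ｛ x ｝) f (x , ∪ʳ (x∈｛x｝ x))) (≤-reflexive (trans (cong (2 *_) (card-∪｛｝ x∉R)) (*-distribˡ-+ 2 (card R) 1)))))
        no-common : Forest (R ∪ ｛ x ｝) → r ~ x → m ~ x → ⊥
        no-common f p p′ = f (cyc-in (triangle (proj₁ (proj₂ L′)) p′ (~sym p)) (∪ˡ r∈R ∷ ∪ˡ m∈R ∷ ∪ʳ (x∈｛x｝ x) ∷ []))
      fa : Forest (R ∪ ｛ a ｝)
      fa = R∪ t (cyc-in (quad (~sym l~b) (~sym q~l) q~c (~sym bc) (≢-sym (proj₁ (proj₂ (out q∈F)))) (proj₂ (proj₂ (out l∈F))))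
        (∪ˡ a∈pair ∷ ∪ʳ (leaf∈claw L) ∷ ∪ʳ q∈claw ∷ ∪ˡ b∈pair ∷ []))
      fb : Forest (R ∪ ｛ b ｝)
      fb = R∪ (rotate t) (cyc-in (quad (~sym l~a) (~sym q~l) q~c ca (≢-sym (proj₁ (out q∈F))) (proj₂ (proj₂ (out l∈F))))
        (∪ˡ b∈pair ∷ ∪ʳ (leaf∈claw L) ∷ ∪ʳ q∈claw ∷ ∪ˡ a∈pair ∷ []))
      fc : Forest (R ∪ ｛ c ｝)
      fc = R∪ (rotate (rotate t)) (cyc-in (triangle ab (~sym l~b) l~a) (∪ˡ a∈pair ∷ ∪ˡ b∈pair ∷ ∪ʳ (leaf∈claw L) ∷ []))
      degs : 3 * card R ≤ D R R + D R (claw q) + (d a R + d b R + d c R)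
      degs = ≤-trans (sum-≥ 3 at) (≤-reflexive (trans (sum-+ R _ _) (cong₂ _+_ (sum-+ R _ _)
        (trans (sum-+ R _ _) (cong₂ _+_ (trans (sum-+ R _ _) (cong₂ _+_ (label a) (label b))) (label c))))))
        where
        at : ∀ {v} → v ∈ R → 3 ≤ d v R + d v (claw q) + (e v a + e v b + e v c)
        at {v} p = subst (λ k → 3 ≤ k + (e v a + e v b + e v c)) (trans (d-split (split-∖ (claw⊆F E)) v) (+-comm (d v (claw q)) (d v R))) (deg₃ (∖⊆ p))
        label : ∀ x → sum R (λ v → e v x) ≡ d x R
        label x = trans (sum-cong (λ {v} _ → sym (d-｛｝ v x))) (D-｛｝ʳ R x)
      RR≤2 : D R R ≤ 2
      RR≤2 = linear (D R R ∷ D R (claw q) ∷ d a R ∷ d b R ∷ d c R ∷ card R ∷ [])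
        ((2 , 3 :* x₅ , x₀ :+ x₁ :+ (x₂ :+ x₃ :+ x₄)) ∷ (1 , x₀ :+ 2 :* x₂ , 2 :* x₅) ∷ (1 , x₀ :+ 2 :* x₃ , 2 :* x₅) ∷ (1 , x₀ :+ 2 :* x₄ , 2 :* x₅) ∷ (2 , x₁ , con 1) ∷ [])
        (0 , x₀ , con 2) degs (R-edges t fa) (R-edges (rotate t) fb) (R-edges (rotate (rotate t)) fc) (boundary≤1 E)
      drR≤1 : d r R ≤ 1
      drR≤1 = *-cancelˡ-≤ 2 (≤-trans (m≤m+n _ _) (subst (_≤ 2) (D-remove r∈R) RR≤2))
      dr-split : d r F ≡ d r (claw q) + d r R
      dr-split = d-split (split-∖ (claw⊆F E)) r
      dr≤2 : d r F ≤ 2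
      dr≤2 = subst (_≤ 2) (sym dr-split) (+-mono-≤ (≤-trans (d≤D r∈R) (boundary≤1 E)) drR≤1)
      q~r : q ~ r
      q~r = from (d-witness inward)
        where
        inward : 1 ≤ d r (claw q)
        inward = +-cancelʳ-≤ 1 _ _ (≤-trans (subst (2 ≤_) dr-split (End.big E′)) (+-monoʳ-≤ _ drR≤1))
        from : (∃ λ w → r ~ w × w ∈ claw q) → q ~ r
        from (w , r~w , w∈) with claw⁻ w∈
        ... | inj₁ refl = ~sym r~w
        ... | inj₂ lw = contradiction (leaf-nbr q∈F lw r∈F (~sym r~w)) (≢-sym q≢r)
      q≢m = R-apart q∈claw m∈R
      l≢m = R-apart (leaf∈claw L) m∈R
      l≢r = R-apart (leaf∈claw L) r∈R
      l≢q = leaf≢q E L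
      m≢r = leaf≢q E′ L′
      r~m = proj₁ (proj₂ L′)
      -- If `m` saw `x`, then `m`, `r`, `x` would be a triangle inside a forest. So `m` sees `y` and
      -- `z`, and the quadrilateral `q l x r` avoids the triangle `m y z`.
      outside : ∀ {x y z} → Tri x y z → l ~ x → q ~ z → Forest (R ∪ ｛ x ｝) → r ~ x → ⊥
      outside t′ lx qz f rx with pick-two t′ m∈F (proj₂ (proj₂ L′))
      ... | inj₁ (mx , _) = no-common t′ f rx mx
      ... | inj₂ (inj₂ (_ , mx)) = no-common t′ f rx mx
      ... | inj₂ (inj₁ (my , mz)) = clash-lists (quad q~l lx (~sym rx) (~sym q~r) (proj₁ (T.out q∈F)) l≢r) (triangle my T.bc (~sym mz))
        ((q≢m ∷ proj₁ (proj₂ (T.out q∈F)) ∷ proj₂ (proj₂ (T.out q∈F)) ∷ [])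
        ∷ (l≢m ∷ proj₁ (proj₂ (T.out l∈F)) ∷ proj₂ (proj₂ (T.out l∈F)) ∷ [])
        ∷ (≢-sym (proj₁ (T.out m∈F)) ∷ ~⇒≢ T.ab ∷ ≢-sym (~⇒≢ T.ca) ∷ [])
        ∷ (≢-sym m≢r ∷ proj₁ (proj₂ (T.out r∈F)) ∷ proj₂ (proj₂ (T.out r∈F)) ∷ []) ∷ [])
        where module T = Tri t′
      last : r ~ a ⊎ r ~ b ⊎ r ~ c → ⊥
      last (inj₁ p) = outside t l~a q~c fa p
      last (inj₂ (inj₁ p)) = outside (flip t) l~b q~c fb p
      last (inj₂ (inj₂ p)) with pick-two t m∈F (proj₂ (proj₂ L′))
      ... | inj₂ (inj₁ (_ , mc)) = no-common (rotate (rotate t)) fc p mc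
      ... | inj₂ (inj₂ (mc , _)) = no-common (rotate (rotate t)) fc p mc
      -- The triangle `c q r` avoids the quadrilateral `l a m b`.
      ... | inj₁ (ma , mb) = clash-lists (triangle (~sym q~c) q~r p) (quad l~a (~sym ma) mb (~sym l~b) l≢m (~⇒≢ ab))
        ((≢-sym (proj₂ (proj₂ (out l∈F))) ∷ ~⇒≢ ca ∷ ≢-sym (proj₂ (proj₂ (out m∈F))) ∷ ≢-sym (~⇒≢ bc) ∷ [])
        ∷ (≢-sym l≢q ∷ proj₁ (out q∈F) ∷ q≢m ∷ proj₁ (proj₂ (out q∈F)) ∷ [])
        ∷ (≢-sym l≢r ∷ proj₁ (out r∈F) ∷ ≢-sym m≢r ∷ proj₁ (proj₂ (out r∈F)) ∷ []) ∷ [])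

-- Triangles whose remaining forest is a matching or a star.

module TriangleCase {n : ℕ} (G : Graph n) (sat : Pairs.Sat G) where
  open Triangles G sat public

  module _ (F : VSet n) where
    open Ends F

    -- An edge inside `F` would be a component of it, whereas `fills` demands an edge to the
    -- remainder, which is non-empty because `F` has three vertices. Hence `F` is independent and
    -- the triangle meets every edge.
    flat-case : ∀ {a b c} → Tri F a b c → 3 ≤ card F → (∀ {v} → v ∈ F → d v F ≤ 1) → ∃ Universal
    flat-case {a} {b} {c} t big low with any? (λ u → any? λ v → (u ∈? F) ×-dec ((v ∈? F) ×-dec (u ~? v)))
    ... | no none = a , covering⇒universal (~⇒≢ (Tri.bc t)) λ (p , q , r) (p′ , q′ , r′) s →
            none (_ , _ , Tri.rest t p q r , Tri.rest t p′ q′ r′ , s)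
    ... | yes (l , m , l∈ , m∈ , l~m) = ⊥-elim contra
      where
      X⊆F : pair l m ⊆ F
      X⊆F p with pair⁻ p
      ... | inj₁ refl = l∈
      ... | inj₂ refl = m∈
      isolated : ∀ {r} → r ∈ F ∖ pair l m → d r (pair l m) ≤ 0
      isolated p = ≁⇒d≤0 λ q → at (pair⁻ q)
        where
        at : ∀ {u} → u ≡ l ⊎ u ≡ m → _ ≁ u
        at (inj₁ refl) s = proj₂ (∖⁻ p) (subst (_∈ pair l m) (d≤1⇒≡ (low l∈) l~m (~sym s) m∈ (∖⊆ p)) b∈pair)
        at (inj₂ refl) s = proj₂ (∖⁻ p) (subst (_∈ pair l m) (d≤1⇒≡ (low m∈) (~sym l~m) (~sym s) l∈ (∖⊆ p)) a∈pair)
      rest : Nonempty (F ∖ pair l m)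
      rest = card-witness (+-cancelˡ-≤ 2 _ _ (subst (3 ≤_) (trans (card-split (split-∖ X⊆F)) (cong (_+ card (F ∖ pair l m)) (card-pair (~⇒≢ l~m)))) big))
      contra : ⊥
      contra with share F t l∈ (low l∈) m∈ (low m∈)
      ... | x , _ , _ , t′ , lx , mx = absurd (≤-trans (proj₁ (fills F t′ X⊆F (apex-triangle F t′ l~m lx mx a∈pair b∈pair) (≤-trans none z≤n) rest)) none)
        where
        none : D (F ∖ pair l m) (pair l m) ≤ 0
        none = sum-≤ 0 isolated

    module Star {q : Fin n} (E : End q) (leaves : ∀ {v} → v ∈ F → v ≢ q → d v F ≤ 1) where
      open End E

      leaf : ∀ {v} → q ~ v → v ∈ F → Leaf q v
      leaf p r = r , p , leaves r (≢-sym (~⇒≢ p))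

      -- A vertex outside the claw would by `fills` yield an edge leaving the claw; but all
      -- neighbours of the centre `q` in `F` are leaves in the claw.
      everything : ∀ {a b c l m} → Tri F a b c → Leaf q l → Leaf q m → l ≢ m → ∀ {v} → v ∈ F → v ∈ claw q
      everything t L M l≢m {v} v∈F with ∈-or-∖ {A = claw q} v∈F | share F t (proj₁ L) (proj₂ (proj₂ L)) (proj₁ M) (proj₂ (proj₂ M))
      ... | inj₁ p | _ = p
      ... | inj₂ p | _ , _ , _ , t′ , lx , mx = absurd (≤-trans (proj₁ (fills F t′ (claw⊆F E) (apex-claw F t′ E L M l≢m lx mx) (boundary≤1 E) (_ , p)))
              (subst (_≤ 0) (sym (boundary E)) (≁⇒d≤0 λ r s → proj₂ (∖⁻ r) (leaf∈claw (leaf s (∖⊆ r))))))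

      module _ (whole : ∀ {v} → v ∈ F → v ∈ claw q) where
        -- Leaves are pairwise non-adjacent, so once none of them sees `c`, every edge meets `a`,
        -- `b` or `q`.
        cover : ∀ {a b c} → Tri F a b c → (∀ {v} → Leaf q v → v ≁ c) → Universal a
        cover {a} {b} {c} t h = covering⇒universal (≢-sym (proj₁ (proj₂ (Tri.out t q∈F)))) cov
          where
          kind : ∀ {u} → u ≢ a × u ≢ b × u ≢ q → u ≡ c ⊎ Leaf q u
          kind {u} (p , r , s) with u ≟ c
          ... | yes u≡c = inj₁ u≡c
          ... | no u≢c with claw⁻ (whole (Tri.rest t p r u≢c))
          ...   | inj₁ u≡q = contradiction u≡q s
          ...   | inj₂ L = inj₂ L
          cov : Covering a b q
          cov o o′ s with kind o | kind o′
          ... | inj₁ refl | inj₁ refl = ~irrefl s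
          ... | inj₁ refl | inj₂ L = h L (~sym s)
          ... | inj₂ L | inj₁ refl = h L s
          ... | inj₂ L | inj₂ L′ = proj₂ (proj₂ o′) (leaf-nbr q∈F L (proj₁ L′) s)

        opposite : ∀ {a b c i j k} → Tri F a b c → Leaf q i → Leaf q j → Leaf q k → i ≢ j → k ≢ i → k ≢ j →
                   i ~ a → j ~ a → k ~ b → k ~ c → ⊥
        opposite t I J K i≢j k≢i k≢j ia ja kb kc = clash-lists
          (quad (~sym ia) (~sym (proj₁ (proj₂ I))) (proj₁ (proj₂ J)) ja (≢-sym (proj₁ (out q∈F))) i≢j) (triangle kb bc (~sym kc))
          ((≢-sym (proj₁ (out (proj₁ K))) ∷ ~⇒≢ ab ∷ ≢-sym (~⇒≢ ca) ∷ [])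
          ∷ (≢-sym k≢i ∷ proj₁ (proj₂ (out (proj₁ I))) ∷ proj₂ (proj₂ (out (proj₁ I))) ∷ [])
          ∷ (≢-sym (leaf≢q E K) ∷ proj₁ (proj₂ (out q∈F)) ∷ proj₂ (proj₂ (out q∈F)) ∷ [])
          ∷ (≢-sym k≢j ∷ proj₁ (proj₂ (out (proj₁ J))) ∷ proj₂ (proj₂ (out (proj₁ J))) ∷ []) ∷ [])
          where open Tri t

        no-third-label : ∀ {a b c i j k} → Tri F a b c → Leaf q i → Leaf q j → Leaf q k → i ≢ j → k ≢ i → k ≢ j →
                         i ~ a → i ~ b → j ~ a → j ~ c → ⊥
        no-third-label t I J K i≢j k≢i k≢j ia ib ja jc with pick-two F t (proj₁ K) (proj₂ (proj₂ K))
        ... | inj₁ (_ , kb) = opposite (rotate F t) I K J (≢-sym k≢i) (≢-sym i≢j) (≢-sym k≢j) ib kb jc ja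
        ... | inj₂ (inj₁ (kb , kc)) = opposite t I J K i≢j k≢i k≢j ia ja kb kc
        ... | inj₂ (inj₂ (kc , _)) = opposite (rotate F (rotate F t)) J K I (≢-sym k≢j) i≢j (≢-sym k≢i) jc kc ia ib

        -- With three leaves, all of them see the same two triangle vertices: otherwise two leaves
        -- share a vertex while a third sees the other two, which gives a quadrilateral through `q`
        -- and a disjoint triangle. So no leaf sees `c`, and `cover` applies.
        three-leaves : ∀ {a b c i j k} → Tri F a b c → Leaf q i → Leaf q j → Leaf q k → i ≢ j → k ≢ i → k ≢ j →
                       i ~ a → i ~ b → Universal a
        three-leaves {c = c} {i} {j} {k} t I J K i≢j k≢i k≢j ia ib = cover t λ {v} L vc → bad L vc (v ≟ i) (v ≟ j)
          where
          avoid : ∀ {l m} → Leaf q l → Leaf q m → i ≢ l → m ≢ i → m ≢ l → l ≁ c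
          avoid L M i≢l m≢i m≢l lc with pick-two F t (proj₁ L) (proj₂ (proj₂ L))
          ... | inj₁ (la , _) = no-third-label t I L M i≢l m≢i m≢l ia ib la lc
          ... | inj₂ (inj₁ (lb , _)) = no-third-label (flip F t) I L M i≢l m≢i m≢l ib ia lb lc
          ... | inj₂ (inj₂ (_ , la)) = no-third-label t I L M i≢l m≢i m≢l ia ib la lc
          on-a : ∀ {l m} → Leaf q l → Leaf q m → i ≢ l → m ≢ i → m ≢ l → l ~ _
          on-a L M i≢l m≢i m≢l with pick-two F t (proj₁ L) (proj₂ (proj₂ L))
          ... | inj₁ (la , _) = la
          ... | inj₂ (inj₁ (_ , lc)) = contradiction lc (avoid L M i≢l m≢i m≢l)
          ... | inj₂ (inj₂ (_ , la)) = la
          bad : ∀ {v} → Leaf q v → v ~ c → Dec (v ≡ i) → Dec (v ≡ j) → ⊥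
          bad L vc (yes refl) _ = opposite t J K I (≢-sym k≢j) i≢j (≢-sym k≢i)
            (on-a J K i≢j k≢i k≢j) (on-a K J (≢-sym k≢i) (≢-sym i≢j) (≢-sym k≢j)) ib vc
          bad L vc (no v≢i) (yes refl) = avoid L K i≢j k≢i k≢j vc
          bad L vc (no v≢i) (no v≢j) = avoid L J (≢-sym v≢i) (≢-sym i≢j) (≢-sym v≢j) vc

        module _ {l m : Fin n} (L : Leaf q l) (M : Leaf q m) (l≢m : l ≢ m) (only : ∀ {v} → Leaf q v → v ≡ l ⊎ v ≡ m) where
          follows : ∀ {a b c i j} → Tri F a b c → Leaf q i → Leaf q j → i ≢ j → q ~ a → i ~ a → j ~ a
          follows t I J i≢j qa ia with pick-two F t (proj₁ J) (proj₂ (proj₂ J))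
          ... | inj₁ (ja , _) = ja
          ... | inj₂ (inj₂ (_ , ja)) = ja
          ... | inj₂ (inj₁ (jb , jc)) = ⊥-elim (clash-lists (triangle (~sym qa) (proj₁ (proj₂ I)) ia) (triangle jb bc (~sym jc))
            ((≢-sym (proj₁ (out (proj₁ J))) ∷ ~⇒≢ ab ∷ ≢-sym (~⇒≢ ca) ∷ [])
            ∷ (≢-sym (leaf≢q E J) ∷ proj₁ (proj₂ (out q∈F)) ∷ proj₂ (proj₂ (out q∈F)) ∷ [])
            ∷ (i≢j ∷ proj₁ (proj₂ (out (proj₁ I))) ∷ proj₂ (proj₂ (out (proj₁ I))) ∷ []) ∷ []))
            where open Tri t

          full-label : ∀ {a b c} → Tri F a b c → q ~ a → l ~ a → m ~ a → Universal a
          full-label t qa la ma = universal F t λ p → at (claw⁻ (whole p))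
            where
            at : ∀ {v} → v ≡ q ⊎ Leaf q v → v ~ _
            at (inj₁ refl) = qa
            at (inj₂ K) with only K
            ... | inj₁ refl = la
            ... | inj₂ refl = ma

          centre : d q F ≤ 2
          centre = ≤-trans (card-mono {Y = pair l m} (λ p → let (r , s) = ∩⁻ p in at (only (leaf r s)))) (≤-reflexive (card-pair l≢m))
            where
            at : ∀ {v} → v ≡ l ⊎ v ≡ m → v ∈ pair l m
            at (inj₁ refl) = a∈pair
            at (inj₂ refl) = b∈pair

          -- By `follows`, the vertex `a` seen by `q` is seen by both leaves or by neither. In the
          -- first case it is universal; in the second `b`, `c` and `q` meet every edge.
          from-centre : ∀ {a b c} → Tri F a b c → q ~ a → ∃ Universal
          from-centre {a} t qa with l ~? a | m ~? a
          ... | yes la | _ = a , full-label t qa la (follows t L M l≢m qa la)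
          ... | no _ | yes ma = a , full-label t qa (follows t M L (≢-sym l≢m) qa ma) ma
          ... | no l≁a | no m≁a = _ , cover (rotate F t) λ K → at (only K)
            where
            at : ∀ {v} → v ≡ l ⊎ v ≡ m → v ≁ a
            at (inj₁ refl) = l≁a
            at (inj₂ refl) = m≁a

          two-leaves : ∀ {a b c} → Tri F a b c → ∃ Universal
          two-leaves t with one-label F t q∈F centre
          ... | inj₁ p = from-centre t p
          ... | inj₂ (inj₁ p) = from-centre (rotate F t) p
          ... | inj₂ (inj₂ p) = from-centre (rotate F (rotate F t)) p

      star-case : ∀ {a b c} → Tri F a b c → ∃ Universal
      star-case t = from (a-leaf E)
        where
        from₂ : ∀ {l m} → Leaf q l → Leaf q m → l ≢ m → ∃ Universal
        from₂ {l} {m} L M l≢m with any? (λ v → leaf? q v ×-dec (¬? (v ≟ l) ×-dec ¬? (v ≟ m)))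
        ... | yes (k , K , k≢l , k≢m) = let (x , _ , _ , t′ , lx , ly) = two F t (proj₁ L) (proj₂ (proj₂ L)) in
                x , three-leaves (everything t L M l≢m) t′ L M K l≢m k≢l k≢m lx ly
        ... | no none = two-leaves (everything t L M l≢m) L M l≢m only t
          where
          only : ∀ {v} → Leaf q v → v ≡ l ⊎ v ≡ m
          only {v} K with v ≟ l | v ≟ m
          ... | yes p | _ = inj₁ p
          ... | no _ | yes p = inj₂ p
          ... | no p | no r = contradiction (v , K , p , r) none
        from : (∃ λ l → Leaf q l) → ∃ Universal
        from (l , L) = let (m , q~m , m∈ , m≢l) = d-witness≢ (End.big E) l in from₂ L (leaf q~m m∈) (≢-sym m≢l)

    triangle-case : ∀ {a b c} → Tri F a b c → 3 ≤ card F → ∃ Universal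
    triangle-case t big with shape (forest F t)
    ... | flat h = flat-case t big h
    ... | star q E h = Star.star-case E h t
    ... | ends q r q≢r E E′ with apex-or-rigid F t E
    ...   | inj₁ (x , _ , _ , t′ , c) = x , apex-ends F t′ q≢r E E′ c
    ...   | inj₂ rigid = ⊥-elim (rigid-ends F q≢r E E′ rigid)

-- Minimum degree three without triangles: quadrilaterals are impossible.

module QuadCase {n : ℕ} (G : Graph n) (sat : Pairs.Sat G) (min₃ : ∀ v → 3 ≤ Counting.d G v full)
                (no-triangle : ∀ {x y z} → Counting._~_ G x y → Counting._~_ G y z → Counting._~_ G z x → ⊥) where
  open Covers G sat

  d-third : ∀ {v X} → 3 ≤ d v X → ∀ y z → ∃ λ w → v ~ w × w ∈ X × w ≢ y × w ≢ z
  d-third {v} {X} h y z with y ∈? X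
  ... | no y∉X = let (w , p , q , r) = d-witness≢ (≤-trans (s≤s (s≤s z≤n)) h) z in w , p , q , (λ { refl → y∉X q }) , r
  ... | yes y∈X = let (w , p , q , r) = d-witness≢ (smaller h) z in w , p , -⊆ q , proj₂ (-⁻ q) , r
    where
    smaller : 3 ≤ d v X → 2 ≤ d v (X - y)
    smaller h = +-cancelˡ-≤ 1 _ _ (≤-trans h (≤-trans (≤-reflexive (d-remove y∈X v)) (+-monoˡ-≤ _ (e≤1 v y))))

  module _ (F : VSet n) where
    open Ends F

    record Quad (a b c k : Fin n) : Set where
      field
        ab   : a ~ b
        bc   : b ~ c
        ck   : c ~ k
        ka   : k ~ a
        a≢c  : a ≢ c
        b≢k  : b ≢ k
        out  : ∀ {v} → v ∈ F → v ≢ a × v ≢ b × v ≢ c × v ≢ k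
        rest : ∀ {v} → v ≢ a → v ≢ b → v ≢ c → v ≢ k → v ∈ F
        deg₃ : ∀ {v} → v ∈ F → 3 ≤ d v F + (e v a + e v b + (e v c + e v k))

    rotate : ∀ {a b c k} → Quad a b c k → Quad b c k a
    rotate t = record
      { ab = bc ; bc = ck ; ck = ka ; ka = ab ; a≢c = b≢k ; b≢k = ≢-sym a≢c
      ; out = λ p → let (x , y , z , w) = out p in y , z , w , x
      ; rest = λ p q r s → rest s p q r
      ; deg₃ = λ {v} p → subst (λ i → 3 ≤ d v F + i) (lem (e v _) _ _ _) (deg₃ p) }
      where
      open Quad t
      lem : ∀ x y z w → x + y + (z + w) ≡ y + z + (w + x)
      lem = solve-∀

    Labels : (Fin n → Fin n → Fin n → Fin n → Set) → Set
    Labels P = ∃ λ a → ∃ λ b → ∃ λ c → ∃ λ k → Quad a b c k × P a b c k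

    module _ {a b c k : Fin n} (t : Quad a b c k) where
      open Quad t

      not-consecutive : ∀ {v x y} → x ~ y → v ~ x → v ~ y → ⊥
      not-consecutive xy vx vy = no-triangle vx xy (~sym vy)

      at-most-one : ∀ {x y} → x ~ y → ∀ v → e v x + e v y ≤ 1
      at-most-one {x} {y} xy v with v ~? x | v ~? y
      ... | yes p | yes q = ⊥-elim (not-consecutive xy p q)
      ... | no p | _ = ≤-trans (≤-reflexive (cong (_+ e v y) (e≡0 p))) (e≤1 v y)
      ... | yes _ | no q = ≤-trans (≤-reflexive (trans (cong (e v x +_) (e≡0 q)) (+-identityʳ _))) (e≤1 v x)

      -- Without triangles a vertex sees at most one end of each side of the quadrilateral. A leaf
      -- needs two neighbours there, so they are opposite.
      labels : ∀ {v} → v ∈ F → d v F ≤ 1 → (v ~ a × v ~ c) ⊎ (v ~ b × v ~ k)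
      labels {v} p h with v ~? a | v ~? b | v ~? c | v ~? k
      ... | yes va | _ | yes vc | _ = inj₁ (va , vc)
      ... | _ | yes vb | _ | yes vk = inj₂ (vb , vk)
      ... | no x | no y | _ | _ = absurd (linear (d v F ∷ e v c + e v k ∷ []) ((1 , con 3 , x₀ :+ x₁) ∷ (1 , x₀ , con 1) ∷ (1 , x₁ , con 1) ∷ []) (0 , con 1 , con 0)
              (subst (λ i → 3 ≤ d v F + (i + (e v c + e v k))) (cong₂ _+_ (e≡0 x) (e≡0 y)) (deg₃ p)) h (at-most-one ck v))
      ... | _ | _ | no x | no y = absurd (linear (d v F ∷ e v a + e v b ∷ []) ((1 , con 3 , x₀ :+ (x₁ :+ con 0)) ∷ (1 , x₀ , con 1) ∷ (1 , x₁ , con 1) ∷ []) (0 , con 1 , con 0)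
              (subst (λ i → 3 ≤ d v F + (e v a + e v b + i)) (cong₂ _+_ (e≡0 x) (e≡0 y)) (deg₃ p)) h (at-most-one ab v))
      ... | yes va | _ | _ | yes vk = ⊥-elim (not-consecutive ka vk va)
      ... | _ | yes vb | yes vc | _ = ⊥-elim (not-consecutive bc vb vc)

      some-label : ∀ {v} → v ∈ F → d v F ≤ 2 → (v ~ a ⊎ v ~ b) ⊎ (v ~ c ⊎ v ~ k)
      some-label {v} p h with v ~? a | v ~? b | v ~? c | v ~? k
      ... | yes x | _ | _ | _ = inj₁ (inj₁ x)
      ... | _ | yes x | _ | _ = inj₁ (inj₂ x)
      ... | _ | _ | yes x | _ = inj₂ (inj₁ x)
      ... | _ | _ | _ | yes x = inj₂ (inj₂ x)
      ... | no x | no y | no z | no w = absurd (linear (d v F ∷ []) ((1 , con 3 , x₀ :+ con 0) ∷ (1 , x₀ , con 2) ∷ []) (0 , con 1 , con 0)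
              (subst (λ i → 3 ≤ d v F + i) (cong₂ _+_ (cong₂ _+_ (e≡0 x) (e≡0 y)) (cong₂ _+_ (e≡0 z) (e≡0 w))) (deg₃ p)) h)

      forest : Forest F
      forest f = clash (quad ab bc ck ka a≢c b≢k) f λ p q → case (listed p) (out q)
        where
        case : ∀ {v} → v List.∈ a ∷ b ∷ c ∷ k ∷ [] → v ≢ a × v ≢ b × v ≢ c × v ≢ k → ⊥
        case (here p) (x , _) = x p
        case (there (here p)) (_ , y , _) = y p
        case (there (there (here p))) (_ , _ , z , _) = z p
        case (there (there (there (here p)))) (_ , _ , _ , w) = w p

      -- The case `A` = {a, b}, `B` = {c, k} of `squeeze`; its bound of one edge from each vertex to
      -- `A` holds because `a` and `b` have no common neighbour.
      fills : ∀ {X} → X ⊆ F → Cyc (pair a b ∪ X) → D (F ∖ X) X ≤ 1 → Nonempty (F ∖ X) →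
              1 ≤ D (F ∖ X) X × (∀ {r} → r ∈ F ∖ X → r ~ a ⊎ r ~ b) × D (F ∖ X) (pair c k) ≤ 1
      fills {X} X⊆F c′ h ne = finish (squeeze c′ dis BR (card-pair (~⇒≢ ck)) (D-pair (~⇒≢ ck) ck) ne
              (Forest-mono ∖⊆ forest) degs (λ {r} _ → ≤-trans (≤-reflexive (d-pair (~⇒≢ ab) r)) (at-most-one ab r)) h)
        where
        not-ab : ∀ {v} → v ∈ F → v ∉ pair a b
        not-ab p q with pair⁻ q
        ... | inj₁ refl = proj₁ (out p) refl
        ... | inj₂ refl = proj₁ (proj₂ (out p)) refl
        not-ck : ∀ {v} → v ∈ F → v ∉ pair c k
        not-ck p q with pair⁻ q
        ... | inj₁ refl = proj₁ (proj₂ (proj₂ (out p))) refl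
        ... | inj₂ refl = proj₂ (proj₂ (proj₂ (out p))) refl
        BR : Disjoint (pair c k) (F ∖ X)
        BR p q = not-ck (∖⊆ q) p
        dis : Disjoint (pair a b ∪ X) (pair c k ∪ (F ∖ X))
        dis p q with ∪⁻ p | ∪⁻ q
        ... | inj₂ x | inj₁ y = not-ck (X⊆F x) y
        ... | inj₂ x | inj₂ y = proj₂ (∖⁻ y) x
        ... | inj₁ x | inj₂ y = not-ab (∖⊆ y) x
        ... | inj₁ x | inj₁ y with pair⁻ x | pair⁻ y
        ...   | inj₁ refl | inj₁ r = a≢c r
        ...   | inj₁ refl | inj₂ r = ~⇒≢ ka (sym r)
        ...   | inj₂ refl | inj₁ r = ~⇒≢ bc r
        ...   | inj₂ refl | inj₂ r = b≢k r
        degs : ∀ {r} → r ∈ F ∖ X → 3 ≤ d r (F ∖ X) + d r X + (d r (pair c k) + d r (pair a b))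
        degs {r} p = subst (3 ≤_) (cong₂ _+_ (trans (d-split (split-∖ X⊆F) r) (+-comm (d r X) _))
          (trans (+-comm (e r a + e r b) _) (cong₂ _+_ (sym (d-pair (~⇒≢ ck) r)) (sym (d-pair (~⇒≢ ab) r))))) (deg₃ (∖⊆ p))
        label : ∀ r → 1 ≤ d r (pair a b) → r ~ a ⊎ r ~ b
        label r h with d-witness h
        ... | w , p , q with pair⁻ q
        ...   | inj₁ refl = inj₁ p
        ...   | inj₂ refl = inj₂ p
        finish : 1 ≤ D (F ∖ X) X × (∀ {r} → r ∈ F ∖ X → 1 ≤ d r (pair a b)) × D (F ∖ X) (pair c k) ≤ 1 →
                 1 ≤ D (F ∖ X) X × (∀ {r} → r ∈ F ∖ X → r ~ a ⊎ r ~ b) × D (F ∖ X) (pair c k) ≤ 1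
        finish (x , y , z) = x , (λ {r} p → label r (y p)) , z

      path-cyc : ∀ {x y} → x ∈ F → y ∈ F → x ~ y → x ~ a → y ~ b → ∀ {X} → x ∈ X → y ∈ X → Cyc (pair a b ∪ X)
      path-cyc {x} {y} x∈F y∈F xy xa yb x∈ y∈ = cyc-in (quad (~sym xa) xy yb (~sym ab)
        (≢-sym (proj₁ (out y∈F))) (proj₁ (proj₂ (out x∈F))))
        (∪ˡ a∈pair ∷ ∪ʳ x∈ ∷ ∪ʳ y∈ ∷ ∪ˡ b∈pair ∷ [])

      edge-cyc : ∀ {x y} → x ∈ F → y ∈ F → x ~ y → x ~ a ⊎ x ~ b → y ~ a ⊎ y ~ b → ∀ {X} → x ∈ X → y ∈ X → Cyc (pair a b ∪ X)
      edge-cyc p q xy (inj₁ xa) (inj₂ yb) x∈ y∈ = path-cyc p q xy xa yb x∈ y∈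
      edge-cyc p q xy (inj₂ xb) (inj₁ ya) x∈ y∈ = path-cyc q p (~sym xy) ya xb y∈ x∈
      edge-cyc _ _ xy (inj₁ xa) (inj₁ ya) = ⊥-elim (no-triangle xy ya (~sym xa))
      edge-cyc _ _ xy (inj₂ xb) (inj₂ yb) = ⊥-elim (no-triangle xy yb (~sym xb))

      leaf-label : ∀ {v} → v ∈ F → d v F ≤ 1 → v ~ a ⊎ v ~ b
      leaf-label p h with labels p h
      ... | inj₁ (va , _) = inj₁ va
      ... | inj₂ (vb , _) = inj₂ vb

      two-leaf-cyc : ∀ {q l m} → End q → Leaf q l → Leaf q m → l ≢ m → Cyc (pair a b ∪ claw q)
      two-leaf-cyc {q} {l} {m} E L@(l∈F , q~l , hl) M@(m∈F , q~m , hm) l≢m with leaf-label l∈F hl | leaf-label m∈F hm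
      ... | inj₁ la | inj₁ ma = cyc-in (quad (~sym la) (~sym q~l) q~m ma (≢-sym (proj₁ (out (End.q∈F E)))) l≢m)
              (∪ˡ a∈pair ∷ ∪ʳ (leaf∈claw L) ∷ ∪ʳ q∈claw ∷ ∪ʳ (leaf∈claw M) ∷ [])
      ... | inj₂ lb | inj₂ mb = cyc-in (quad (~sym lb) (~sym q~l) q~m mb (≢-sym (proj₁ (proj₂ (out (End.q∈F E))))) l≢m)
              (∪ˡ b∈pair ∷ ∪ʳ (leaf∈claw L) ∷ ∪ʳ q∈claw ∷ ∪ʳ (leaf∈claw M) ∷ [])
      ... | inj₁ la | inj₂ mb = cyc-in (pent (~sym la) (~sym q~l) q~m mb (~sym ab) (≢-sym (proj₁ (out (End.q∈F E)))) l≢m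
              (proj₁ (proj₂ (out (End.q∈F E)))) (proj₁ (out m∈F)) (≢-sym (proj₁ (proj₂ (out l∈F)))))
              (∪ˡ a∈pair ∷ ∪ʳ (leaf∈claw L) ∷ ∪ʳ q∈claw ∷ ∪ʳ (leaf∈claw M) ∷ ∪ˡ b∈pair ∷ [])
      ... | inj₂ lb | inj₁ ma = cyc-in (pent (~sym ma) (~sym q~m) q~l lb (~sym ab) (≢-sym (proj₁ (out (End.q∈F E)))) (≢-sym l≢m)
              (proj₁ (proj₂ (out (End.q∈F E)))) (proj₁ (out l∈F)) (≢-sym (proj₁ (proj₂ (out m∈F)))))
              (∪ˡ a∈pair ∷ ∪ʳ (leaf∈claw M) ∷ ∪ʳ q∈claw ∷ ∪ʳ (leaf∈claw L) ∷ ∪ˡ b∈pair ∷ [])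

      a≁c : a ≁ c
      a≁c ac = not-consecutive bc ab ac

      -- Such a cover would make `a` universal, but `a ≁ c` because both are adjacent to `b`. This
      -- is how the triangle-free cases end in a contradiction.
      covering-false : ∀ {x} → c ≢ x → Covering a c x → ⊥
      covering-false c≢x cov = a≁c (covering⇒universal c≢x cov c (≢-sym a≢c))

      third-of-c : ∃ λ w → w ~ c × w ∈ F
      third-of-c with d-third (min₃ c) b k
      ... | w , c~w , _ , w≢b , w≢k = w , ~sym c~w , rest (λ { refl → a≁c (~sym c~w) }) w≢b (≢-sym (~⇒≢ c~w)) w≢k

    -- No rigid case arises: a single leaf sees two opposite vertices, and `q`, adjacent to the
    -- leaf, can only see one of the other two. The leaf and `q` thus close a quadrilateral along
    -- some side.
    claw-cyc : ∀ {a b c k q} → Quad a b c k → End q → Labels λ x y _ _ → Cyc (pair x y ∪ claw q)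
    claw-cyc {q = q} t E = from (a-leaf E)
      where
      open End E
      one : ∀ {l} → Leaf q l → (∃ λ m → Leaf q m × m ≢ l) ⊎ d q F ≤ 2 → Labels λ x y _ _ → Cyc (pair x y ∪ claw q)
      one L (inj₁ (m , M , m≢l)) = _ , _ , _ , _ , t , two-leaf-cyc t E L M (≢-sym m≢l)
      one L@(l∈F , q~l , hl) (inj₂ h) with labels t l∈F hl | some-label t q∈F h
      ... | inj₁ (la , lc) | inj₁ (inj₁ qa) = ⊥-elim (no-triangle q~l la (~sym qa))
      ... | inj₁ (la , lc) | inj₁ (inj₂ qb) = _ , _ , _ , _ , t , edge-cyc t q∈F l∈F q~l (inj₂ qb) (inj₁ la) q∈claw (leaf∈claw L)
      ... | inj₁ (la , lc) | inj₂ (inj₁ qc) = ⊥-elim (no-triangle q~l lc (~sym qc))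
      ... | inj₁ (la , lc) | inj₂ (inj₂ qk) = _ , _ , _ , _ , t′ , edge-cyc t′ q∈F l∈F q~l (inj₁ qk) (inj₂ la) q∈claw (leaf∈claw L)
        where t′ = rotate (rotate (rotate t))
      one L@(l∈F , q~l , hl) (inj₂ h) | inj₂ (lb , lk) | inj₁ (inj₁ qa) = _ , _ , _ , _ , t , edge-cyc t q∈F l∈F q~l (inj₁ qa) (inj₂ lb) q∈claw (leaf∈claw L)
      one L@(l∈F , q~l , hl) (inj₂ h) | inj₂ (lb , lk) | inj₁ (inj₂ qb) = ⊥-elim (no-triangle q~l lb (~sym qb))
      one L@(l∈F , q~l , hl) (inj₂ h) | inj₂ (lb , lk) | inj₂ (inj₁ qc) = _ , _ , _ , _ , rotate t , edge-cyc (rotate t) q∈F l∈F q~l (inj₂ qc) (inj₁ lb) q∈claw (leaf∈claw L)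
      one L@(l∈F , q~l , hl) (inj₂ h) | inj₂ (lb , lk) | inj₂ (inj₂ qk) = ⊥-elim (no-triangle q~l lk (~sym qk))
      from : (∃ λ l → Leaf q l) → Labels λ x y _ _ → Cyc (pair x y ∪ claw q)
      from (l , L) = one L (other-leaf? E l)

    D≥2 : ∀ {X Y u v} → u ≢ v → u ∈ X → v ∈ X → 1 ≤ d u Y → 1 ≤ d v Y → 2 ≤ D X Y
    D≥2 {X} {Y} u≢v p q hu hv = ≤-trans (+-mono-≤ hu (≤-trans hv (d≤D (-⁺ q (≢-sym u≢v))))) (≤-reflexive (sym (sum-remove p _)))

    -- Filling from the claw at `q` labels `r` and its leaf, so the claw at `r` closes up with `ab`
    -- as well, and filling works from both sides. If the leaves `l` and `m` see the same opposite
    -- pair, too many edges reach `c` and `k`. If they see different pairs, there is a triangle or a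
    -- pair of disjoint quadrilaterals.
    ends-false : ∀ {a b c k q r} → Quad a b c k → q ≢ r → End q → End r → Cyc (pair a b ∪ claw q) → ⊥
    ends-false {a} {b} {c} {k} {q} {r} t q≢r E E′ cq = final (labels t l∈F (proj₂ (proj₂ L))) (labels t m∈F (proj₂ (proj₂ M))) (Q-label q∈F₂) (R-label r∈F₁)
      where
      open Quad t
      l = proj₁ (a-leaf E)
      L = proj₂ (a-leaf E)
      m = proj₁ (a-leaf E′)
      M = proj₂ (a-leaf E′)
      l∈F = proj₁ L
      m∈F = proj₁ M
      q∈F = End.q∈F E
      r∈F = End.q∈F E′
      in-rest : ∀ {v} → v ∈ claw r → v ∈ F ∖ claw q
      in-rest p = ∖⁺ (claw⊆F E′ p) λ s → claws-apart q≢r E E′ s p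
      in-rest′ : ∀ {v} → v ∈ claw q → v ∈ F ∖ claw r
      in-rest′ p = ∖⁺ (claw⊆F E p) λ s → claws-apart q≢r E E′ p s
      r∈F₁ = in-rest q∈claw
      q∈F₂ = in-rest′ q∈claw
      m∈F₁ = in-rest (leaf∈claw M)
      l∈F₂ = in-rest′ (leaf∈claw L)
      R₁ = fills t (claw⊆F E) cq (boundary≤1 E) (r , r∈F₁)
      R-label : ∀ {v} → v ∈ F ∖ claw q → v ~ a ⊎ v ~ b
      R-label = proj₁ (proj₂ R₁)
      cr : Cyc (pair a b ∪ claw r)
      cr = edge-cyc t r∈F m∈F (proj₁ (proj₂ M)) (R-label r∈F₁) (R-label m∈F₁) q∈claw (leaf∈claw M)
      R₂ = fills t (claw⊆F E′) cr (boundary≤1 E′) (q , q∈F₂)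
      Q-label : ∀ {v} → v ∈ F ∖ claw r → v ~ a ⊎ v ~ b
      Q-label = proj₁ (proj₂ R₂)
      -- Each remainder may send only one edge to {c, k}. Whichever remainder contains `w` also
      -- contains `m` or `l`, so it sends two.
      crowded : ∀ {x y w} → x ∈ pair c k → y ∈ pair c k → l ~ x → m ~ x → w ~ y → (∀ {v} → v ~ x → v ~ y → ⊥) → w ∈ F → ⊥
      crowded {x} {y} {w} x∈ y∈ lx mx wy excl w∈F with ∈-or-∖ {A = claw q} w∈F
      ... | inj₂ s = absurd (≤-pred (≤-trans (D≥2 (λ { refl → excl mx wy }) m∈F₁ s (d≥1 mx x∈) (d≥1 wy y∈)) (proj₂ (proj₂ R₁))))
      ... | inj₁ s = absurd (≤-pred (≤-trans (D≥2 (λ { refl → excl lx wy }) l∈F₂ (in-rest′ s) (d≥1 lx x∈) (d≥1 wy y∈)) (proj₂ (proj₂ R₂))))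
      -- The two quadrilaterals are `l q y z` and `m r x w`.
      cross : ∀ {x y z w} → l ~ z → q ~ y → m ~ w → r ~ x → y ~ z → x ~ w → x ≢ y → x ≢ z → w ≢ y → w ≢ z →
              (∀ {v} → v ∈ F → v ≢ x × v ≢ y × v ≢ z × v ≢ w) → ⊥
      cross lz qy mw rx yz xw x≢y x≢z w≢y w≢z o = clash-lists
        (quad (~sym (proj₁ (proj₂ L))) qy yz (~sym lz) (proj₁ (proj₂ (o l∈F))) (proj₁ (proj₂ (proj₂ (o q∈F)))))
        (quad (~sym (proj₁ (proj₂ M))) rx xw (~sym mw) (proj₁ (o m∈F)) (proj₂ (proj₂ (proj₂ (o r∈F)))))
        ((ne (leaf∈claw L) (leaf∈claw M) ∷ ne (leaf∈claw L) q∈claw ∷ proj₁ (o l∈F) ∷ proj₂ (proj₂ (proj₂ (o l∈F))) ∷ [])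
        ∷ (ne q∈claw (leaf∈claw M) ∷ q≢r ∷ proj₁ (o q∈F) ∷ proj₂ (proj₂ (proj₂ (o q∈F))) ∷ [])
        ∷ (≢-sym (proj₁ (proj₂ (o m∈F))) ∷ ≢-sym (proj₁ (proj₂ (o r∈F))) ∷ ≢-sym x≢y ∷ ≢-sym w≢y ∷ [])
        ∷ (≢-sym (proj₁ (proj₂ (proj₂ (o m∈F)))) ∷ ≢-sym (proj₁ (proj₂ (proj₂ (o r∈F)))) ∷ ≢-sym x≢z ∷ ≢-sym w≢z ∷ []) ∷ [])
        where
        ne : ∀ {u v} → u ∈ claw q → v ∈ claw r → u ≢ v
        ne p s refl = claws-apart q≢r E E′ p s
      final : (l ~ a × l ~ c) ⊎ (l ~ b × l ~ k) → (m ~ a × m ~ c) ⊎ (m ~ b × m ~ k) → q ~ a ⊎ q ~ b → r ~ a ⊎ r ~ b → ⊥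
      final (inj₁ (la , lc)) (inj₁ (ma , mc)) _ _ =
        let (w , wk , w∈F) = third-of-c (rotate t) in crowded a∈pair b∈pair lc mc wk (not-consecutive t ck) w∈F
      final (inj₂ (lb , lk)) (inj₂ (mb , mk)) _ _ =
        let (w , wc , w∈F) = third-of-c t in crowded b∈pair a∈pair lk mk wc (not-consecutive t (~sym ck)) w∈F
      final (inj₁ (la , lc)) (inj₂ (mb , mk)) (inj₂ qb) (inj₁ ra) =
        cross lc qb mk ra bc (~sym ka) (~⇒≢ ab) a≢c (≢-sym b≢k) (≢-sym (~⇒≢ ck)) out
      final (inj₂ (lb , lk)) (inj₁ (ma , mc)) (inj₁ qa) (inj₂ rb) =
        cross lk qa mc rb (~sym ka) bc (≢-sym (~⇒≢ ab)) b≢k (≢-sym a≢c) (~⇒≢ ck)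
          (λ p → let (x , y , z , w) = out p in y , x , w , z)
      final (inj₁ (la , lc)) _ (inj₁ qa) _ = no-triangle (proj₁ (proj₂ L)) la (~sym qa)
      final (inj₂ (lb , lk)) _ (inj₂ qb) _ = no-triangle (proj₁ (proj₂ L)) lb (~sym qb)
      final _ (inj₁ (ma , mc)) _ (inj₁ ra) = no-triangle (proj₁ (proj₂ M)) ma (~sym ra)
      final _ (inj₂ (mb , mk)) _ (inj₂ rb) = no-triangle (proj₁ (proj₂ M)) mb (~sym rb)

    flat-false : ∀ {a b c k} → Quad a b c k → (∀ {v} → v ∈ F → d v F ≤ 1) → ⊥
    flat-false {a} {b} {c} {k} t low = from (third-of-c t)
      where
      open Quad t
      -- Here the graph is the complete bipartite graph with classes {a, c, m} and {b, k, l}. It has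
      -- no two disjoint cycles but fails to be saturated: one class covers all edges without being
      -- a clique.
      K₂ : ∀ {a b c k l m} → Quad a b c k → l ~ a → l ~ c → m ~ b → m ~ k → (∀ {v} → v ∈ F → v ≡ l ⊎ v ≡ m) → c ≢ m → ⊥
      K₂ {a} {b} {c} {k} {l} {m} t la lc mb mk only c≢m = covering-false t c≢m cov
        where
        module T = Quad t
        kind : ∀ {u} → u ≢ a × u ≢ c × u ≢ m → u ≡ b ⊎ u ≡ k ⊎ u ≡ l
        kind {u} (p , q , r) with u ≟ b | u ≟ k
        ... | yes x | _ = inj₁ x
        ... | no _ | yes x = inj₂ (inj₁ x)
        ... | no x | no y with only (T.rest p x q y)
        ...   | inj₁ z = inj₂ (inj₂ z)
        ...   | inj₂ z = contradiction z r
        lb : l ≁ b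
        lb = not-consecutive t T.ab la
        lk : l ≁ k
        lk = not-consecutive t T.ck lc
        bk : b ≁ k
        bk = a≁c (rotate t)
        cov : Covering a c m
        cov o o′ s with kind o | kind o′
        ... | inj₁ refl | inj₁ refl = ~irrefl s
        ... | inj₁ refl | inj₂ (inj₁ refl) = bk s
        ... | inj₁ refl | inj₂ (inj₂ refl) = lb (~sym s)
        ... | inj₂ (inj₁ refl) | inj₁ refl = bk (~sym s)
        ... | inj₂ (inj₁ refl) | inj₂ (inj₁ refl) = ~irrefl s
        ... | inj₂ (inj₁ refl) | inj₂ (inj₂ refl) = lk (~sym s)
        ... | inj₂ (inj₂ refl) | inj₁ refl = lb s
        ... | inj₂ (inj₂ refl) | inj₂ (inj₁ refl) = lk s
        ... | inj₂ (inj₂ refl) | inj₂ (inj₂ refl) = ~irrefl s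
      edge : ∀ {l m} → l ∈ F → m ∈ F → l ~ m → ⊥
      edge {l} {m} l∈ m∈ l~m with nonempty? (F ∖ pair l m)
      ... | yes ne = absurd (≤-trans (proj₁ (fills t X⊆F (edge-cyc t l∈ m∈ l~m (leaf-label t l∈ (low l∈)) (leaf-label t m∈ (low m∈)) a∈pair b∈pair) (≤-trans none z≤n) ne)) none)
        where
        X⊆F : pair l m ⊆ F
        X⊆F p with pair⁻ p
        ... | inj₁ refl = l∈
        ... | inj₂ refl = m∈
        isolated : ∀ {r} → r ∈ F ∖ pair l m → d r (pair l m) ≤ 0
        isolated p = ≁⇒d≤0 λ q → at (pair⁻ q)
          where
          at : ∀ {u} → u ≡ l ⊎ u ≡ m → _ ≁ u
          at (inj₁ refl) s = proj₂ (∖⁻ p) (subst (_∈ pair l m) (d≤1⇒≡ (low l∈) l~m (~sym s) m∈ (∖⊆ p)) b∈pair)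
          at (inj₂ refl) s = proj₂ (∖⁻ p) (subst (_∈ pair l m) (d≤1⇒≡ (low m∈) (~sym l~m) (~sym s) l∈ (∖⊆ p)) a∈pair)
        none : D (F ∖ pair l m) (pair l m) ≤ 0
        none = sum-≤ 0 isolated
      ... | no ¬ne with labels t l∈ (low l∈) | labels t m∈ (low m∈)
      ...   | inj₁ (la , lc) | inj₂ (mb , mk) = K₂ t la lc mb mk only (≢-sym (proj₁ (proj₂ (proj₂ (out m∈)))))
        where
        only : ∀ {v} → v ∈ F → v ≡ l ⊎ v ≡ m
        only {v} p with ∈-or-∖ {A = pair l m} p
        ... | inj₁ q = pair⁻ q
        ... | inj₂ q = contradiction (v , q) ¬ne
      ...   | inj₂ (lb , lk) | inj₁ (ma , mc) = K₂ (rotate t) lb lk mc ma only (≢-sym (proj₂ (proj₂ (proj₂ (out m∈)))))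
        where
        only : ∀ {v} → v ∈ F → v ≡ l ⊎ v ≡ m
        only {v} p with ∈-or-∖ {A = pair l m} p
        ... | inj₁ q = pair⁻ q
        ... | inj₂ q = contradiction (v , q) ¬ne
      ...   | inj₁ (la , _) | inj₁ (ma , _) = no-triangle l~m ma (~sym la)
      ...   | inj₂ (lb , _) | inj₂ (mb , _) = no-triangle l~m mb (~sym lb)
      nbr : ∀ {l} → l ∈ F → 1 ≤ d l F
      nbr {l} p = linear (d l F ∷ e l a + e l b ∷ e l c + e l k ∷ []) ((1 , con 3 , x₀ :+ (x₁ :+ x₂)) ∷ (1 , x₁ , con 1) ∷ (1 , x₂ , con 1) ∷ []) (0 , con 1 , x₀)
        (deg₃ p) (at-most-one t ab l) (at-most-one t ck l)
      from : (∃ λ w → w ~ c × w ∈ F) → ⊥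
      from (w , _ , w∈F) = let (m , w~m , m∈F) = d-witness (nbr w∈F) in edge w∈F m∈F w~m

    module Star {q : Fin n} (E : End q) (leaves : ∀ {v} → v ∈ F → v ≢ q → d v F ≤ 1) where
      open End E

      leaf : ∀ {v} → q ~ v → v ∈ F → Leaf q v
      leaf p r = r , p , leaves r (≢-sym (~⇒≢ p))

      everything : ∀ {a b c k l m} → Quad a b c k → Leaf q l → Leaf q m → l ≢ m → ∀ {v} → v ∈ F → v ∈ claw q
      everything t L M l≢m {v} v∈F with ∈-or-∖ {A = claw q} v∈F
      ... | inj₁ p = p
      ... | inj₂ p = absurd (≤-trans (proj₁ (fills t (claw⊆F E) (two-leaf-cyc t E L M l≢m) (boundary≤1 E) (_ , p)))
              (subst (_≤ 0) (sym (boundary E)) (≁⇒d≤0 λ r s → proj₂ (∖⁻ r) (leaf∈claw (leaf s (∖⊆ r))))))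

      module _ (whole : ∀ {v} → v ∈ F → v ∈ claw q) where
        -- When all leaves see `a` and `c`, they see neither `b` nor `k`, so `a`, `c` and `q` meet
        -- every edge.
        all-a : ∀ {a b c k} → Quad a b c k → (∀ {v} → Leaf q v → v ~ a × v ~ c) → ⊥
        all-a {a} {b} {c} {k} t h = covering-false t (≢-sym (proj₁ (proj₂ (proj₂ (out q∈F))))) cov
          where
          open Quad t
          kind : ∀ {u} → u ≢ a × u ≢ c × u ≢ q → u ≡ b ⊎ u ≡ k ⊎ Leaf q u
          kind {u} (p , r , s) with u ≟ b | u ≟ k
          ... | yes x | _ = inj₁ x
          ... | no _ | yes x = inj₂ (inj₁ x)
          ... | no x | no y with claw⁻ (whole (rest p x r y))
          ...   | inj₁ z = contradiction z s
          ...   | inj₂ L = inj₂ (inj₂ L)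
          lb : ∀ {l} → Leaf q l → l ≁ b
          lb L = not-consecutive t ab (proj₁ (h L))
          lk : ∀ {l} → Leaf q l → l ≁ k
          lk L = not-consecutive t ck (proj₂ (h L))
          bk : b ≁ k
          bk = a≁c (rotate t)
          cov : Covering a c q
          cov o o′ s with kind o | kind o′
          ... | inj₁ refl | inj₁ refl = ~irrefl s
          ... | inj₁ refl | inj₂ (inj₁ refl) = bk s
          ... | inj₁ refl | inj₂ (inj₂ L) = lb L (~sym s)
          ... | inj₂ (inj₁ refl) | inj₁ refl = bk (~sym s)
          ... | inj₂ (inj₁ refl) | inj₂ (inj₁ refl) = ~irrefl s
          ... | inj₂ (inj₁ refl) | inj₂ (inj₂ L) = lk L (~sym s)
          ... | inj₂ (inj₂ L) | inj₁ refl = lb L s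
          ... | inj₂ (inj₂ L) | inj₂ (inj₁ refl) = lk L s
          ... | inj₂ (inj₂ L) | inj₂ (inj₂ L′) = proj₂ (proj₂ o′) (leaf-nbr q∈F L (proj₁ L′) s)

        mixed₃ : ∀ {a b c k i j m} → Quad a b c k → Leaf q i → Leaf q j → Leaf q m → i ≢ j → m ≢ i → m ≢ j →
                 j ~ b → j ~ k → i ~ a → m ~ a → ⊥
        mixed₃ t I J M i≢j m≢i m≢j jb jk ia ma = clash-lists
          (quad (~sym ia) (~sym (proj₁ (proj₂ I))) (proj₁ (proj₂ M)) ma (≢-sym (proj₁ (out q∈F))) (≢-sym m≢i))
          (quad bc ck (~sym jk) jb b≢k (≢-sym (proj₁ (proj₂ (proj₂ (out (proj₁ J)))))))
          ((~⇒≢ ab ∷ a≢c ∷ ≢-sym (~⇒≢ ka) ∷ ≢-sym (proj₁ (out (proj₁ J))) ∷ [])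
          ∷ (proj₁ (proj₂ (out (proj₁ I))) ∷ proj₁ (proj₂ (proj₂ (out (proj₁ I)))) ∷ proj₂ (proj₂ (proj₂ (out (proj₁ I)))) ∷ i≢j ∷ [])
          ∷ (proj₁ (proj₂ (out q∈F)) ∷ proj₁ (proj₂ (proj₂ (out q∈F))) ∷ proj₂ (proj₂ (proj₂ (out q∈F))) ∷ ≢-sym (leaf≢q E J) ∷ [])
          ∷ (proj₁ (proj₂ (out (proj₁ M))) ∷ proj₁ (proj₂ (proj₂ (out (proj₁ M)))) ∷ proj₂ (proj₂ (proj₂ (out (proj₁ M)))) ∷ m≢j ∷ []) ∷ [])
          where open Quad t

        -- With leaves of both kinds, a third leaf pairs with one of its own kind in a quadrilateral
        -- through `q`, disjoint from one through the leaf of the other kind. Without a third leaf,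
        -- `q` must see a vertex of the removed quadrilateral, which closes a triangle.
        mixed : ∀ {a b c k i j} → Quad a b c k → Leaf q i → Leaf q j → i ~ a → i ~ c → j ~ b → j ~ k → ⊥
        mixed {a} {b} {c} {k} {i} {j} t I J ia ic jb jk with 3 ≤? d q F
        ... | yes h = third (d-third h i j)
          where
          i≢j : i ≢ j
          i≢j refl = not-consecutive t (Quad.ab t) ia jb
          third : (∃ λ m → q ~ m × m ∈ F × m ≢ i × m ≢ j) → ⊥
          third (m , q~m , m∈F , m≢i , m≢j) with labels t m∈F (leaves m∈F (≢-sym (~⇒≢ q~m)))
          ... | inj₁ (ma , _) = mixed₃ t I J (leaf q~m m∈F) i≢j m≢i m≢j jb jk ia ma
          ... | inj₂ (mb , _) = mixed₃ (rotate t) J I (leaf q~m m∈F) (≢-sym i≢j) m≢j m≢i ic ia jb mb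
        ... | no ¬h with some-label t q∈F (≤-pred (≰⇒> ¬h))
        ...   | inj₁ (inj₁ qa) = no-triangle (proj₁ (proj₂ I)) ia (~sym qa)
        ...   | inj₁ (inj₂ qb) = no-triangle (proj₁ (proj₂ J)) jb (~sym qb)
        ...   | inj₂ (inj₁ qc) = no-triangle (proj₁ (proj₂ I)) ic (~sym qc)
        ...   | inj₂ (inj₂ qk) = no-triangle (proj₁ (proj₂ J)) jk (~sym qk)

        sorted : ∀ {a b c k} → Quad a b c k → ⊥
        sorted {a} {b} {c} {k} t with any? (λ v → leaf? q v ×-dec ¬? (v ~? a)) | any? (λ v → leaf? q v ×-dec ¬? (v ~? b))
        ... | no h | _ = all-a t λ {v} L → pick L (labels t (proj₁ L) (proj₂ (proj₂ L)))
          where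
          pick : ∀ {v} → Leaf q v → (v ~ a × v ~ c) ⊎ (v ~ b × v ~ k) → v ~ a × v ~ c
          pick L (inj₁ p) = p
          pick {v} L (inj₂ (vb , _)) = contradiction (v , L , λ va → not-consecutive t (Quad.ab t) va vb) h
        ... | yes _ | no h = all-a (rotate t) λ {v} L → pick L (labels t (proj₁ L) (proj₂ (proj₂ L)))
          where
          pick : ∀ {v} → Leaf q v → (v ~ a × v ~ c) ⊎ (v ~ b × v ~ k) → v ~ b × v ~ k
          pick L (inj₂ p) = p
          pick {v} L (inj₁ (va , _)) = contradiction (v , L , λ vb → not-consecutive t (Quad.ab t) va vb) h
        ... | yes (j , J , j≁a) | yes (i , I , i≁b) with labels t (proj₁ J) (proj₂ (proj₂ J)) | labels t (proj₁ I) (proj₂ (proj₂ I))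
        ...   | inj₁ (ja , _) | _ = j≁a ja
        ...   | _ | inj₂ (ib , _) = i≁b ib
        ...   | inj₂ (jb , jk) | inj₁ (ia , ic) = mixed t I J ia ic jb jk

      star-false : ∀ {a b c k} → Quad a b c k → ⊥
      star-false t = let (l , L) = a-leaf E in let (m , q~m , m∈ , m≢l) = d-witness≢ big l in
        sorted (everything t L (leaf q~m m∈) (≢-sym m≢l)) t

    quad-false : ∀ {a b c k} → Quad a b c k → ⊥
    quad-false t with shape (forest t)
    ... | flat h = flat-false t h
    ... | star q E h = Star.star-false E h t
    ... | ends q r q≢r E E′ with claw-cyc t E
    ...   | _ , _ , _ , _ , t′ , c = ends-false t′ q≢r E E′ c

-- Shortest cycles as dense sets of least cardinality.

module Shortest {n : ℕ} (G : Graph n) where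
  open Cycles G public

  record Least (X Q : VSet n) : Set where
    field
      Q⊆X     : Q ⊆ X
      some    : Nonempty Q
      dense   : Dense Q
      minimal : ∀ {Y} → Cyc Y → Y ⊆ X → card Q ≤ card Y

  -- The double negation replaces a search through all vertex sets by a descent on cardinality. It
  -- costs nothing, since every use aims at a contradiction.
  least : ∀ {X} → Cyc X → ¬ ¬ ∃ (Least X)
  least {X} (cyc Q i s dn) none = descend (card Q) Q ≤-refl i s dn
    where
    descend : ∀ m Q → card Q ≤ m → Q ⊆ X → Nonempty Q → Dense Q → ⊥
    descend zero Q h i s dn = absurd (≤-trans (card-≥1 (proj₂ s)) h)
    descend (suc m) Q h i s dn = none (Q , record { Q⊆X = i ; some = s ; dense = dn ; minimal = minimal })
      where
      minimal : ∀ {Y} → Cyc Y → Y ⊆ X → card Q ≤ card Y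
      minimal {Y} (cyc Z j t dm) Y⊆X with card Q ≤? card Y
      ... | yes p = p
      ... | no p = ⊥-elim (descend m Z (≤-trans (card-mono j) (≤-pred (≤-trans (≰⇒> p) h))) (λ q → Y⊆X (j q)) t dm)

  module _ {X Q : VSet n} (L : Least X Q) where
    open Least L

    proper : ∀ {v} → v ∈ Q → Forest (Q - v)
    proper p c = 1+n≰n (≤-trans (≤-reflexive (sym (card-remove p))) (minimal c (λ q → Q⊆X (-⊆ q))))

    -- If all degrees were at least three, deleting any vertex would leave a smaller dense set.
    degree-two : ∃ λ v → v ∈ Q × d v Q ≤ 2
    degree-two with any? (λ v → (v ∈? Q) ×-dec (d v Q ≤? 2))
    ... | yes p = p
    ... | no none = ⊥-elim (smaller some)
      where
      smaller : Nonempty Q → ⊥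
      smaller (v , p) = proper p (cyc (Q - v) (λ q → q) rest λ {w} q → +-cancelˡ-≤ 1 _ _
        (≤-trans (≰⇒> λ h → none (w , -⊆ q , h)) (≤-trans (≤-reflexive (d-remove p w)) (+-monoˡ-≤ _ (e≤1 w v)))))
        where
        rest : Nonempty (Q - v)
        rest = let (u , p~u , u∈) = d-witness (≤-trans (s≤s z≤n) (dense p)) in u , -⁺ u∈ (≢-sym (~⇒≢ p~u))

    -- With more edges than vertices, deleting a vertex of degree two would leave enough edges for a
    -- smaller cycle.
    edges≤ : D Q Q ≤ 2 * card Q
    edges≤ = from degree-two
      where
      from : (∃ λ v → v ∈ Q × d v Q ≤ 2) → D Q Q ≤ 2 * card Q
      from (v , p , h) with D Q Q ≤? 2 * card Q
      ... | yes le = le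
      ... | no gt = ⊥-elim (proper p (many-edges rest
              (linear (D Q Q ∷ card Q ∷ d v Q ∷ D (Q - v) (Q - v) ∷ card (Q - v) ∷ [])
                ((1 , con 1 :+ 2 :* x₁ , x₀) ∷ (2 , x₂ , con 2) ∷ (1 , x₀ , 2 :* x₂ :+ x₃) ∷ (2 , con 1 :+ x₄ , x₁) ∷ [])
                (0 , 2 :* x₄ , x₃ :+ con 1) (≰⇒> gt) h (≤-reflexive (D-remove p)) (≤-reflexive (sym (card-remove p))))))
        where
        rest : Nonempty (Q - v)
        rest = let (u , p~u , u∈) = d-witness (≤-trans (s≤s z≤n) (dense p)) in u , -⁺ u∈ (≢-sym (~⇒≢ p~u))

    edges≡ : D Q Q ≡ 2 * card Q
    edges≡ = ≤-antisym edges≤ (sum-≥ 2 dense)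

    regular : ∀ {v} → v ∈ Q → d v Q ≤ 2
    regular = sum-tight-≥ 2 dense edges≤

    -- Exchanging c for y keeps both the size and the number of edges, so the
    -- result is again a shortest cycle.
    exchange : ∀ {y c u} → y ∈ X → y ∉ Q → 2 ≤ d y Q → c ∈ Q → y ≁ c → u ∈ Q → u ~ c → u ~ y
    exchange {y} {c} {u} y∈X y∉Q two c∈Q y≁c u∈Q u~c = finish (minimal-core Z-cyc)
      where
      Z : VSet n
      Z = Q - c ∪ ｛ y ｝
      y∉ : y ∉ Q - c
      y∉ p = y∉Q (-⊆ p)
      Z-cyc : Cyc Z
      Z-cyc = many-edges (y , ∪ʳ (x∈｛x｝ y)) (subst₂ (λ i j → 2 * i ≤ j + 1) (sym (card-∪｛｝ y∉)) (sym (D-∪｛｝ y∉))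
        (linear (card Q ∷ card (Q - c) ∷ D Q Q ∷ D (Q - c) (Q - c) ∷ d y (Q - c) ∷ d c Q ∷ [])
          ((2 , con 1 :+ x₁ , x₀) ∷ (1 , 2 :* x₀ , x₂) ∷ (1 , x₂ , 2 :* x₅ :+ x₃) ∷ (2 , x₅ , con 2) ∷ (2 , con 2 , x₄) ∷ [])
          (0 , 2 :* (x₁ :+ con 1) , x₃ :+ 2 :* x₄ :+ con 1)
          (≤-reflexive (sym (card-remove c∈Q))) (sum-≥ 2 dense) (≤-reflexive (D-remove c∈Q)) (regular c∈Q) (subst (2 ≤_) (sym (d-≁- y≁c)) two)))
      Z⊆X : Z ⊆ X
      Z⊆X p with ∪⁻ p
      ... | inj₁ q = Q⊆X (-⊆ q)
      ... | inj₂ q = subst (_∈ X) (sym (∈｛｝ q)) y∈X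
      u∈Z : u ∈ Z
      u∈Z = ∪ˡ (-⁺ u∈Q (~⇒≢ u~c))
      -- A dense subset of `Z` has at least `card Q = card Z` elements, so it is all of `Z`. Hence
      -- `u`, which lost its neighbour `c`, must see `y`.
      minimal-core : Cyc Z → 2 ≤ d u Z
      minimal-core (cyc W i s dn) = ≤-trans (dn (card-⊆-≡ i
        (≤-trans (≤-reflexive (trans (card-∪｛｝ y∉) (trans (+-comm _ 1) (sym (card-remove c∈Q))))) (minimal (cyc W (λ p → p) s dn) (λ p → Z⊆X (i p)))) u∈Z)) (d-mono i u)
      finish : 2 ≤ d u Z → u ~ y
      finish h with u ~? y
      ... | yes p = p
      ... | no p = absurd (≤-pred (≤-trans h (≤-trans (≤-reflexive (trans (d-∪｛｝ y∉ u) (trans (cong (d u (Q - c) +_) (e≡0 p)) (+-identityʳ _))))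
              (+-cancelˡ-≤ 1 _ _ (≤-trans (≤-reflexive (trans (cong (_+ d u (Q - c)) (sym (e≡1 u~c))) (sym (d-remove c∈Q u)))) (regular u∈Q))))))

-- Minimum degree three: finding a triangle or a quadrilateral.

module CubicCase {n : ℕ} (G : Graph n) (sat : Pairs.Sat G) (min₃ : ∀ v → 3 ≤ Counting.d G v full) (n≥6 : 6 ≤ n) where
  open TriangleCase G sat
  open Shortest G using (Least; least; regular; exchange)

  from-triangle : ∀ {a b c} → a ~ b → b ~ c → c ~ a → ∃ Universal
  from-triangle {a} {b} {c} ab bc ca = triangle-case F t size
    where
    F = full - a - b - c
    b∈ : b ∈ full - a
    b∈ = -⁺ ∈full (≢-sym (~⇒≢ ab))
    c∈ : c ∈ full - a - b
    c∈ = -⁺ (-⁺ ∈full (~⇒≢ ca)) (≢-sym (~⇒≢ bc))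
    t : Tri F a b c
    t = record
      { ab = ab ; bc = bc ; ca = ca
      ; out = λ p → let (q , z) = -⁻ p in let (r , y) = -⁻ q in proj₂ (-⁻ r) , y , z
      ; rest = λ x y z → -⁺ (-⁺ (-⁺ ∈full x) y) z
      ; deg₃ = λ {v} _ → subst (3 ≤_) (trans (d-remove ∈full v) (trans (cong (e v a +_) (trans (d-remove b∈ v) (cong (e v b +_) (d-remove c∈ v)))) (lem (e v a) (e v b) (e v c) _))) (min₃ v) }
      where
      lem : ∀ x y z w → x + (y + (z + w)) ≡ w + (x + y + z)
      lem = solve-∀
    size : 3 ≤ card F
    size = +-cancelˡ-≤ 3 _ _ (subst (6 ≤_) (trans (sym (card-full n)) (trans (card-remove ∈full) (cong suc (trans (card-remove b∈) (cong suc (card-remove c∈)))))) n≥6)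

  -- A leaf `y` of the forest outside a shortest cycle `Q` has two neighbours on `Q`. Let `u` be one
  -- of them and `u c v` a path on `Q`; as `y ≁ c`, exchanging `c` for `y` shows `v ~ y`, and
  -- `u c v y` is a quadrilateral.
  no-triangle-false : (∀ {x y z} → x ~ y → y ~ z → z ~ x → ⊥) → ∀ {Q} → Least full Q → ⊥
  no-triangle-false none {Q} L = from outside
    where
    open Least L
    R = full ∖ Q
    R-forest : Forest R
    R-forest f = clash (cyc Q (λ p → p) some dense) f λ p q → proj₂ (∖⁻ q) p
    deg : ∀ v → 3 ≤ d v Q + d v R
    deg v = subst (3 ≤_) (d-split (split-∖ (λ _ → ∈full)) v) (min₃ v)
    outside : ∃ λ y → y ∈ R × d y R ≤ 1
    outside = let (v , v∈Q) = some in
      let (u , _ , u∈R) = d-witness {v} {R} (linear (d v Q ∷ d v R ∷ []) ((1 , con 3 , x₀ :+ x₁) ∷ (1 , x₀ , con 2) ∷ []) (0 , con 1 , x₁) (deg v) (regular L v∈Q))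
      in forest-leaf R-forest u∈R
    four : ∀ {a b c k} → a ~ b → b ~ c → c ~ k → k ~ a → a ≢ c → b ≢ k → ⊥
    four {a} {b} {c} {k} ab bc ck ka a≢c b≢k = quad-false F t
      where
      open QuadCase G sat min₃ none
      F = full - a - b - c - k
      b∈ : b ∈ full - a
      b∈ = -⁺ ∈full (≢-sym (~⇒≢ ab))
      c∈ : c ∈ full - a - b
      c∈ = -⁺ (-⁺ ∈full (≢-sym a≢c)) (≢-sym (~⇒≢ bc))
      k∈ : k ∈ full - a - b - c
      k∈ = -⁺ (-⁺ (-⁺ ∈full (~⇒≢ ka)) (≢-sym b≢k)) (≢-sym (~⇒≢ ck))
      t : Quad F a b c k
      t = record
        { ab = ab ; bc = bc ; ck = ck ; ka = ka ; a≢c = a≢c ; b≢k = b≢k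
        ; out = λ p → let (q , w) = -⁻ p in let (r , z) = -⁻ q in let (s , y) = -⁻ r in proj₂ (-⁻ s) , y , z , w
        ; rest = λ x y z w → -⁺ (-⁺ (-⁺ (-⁺ ∈full x) y) z) w
        ; deg₃ = λ {v} _ → subst (3 ≤_) (trans (d-remove ∈full v) (trans (cong (e v a +_) (trans (d-remove b∈ v) (cong (e v b +_) (trans (d-remove c∈ v) (cong (e v c +_) (d-remove k∈ v)))))) (lem (e v a) (e v b) (e v c) (e v k) _))) (min₃ v) }
        where
        lem : ∀ x y z u w → x + (y + (z + (u + w))) ≡ w + (x + y + (z + u))
        lem = solve-∀
    from : (∃ λ y → y ∈ R × d y R ≤ 1) → ⊥
    from (y , y∈R , h) =
      let (u , y~u , u∈Q) = d-witness (≤-trans (s≤s z≤n) two-in-Q)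
          (c , u~c , c∈Q) = d-witness (≤-trans (s≤s z≤n) (dense u∈Q))
          (v , c~v , v∈Q , v≢u) = d-witness≢ (dense c∈Q) u
          y≁c = λ yc → none y~u u~c (~sym yc)
          v~y = exchange L ∈full (proj₂ (∖⁻ y∈R)) two-in-Q c∈Q y≁c v∈Q (~sym c~v)
      in four u~c c~v v~y y~u (≢-sym v≢u) (λ c≡y → proj₂ (∖⁻ y∈R) (subst (_∈ Q) c≡y c∈Q))
      where
      two-in-Q : 2 ≤ d y Q
      two-in-Q = linear (d y Q ∷ d y R ∷ []) ((1 , con 3 , x₀ :+ x₁) ∷ (1 , x₁ , con 1) ∷ []) (0 , con 2 , x₀) (deg y) h

  cubic-universal : ∃ Universal
  cubic-universal with any? (λ x → any? λ y → any? λ z → (x ~? y) ×-dec ((y ~? z) ×-dec (z ~? x)))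
  ... | yes (_ , _ , _ , ab , bc , ca) = from-triangle ab bc ca
  ... | no none = ⊥-elim (least (cyc full (λ p → p) somewhere (λ {v} _ → ≤-trans (s≤s (s≤s z≤n)) (min₃ v)))
          λ (Q , L) → no-triangle-false (λ p q r → none (_ , _ , _ , p , q , r)) L)
    where
    somewhere : Nonempty full
    somewhere = card-witness (subst (1 ≤_) (sym (card-full n)) (≤-trans (s≤s z≤n) n≥6))

-- A vertex of degree two: its neighbours `a` and `b` meet all cycles.

module PairCase {n : ℕ} (G : Graph n) (sat : Pairs.Sat G) (min₂ : ∀ v → 2 ≤ Counting.d G v full)
  (clique₂ : ∀ {v x y} → Counting.d G v full ≤ 2 → Counting._~_ G v x → Counting._~_ G v y → x ≢ y → Counting._~_ G x y) where
  open Covers G sat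
  open Shortest G using (Least; least; regular; edges≡)

  module _ (K : VSet n) (forest : Counting.Forest G K) where
    open Ends K

    record Base (a b : Fin n) : Set where
      field
        a≢b  : a ≢ b
        out  : ∀ {v} → v ∈ K → v ≢ a × v ≢ b
        rest : ∀ {v} → v ≢ a → v ≢ b → v ∈ K
        deg  : ∀ v → d v full ≡ d v K + (e v a + e v b)

    flip : ∀ {a b} → Base a b → Base b a
    flip t = record { a≢b = ≢-sym a≢b ; out = λ p → let (x , y) = out p in y , x ; rest = λ p q → rest q p
                    ; deg = λ v → trans (deg v) (cong (d v K +_) (+-comm (e v _) _)) }
      where open Base t

    module _ {a b : Fin n} (t : Base a b) where
      open Base t

      ab : a ~ b
      ab with a ~? b
      ... | yes p = p
      ... | no p = ⊥-elim (from (path a≢b p))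
        where
        from : PathCyc a b → ⊥
        from pc = forest (cyc Q (λ p → rest (λ { refl → apart u∈P p }) (λ { refl → apart v∈P p })) some dense)
          where open PathCyc pc

      isolated : ∀ {v} → d v K ≤ 0 → v ~ a
      isolated {v} h with v ~? a
      ... | yes p = p
      ... | no p = absurd (≤-pred (≤-trans (min₂ v) (≤-trans (≤-reflexive (deg v)) (+-mono-≤ h (+-mono-≤ (≤-reflexive (e≡0 p)) (e≤1 v b))))))

      -- Otherwise `v` has degree two in the whole graph and both neighbours in `K`; by `clique₂`
      -- they are adjacent, giving a triangle in a forest.
      labelled : ∀ {v} → v ∈ K → d v K ≤ 2 → v ~ a ⊎ v ~ b
      labelled {v} v∈K h with v ~? a | v ~? b
      ... | yes p | _ = inj₁ p
      ... | _ | yes p = inj₂ p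
      ... | no p | no q = ⊥-elim (from (d-witness (≤-trans (s≤s z≤n) big)))
        where
        same : d v full ≡ d v K
        same = trans (deg v) (trans (cong (d v K +_) (cong₂ _+_ (e≡0 p) (e≡0 q))) (+-identityʳ _))
        big : 2 ≤ d v K
        big = subst (2 ≤_) same (min₂ v)
        from : (∃ λ x → v ~ x × x ∈ K) → ⊥
        from (x , vx , x∈) = let (y , vy , y∈ , y≢x) = d-witness≢ big x in
          forest (cyc-in (triangle vx (clique₂ (subst (_≤ 2) (sym same) h) vx vy (≢-sym y≢x)) (~sym vy)) (v∈K ∷ x∈ ∷ y∈ ∷ []))

      -- The total degree of `v` is at most two, so its neighbours `w` and `a` are adjacent by
      -- `clique₂`.
      parent : ∀ {v w} → d v K ≤ 1 → v ~ w → w ∈ K → v ~ a → v ≁ b → w ~ a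
      parent {v} h vw w∈K va v≁b = clique₂ (≤-trans (≤-reflexive (deg v))
        (+-mono-≤ h (≤-trans (≤-reflexive (trans (cong (e v a +_) (e≡0 v≁b)) (+-identityʳ _))) (e≤1 v a)))) vw va (proj₁ (out w∈K))

      apex-edge : ∀ {x y X} → x ~ y → x ~ a → y ~ a → x ∈ X → y ∈ X → Cyc (｛ a ｝ ∪ X)
      apex-edge p q r x∈ y∈ = cyc-in (triangle (~sym q) p r) (∪ˡ (x∈｛x｝ a) ∷ ∪ʳ x∈ ∷ ∪ʳ y∈ ∷ [])

      leaf-edge : ∀ {v w X} → v ∈ K → d v K ≤ 1 → v ~ w → w ∈ K → v ≁ b → v ∈ X → w ∈ X → Cyc (｛ a ｝ ∪ X)
      leaf-edge v∈K h vw w∈K v≁b v∈X w∈X with labelled v∈K (m≤n⇒m≤1+n h)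
      ... | inj₁ va = apex-edge vw va (parent h vw w∈K va v≁b) v∈X w∈X
      ... | inj₂ vb = contradiction vb v≁b

      universal : (∀ {v} → v ∈ K → v ~ a) → Universal a
      universal h v v≢a with v ≟ b
      ... | yes refl = ab
      ... | no v≢b = ~sym (h (rest v≢a v≢b))

    -- Designed for pairs: disjoint blocks cannot close cycles with different vertices among `a` and
    -- `b`, so both do so with the same one, say `a`, and neither with `b`; `covered` then makes
    -- both adjacent to `a` throughout.
    record Block (a b : Fin n) (B : VSet n) : Set where
      field
        inside  : B ⊆ K
        cyclic  : Cyc (｛ a ｝ ∪ B) ⊎ Cyc (｛ b ｝ ∪ B)
        covered : Forest (｛ b ｝ ∪ B) → ∀ {v} → v ∈ B → v ~ a
        covered′ : Forest (｛ a ｝ ∪ B) → ∀ {v} → v ∈ B → v ~ b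

    module _ {q : Fin n} (E : End q) where
      open End E

      claw-quad : ∀ {a b l m} → Base a b → Leaf q l → Leaf q m → l ≢ m → l ~ a → m ~ a → Cyc (｛ a ｝ ∪ claw q)
      claw-quad t L M l≢m la ma = cyc-in (quad (~sym la) (~sym (proj₁ (proj₂ L))) (proj₁ (proj₂ M)) ma (≢-sym (proj₁ (Base.out t q∈F))) l≢m)
        (∪ˡ (x∈｛x｝ _) ∷ ∪ʳ (leaf∈claw L) ∷ ∪ʳ q∈claw ∷ ∪ʳ (leaf∈claw M) ∷ [])

      claw-leaf : ∀ {a b l} → Base a b → Leaf q l → l ≁ b → Cyc (｛ a ｝ ∪ claw q)
      claw-leaf t L@(l∈ , ql , h) l≁b = leaf-edge t l∈ h (~sym ql) q∈F l≁b (leaf∈claw L) q∈claw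

      -- A leaf that misses one of `a`, `b` forms a triangle with `q` and the other, by `parent`. A
      -- leaf seeing both leaves two options: another leaf, giving a quadrilateral or again such a
      -- triangle, or `d q K ≤ 2`, so that `q` itself sees `a` or `b`.
      claw-cyclic : ∀ {a b} → Base a b → Cyc (｛ a ｝ ∪ claw q) ⊎ Cyc (｛ b ｝ ∪ claw q)
      claw-cyclic {a} {b} t = from (a-leaf E)
        where
        both : ∀ {l} → Leaf q l → l ~ a → l ~ b → (∃ λ m → Leaf q m × m ≢ l) ⊎ d q K ≤ 2 → Cyc (｛ a ｝ ∪ claw q) ⊎ Cyc (｛ b ｝ ∪ claw q)
        both L la lb (inj₁ (m , M , m≢l)) with m ~? a
        ... | yes ma = inj₁ (claw-quad t L M (≢-sym m≢l) la ma)
        ... | no m≁a = inj₂ (claw-leaf (flip t) M m≁a)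
        both L la lb (inj₂ h) with labelled t q∈F h
        ... | inj₁ qa = inj₁ (apex-edge t (proj₁ (proj₂ L)) qa la q∈claw (leaf∈claw L))
        ... | inj₂ qb = inj₂ (apex-edge (flip t) (proj₁ (proj₂ L)) qb lb q∈claw (leaf∈claw L))
        from : (∃ λ l → Leaf q l) → Cyc (｛ a ｝ ∪ claw q) ⊎ Cyc (｛ b ｝ ∪ claw q)
        from (l , L) with l ~? a | l ~? b
        ... | no l≁a | _ = inj₂ (claw-leaf (flip t) L l≁a)
        ... | yes _ | no l≁b = inj₁ (claw-leaf t L l≁b)
        ... | yes la | yes lb = both L la lb (other-leaf? E l)

      claw-covered : ∀ {a b} → Base a b → Forest (｛ b ｝ ∪ claw q) → ∀ {v} → v ∈ claw q → v ~ a
      claw-covered {a} {b} t f p with claw⁻ p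
      ... | inj₂ L = leaf-a L
        where
        leaf-a : ∀ {l} → Leaf q l → l ~ a
        leaf-a {l} L with l ~? a
        ... | yes la = la
        ... | no l≁a = contradiction (claw-leaf (flip t) L l≁a) f
      ... | inj₁ refl with q ~? a
      ...   | yes qa = qa
      ...   | no q≁a = ⊥-elim (from (a-leaf E))
        where
        leaf-b : ∀ {l} → Leaf q l → l ~ b
        leaf-b {l} L@(l∈ , ql , h) with l ~? b
        ... | yes lb = lb
        ... | no l≁b with labelled t l∈ (m≤n⇒m≤1+n h)
        ...   | inj₁ la = contradiction (parent t h (~sym ql) q∈F la l≁b) q≁a
        ...   | inj₂ lb = lb
        try : ∀ {l} → Leaf q l → (∃ λ m → Leaf q m × m ≢ l) ⊎ d q K ≤ 2 → ⊥
        try L (inj₁ (m , M , m≢l)) = f (claw-quad (flip t) L M (≢-sym m≢l) (leaf-b L) (leaf-b M))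
        try L (inj₂ h) with labelled t q∈F h
        ... | inj₁ qa = q≁a qa
        ... | inj₂ qb = f (apex-edge (flip t) (proj₁ (proj₂ L)) qb (leaf-b L) q∈claw (leaf∈claw L))
        from : (∃ λ l → Leaf q l) → ⊥
        from (l , L) = try L (other-leaf? E l)

      claw-block : ∀ {a b} → Base a b → Block a b (claw q)
      claw-block t = record { inside = claw⊆F E ; cyclic = claw-cyclic t ; covered = claw-covered t ; covered′ = claw-covered (flip t) }

    module _ {l m : Fin n} (l∈ : l ∈ K) (m∈ : m ∈ K) (hl : d l K ≤ 1) (hm : d m K ≤ 1) (lm : l ~ m) where
      edge-cyclic : ∀ {a b} → Base a b → Cyc (｛ a ｝ ∪ pair l m) ⊎ Cyc (｛ b ｝ ∪ pair l m)
      edge-cyclic {a} {b} t with l ~? a | l ~? b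
      ... | no l≁a | _ = inj₂ (leaf-edge (flip t) l∈ hl lm m∈ l≁a a∈pair b∈pair)
      ... | yes _ | no l≁b = inj₁ (leaf-edge t l∈ hl lm m∈ l≁b a∈pair b∈pair)
      ... | yes la | yes lb with labelled t m∈ (m≤n⇒m≤1+n hm)
      ...   | inj₁ ma = inj₁ (apex-edge t lm la ma a∈pair b∈pair)
      ...   | inj₂ mb = inj₂ (apex-edge (flip t) lm lb mb a∈pair b∈pair)

      edge-covered : ∀ {a b} → Base a b → Forest (｛ b ｝ ∪ pair l m) → ∀ {v} → v ∈ pair l m → v ~ a
      edge-covered {a} {b} t f {v} p with v ~? a | pair⁻ p
      ... | yes va | _ = va
      ... | no v≁a | inj₁ refl = contradiction (leaf-edge (flip t) l∈ hl lm m∈ v≁a a∈pair b∈pair) f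
      ... | no v≁a | inj₂ refl = contradiction (leaf-edge (flip t) m∈ hm (~sym lm) l∈ v≁a b∈pair a∈pair) f

      edge-block : ∀ {a b} → Base a b → Block a b (pair l m)
      edge-block t = record { inside = inside ; cyclic = edge-cyclic t ; covered = edge-covered t ; covered′ = edge-covered (flip t) }
        where
        inside : pair l m ⊆ K
        inside p with pair⁻ p
        ... | inj₁ refl = l∈
        ... | inj₂ refl = m∈

    module _ {a b : Fin n} (t : Base a b) {X Y : VSet n} (X⊆K : X ⊆ K) (Y⊆K : Y ⊆ K) (XY : Disjoint X Y)
             (cX : Cyc (｛ a ｝ ∪ X)) (cY : Cyc (｛ a ｝ ∪ Y)) (Xa : ∀ {v} → v ∈ X → v ~ a) (Ya : ∀ {v} → v ∈ Y → v ~ a) where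
      open Base t

      far : ∀ {u w Z} → u ∈ K → w ∈ K → u ~ w → u ~ b → w ~ b → Cyc (｛ a ｝ ∪ Z) → Z ⊆ K → u ∉ Z → w ∉ Z → ⊥
      far {u} {w} {Z} u∈K w∈K uw ub wb c Z⊆K u∉ w∉ = clash c (triangle (~sym ub) uw wb) λ p q → case (∪⁻ p) (listed q)
        where
        case : ∀ {v} → v ∈ ｛ a ｝ ⊎ v ∈ Z → v List.∈ b ∷ u ∷ w ∷ [] → ⊥
        case (inj₁ p) (here refl) = a≢b (sym (∈｛｝ p))
        case (inj₁ p) (there (here refl)) = proj₁ (out u∈K) (∈｛｝ p)
        case (inj₁ p) (there (there (here refl))) = proj₁ (out w∈K) (∈｛｝ p)
        case (inj₂ p) (here refl) = proj₂ (out (Z⊆K p)) refl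
        case (inj₂ p) (there (here refl)) = u∉ p
        case (inj₂ p) (there (there (here refl))) = w∉ p

      -- The triangle `b u w` avoids one of the two cycles through `a`: `u` lies in neither block
      -- because it misses `a`, and `w` lies in at most one.
      no-b-edge : ∀ {u w} → u ∈ K → w ∈ K → u ~ w → u ≁ a → u ~ b → w ~ b → ⊥
      no-b-edge {u} {w} u∈K w∈K uw u≁a ub wb with w ∈? X
      ... | no w∉X = far u∈K w∈K uw ub wb cX X⊆K (u≁a ∘ Xa) w∉X
      ... | yes w∈X = far u∈K w∈K uw ub wb cY Y⊆K (u≁a ∘ Ya) (XY w∈X)

      leaf-a : ∀ {u} → u ∈ K → d u K ≤ 1 → u ~ a
      leaf-a {u} u∈K h with u ~? a
      ... | yes p = p
      ... | no u≁a with 1 ≤? d u K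
      ...   | no z = isolated t (≤-pred (≰⇒> z))
      ...   | yes pos with labelled t u∈K (m≤n⇒m≤1+n h)
      ...     | inj₁ ua = ua
      ...     | inj₂ ub = ⊥-elim (from (d-witness pos))
        where
        from : (∃ λ w → u ~ w × w ∈ K) → ⊥
        from (w , uw , w∈K) = no-b-edge u∈K w∈K uw u≁a ub (parent (flip t) h uw w∈K ub u≁a)

      -- The cycle C through b which would be created together with one through
      -- a and z: counting the edges between C - b and the rest of K shows that
      -- z and one of its neighbours span a triangle with b.
      module Far {z : Fin n} (z∈K : z ∈ K) (z≁a : z ≁ a) {Z C : VSet n} (L : Least Z C) (a∉C : a ∉ C) (z∉C : z ∉ C) where
        open Least L
        C⊆K∪b : ∀ {v} → v ∈ C → v ≢ b → v ∈ K
        C⊆K∪b p v≢b = rest (λ { refl → a∉C p }) v≢b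
        b∈C : b ∈ C
        b∈C with b ∈? C
        ... | yes p = p
        ... | no p = ⊥-elim (forest (cyc C (λ q → C⊆K∪b q (λ { refl → p q })) some dense))
        B = C - b
        B⊆K : B ⊆ K
        B⊆K p = let (q , r) = -⁻ p in C⊆K∪b q r
        ne-B : Nonempty B
        ne-B = let (w , bw , w∈) = d-witness (≤-trans (s≤s z≤n) (dense b∈C)) in w , -⁺ w∈ (≢-sym (~⇒≢ bw))
        B-edges : 2 * card B ≤ D B B + 2
        B-edges = linear (card C ∷ card B ∷ D C C ∷ D B B ∷ d b C ∷ [])
          ((2 , con 1 :+ x₁ , x₀) ∷ (1 , 2 :* x₀ , x₂) ∷ (1 , x₂ , 2 :* x₄ :+ x₃) ∷ (2 , x₄ , con 2) ∷ [])
          (0 , 2 :* x₁ , x₃ :+ con 2)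
          (≤-reflexive (sym (card-remove b∈C))) (≤-reflexive (sym (edges≡ L))) (≤-reflexive (D-remove b∈C)) (regular L b∈C)
        U? : ∀ v → Dec (v ∈ K × v ∉ C × 1 ≤ d v K)
        U? v = (v ∈? K) ×-dec (¬? (v ∈? C) ×-dec (1 ≤? d v K))
        U = sep U?
        U⁻ : ∀ {v} → v ∈ U → v ∈ K × v ∉ C × 1 ≤ d v K
        U⁻ = sep⁻ U?
        UB : Disjoint U B
        UB p q = proj₁ (proj₂ (U⁻ p)) (-⊆ q)
        a∉U : a ∉ U
        a∉U p = proj₁ (out (proj₁ (U⁻ p))) refl
        Ua : D U U + 2 * d a U ≤ 2 * card U
        Ua = +-cancelʳ-≤ 2 _ _ (≤-trans (≤-reflexive (cong (_+ 2) (sym (D-∪｛｝ a∉U))))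
          (≤-trans (forest-edges (U ∪ ｛ a ｝) fr (a , ∪ʳ (x∈｛x｝ a))) (≤-reflexive (trans (cong (2 *_) (card-∪｛｝ a∉U)) (*-distribˡ-+ 2 (card U) 1)))))
          where
          fr : Forest (U ∪ ｛ a ｝)
          fr f = clash (cyc C (λ p → p) some dense) f λ p q → case p (∪⁻ q)
            where
            case : ∀ {v} → v ∈ C → v ∈ U ⊎ v ∈ ｛ a ｝ → ⊥
            case p (inj₁ q) = proj₁ (proj₂ (U⁻ q)) p
            case p (inj₂ q) = a∉C (subst (_∈ C) (∈｛｝ q) p)
        U∪B : D U U + 2 * D U B + D B B + 2 ≤ 2 * (card U + card B)
        U∪B = subst₂ (λ i j → i + 2 ≤ 2 * j) (D-split (split-∪ UB)) (card-split (split-∪ UB))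
          (forest-edges (U ∪ B) (Forest-mono (λ p → case (∪⁻ p)) forest) (_ , ∪ʳ (proj₂ ne-B)))
          where
          case : ∀ {v} → v ∈ U ⊎ v ∈ B → v ∈ K
          case (inj₁ p) = proj₁ (U⁻ p)
          case (inj₂ p) = B⊆K p
        seen : ∀ {u} → u ∈ K → d u K ≤ d u U + d u B
        seen {u} u∈K = subst (d u K ≤_) (d-split (split-∪ UB) u) (card-mono λ p → let (r , s) = ∩⁻ p in ∩⁺ r (place r s))
          where
          place : ∀ {w} → u ~ w → w ∈ K → w ∈ U ∪ B
          place {w} uw w∈K with w ∈? C
          ... | yes w∈C = ∪ʳ (-⁺ w∈C (proj₂ (out w∈K)))
          ... | no w∉C = ∪ˡ (sep⁺ U? (w∈K , w∉C , d≥1 (~sym uw) u∈K))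
        two-each : ∀ {u} → u ∈ U → 2 ≤ d u U + d u B + e u a
        two-each {u} p with 2 ≤? d u K
        ... | yes h = ≤-trans h (≤-trans (seen (proj₁ (U⁻ p))) (m≤m+n _ _))
        ... | no h = ≤-trans (+-mono-≤ (proj₂ (proj₂ (U⁻ p))) (≤-reflexive (sym (e≡1 (leaf-a (proj₁ (U⁻ p)) (≤-pred (≰⇒> h)))))))
                       (+-monoˡ-≤ (e u a) (seen (proj₁ (U⁻ p))))
        -- Adding the forest bounds for `U ∪ ｛ a ｝` and `U ∪ B`, where `B` has at least as many
        -- edges as a spanning path, caps the very sum that `two-each` bounds from below. Equality
        -- then holds at each vertex of `U`.
        total : sum U (λ u → d u U + d u B + e u a) ≤ 2 * card U
        total = subst (_≤ 2 * card U) (sym (trans (sum-+ U _ _) (cong₂ _+_ (sum-+ U _ _) (trans (sum-cong (λ {v} _ → sym (d-｛｝ v a))) (D-｛｝ʳ U a)))))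
          (linear (D U U ∷ D U B ∷ D B B ∷ d a U ∷ card U ∷ card B ∷ [])
            ((1 , x₀ :+ 2 :* x₃ , 2 :* x₄) ∷ (1 , x₀ :+ 2 :* x₁ :+ x₂ :+ con 2 , 2 :* (x₄ :+ x₅)) ∷ (1 , 2 :* x₅ , x₂ :+ con 2) ∷ [])
            (1 , x₀ :+ x₁ :+ x₃ , 2 :* x₄) Ua U∪B B-edges)
        tight : ∀ {u} → u ∈ U → d u U + d u B + e u a ≤ 2
        tight = sum-tight-≥ 2 two-each total
        low : ∀ {u} → u ∈ U → d u K + e u a ≤ 2
        low p = ≤-trans (+-monoˡ-≤ _ (seen (proj₁ (U⁻ p)))) (tight p)
        z-big : 2 ≤ d z K
        z-big = ≰⇒> λ h → z≁a (leaf-a z∈K h)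
        z∈U : z ∈ U
        z∈U = sep⁺ U? (z∈K , z∉C , ≤-trans (s≤s z≤n) z-big)
        b-label : ∀ {u} → u ∈ U → u ≁ a → u ~ b
        b-label p u≁a with labelled t (proj₁ (U⁻ p)) (≤-trans (m≤m+n _ _) (low p))
        ... | inj₁ ua = contradiction ua u≁a
        ... | inj₂ ub = ub
        zB≤1 : d z B ≤ 1
        zB≤1 = linear (D B B ∷ d z B ∷ card B ∷ []) ((1 , x₀ :+ 2 :* x₁ :+ con 2 , 2 :* (x₂ :+ con 1)) ∷ (1 , 2 :* x₂ , x₀ :+ con 2) ∷ [])
          (1 , x₁ , con 1)
          (subst₂ (λ i j → i + 2 ≤ 2 * j) (D-∪｛｝ z∉B) (card-∪｛｝ z∉B) (forest-edges (B ∪ ｛ z ｝) (Forest-mono (λ p → case (∪⁻ p)) forest) (z , ∪ʳ (x∈｛x｝ z)))) B-edges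
          where
          z∉B : z ∉ B
          z∉B p = z∉C (-⊆ p)
          case : ∀ {v} → v ∈ B ⊎ v ∈ ｛ z ｝ → v ∈ K
          case (inj₁ p) = B⊆K p
          case (inj₂ p) = subst (_∈ K) (sym (∈｛｝ p)) z∈K
        zU : 1 ≤ d z U
        zU = +-cancelʳ-≤ 1 _ _ (≤-trans z-big (≤-trans (seen z∈K) (+-monoʳ-≤ (d z U) zB≤1)))
        impossible : ⊥
        impossible = from (d-witness zU)
          where
          from : (∃ λ w → z ~ w × w ∈ U) → ⊥
          from (w , zw , w∈U) = no-b-edge z∈K (proj₁ (U⁻ w∈U)) zw z≁a (b-label z∈U z≁a) wb
            where
            wb : w ~ b
            wb with w ~? a | w ~? b
            ... | _ | yes p = p
            ... | no w≁a | no _ = b-label w∈U w≁a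
            ... | yes wa | no w≁b = contradiction (parent t (+-cancelʳ-≤ 1 _ _ (subst (λ i → d w K + i ≤ 2) (e≡1 wa) (low w∈U))) (~sym zw) z∈K wa w≁b) z≁a

      two-blocks : Universal a
      two-blocks = universal t λ {z} z∈K → by z∈K
        where
        by : ∀ {z} → z ∈ K → z ~ a
        by {z} z∈K with z ~? a
        ... | yes p = p
        ... | no z≁a = ⊥-elim (from (path (≢-sym (proj₁ (out z∈K))) (z≁a ∘ ~sym)))
          where
          from : PathCyc a z → ⊥
          from pc = least (cyc Q (λ p → p) some dense) λ (C , L) →
            Far.impossible z∈K z≁a L (λ p → apart u∈P (Least.Q⊆X L p)) (λ p → apart v∈P (Least.Q⊆X L p))
            where open PathCyc pc

    blocks-apart : ∀ {a b X Y} → Base a b → X ⊆ K → Y ⊆ K → Disjoint X Y → Cyc (｛ a ｝ ∪ X) → Cyc (｛ b ｝ ∪ Y) → ⊥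
    blocks-apart t X⊆K Y⊆K XY c c′ = clash c c′ λ p q → case (∪⁻ p) (∪⁻ q)
      where
      open Base t
      case : ∀ {v} → v ∈ ｛ _ ｝ ⊎ v ∈ _ → v ∈ ｛ _ ｝ ⊎ v ∈ _ → ⊥
      case (inj₁ p) (inj₁ q) = a≢b (trans (sym (∈｛｝ p)) (∈｛｝ q))
      case (inj₁ p) (inj₂ q) = proj₁ (out (Y⊆K q)) (∈｛｝ p)
      case (inj₂ p) (inj₁ q) = proj₂ (out (X⊆K p)) (∈｛｝ q)
      case (inj₂ p) (inj₂ q) = XY p q

    from-blocks : ∀ {a b X Y} → Base a b → Block a b X → Block a b Y → Disjoint X Y → ∃ Universal
    from-blocks {a} {b} {X} {Y} t β γ XY with Block.cyclic β | Block.cyclic γ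
    ... | inj₁ c | inj₁ c′ = a , two-blocks t (Block.inside β) (Block.inside γ) XY c c′
            (Block.covered β λ x → blocks-apart t (Block.inside γ) (Block.inside β) (λ p q → XY q p) c′ x)
            (Block.covered γ λ x → blocks-apart t (Block.inside β) (Block.inside γ) XY c x)
    ... | inj₂ c | inj₂ c′ = b , two-blocks (flip t) (Block.inside β) (Block.inside γ) XY c c′
            (Block.covered′ β λ x → blocks-apart t (Block.inside β) (Block.inside γ) XY x c′)
            (Block.covered′ γ λ x → blocks-apart t (Block.inside γ) (Block.inside β) (λ p q → XY q p) x c)
    ... | inj₁ c | inj₂ c′ = ⊥-elim (blocks-apart t (Block.inside β) (Block.inside γ) XY c c′)
    ... | inj₂ c | inj₁ c′ = ⊥-elim (blocks-apart t (Block.inside γ) (Block.inside β) (λ p q → XY q p) c′ c)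

    -- With no edge in `K`, `a` sees everything. With exactly one, `a`, `b` and an end of it meet
    -- all edges. Two edges of the matching `K` form disjoint blocks.
    pair-flat : ∀ {a b} → Base a b → (∀ {v} → v ∈ K → d v K ≤ 1) → ∃ Universal
    pair-flat {a} {b} t low with any? (λ u → any? λ v → (u ∈? K) ×-dec ((v ∈? K) ×-dec (u ~? v)))
    ... | no none = a , universal t λ {v} p → isolated t (≁⇒d≤0 λ q r → none (_ , _ , p , q , r))
    ... | yes (l , m , l∈ , m∈ , lm) with any? (λ u → any? λ v → (u ∈? K) ×-dec ((v ∈? K) ×-dec ((u ~? v) ×-dec ¬? (u ∈? pair l m))))
    ...   | no none = a , covering⇒universal (≢-sym (proj₂ (out l∈))) cov
      where
      open Base t
      only-m : ∀ {u v} → u ≢ a × u ≢ b × u ≢ l → v ∈ K → u ~ v → u ≡ m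
      only-m {u} (p , q , r) v∈ uv with u ∈? pair l m
      ... | no s = contradiction (_ , _ , rest p q , v∈ , uv , s) none
      ... | yes s with pair⁻ s
      ...   | inj₁ x = contradiction x r
      ...   | inj₂ x = x
      cov : Covering a b l
      cov o@(p , q , _) o′@(p′ , q′ , _) uv = ~⇒≢ uv (trans (only-m o (rest p′ q′) uv) (sym (only-m o′ (rest p q) (~sym uv))))
    ...   | yes (u , v , u∈ , v∈ , uv , u∉) = from-blocks t (edge-block l∈ m∈ (low l∈) (low m∈) lm t) (edge-block u∈ v∈ (low u∈) (low v∈) uv t) dis
      where
      dis : Disjoint (pair l m) (pair u v)
      dis p q with pair⁻ p | pair⁻ q
      ... | x | inj₁ refl = u∉ p
      ... | inj₁ refl | inj₂ refl = u∉ (subst (_∈ pair l m) (d≤1⇒≡ (low l∈) lm (~sym uv) m∈ u∈) b∈pair)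
      ... | inj₂ refl | inj₂ refl = u∉ (subst (_∈ pair l m) (d≤1⇒≡ (low m∈) (~sym lm) (~sym uv) l∈ u∈) a∈pair)

    -- Either all edges of `K` meet `q`, so that `a`, `b`, `q` cover, or an edge off `q` lies
    -- outside the claw and serves as a second block.
    pair-star : ∀ {a b q} → Base a b → End q → (∀ {v} → v ∈ K → v ≢ q → d v K ≤ 1) → ∃ Universal
    pair-star {a} {b} {q} t E low with any? (λ u → any? λ v → (u ∈? K) ×-dec ((v ∈? K) ×-dec ((u ~? v) ×-dec (¬? (u ≟ q) ×-dec ¬? (v ≟ q)))))
    ... | no none = a , covering⇒universal (≢-sym (proj₂ (out (End.q∈F E)))) λ (p , r , s) (p′ , r′ , s′) uv →
            none (_ , _ , rest p r , rest p′ r′ , uv , s , s′)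
      where open Base t
    ... | yes (u , v , u∈ , v∈ , uv , u≢q , v≢q) = from-blocks t (claw-block E t) (edge-block u∈ v∈ (low u∈ u≢q) (low v∈ v≢q) uv t) dis
      where
      off : ∀ {x y} → x ∈ K → y ∈ K → x ≢ q → y ≢ q → x ~ y → x ∉ claw q
      off x∈ y∈ x≢q y≢q xy p with claw⁻ p
      ... | inj₁ x≡q = x≢q x≡q
      ... | inj₂ L = y≢q (leaf-nbr (End.q∈F E) L y∈ xy)
      dis : Disjoint (claw q) (pair u v)
      dis p r with pair⁻ r
      ... | inj₁ refl = off u∈ v∈ u≢q v≢q uv p
      ... | inj₂ refl = off v∈ u∈ v≢q u≢q (~sym uv) p

    pair-universal : ∀ {a b} → Base a b → ∃ Universal
    pair-universal t with shape forest
    ... | flat low = pair-flat t low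
    ... | star q E low = pair-star t E low
    ... | ends q r q≢r E E′ = from-blocks t (claw-block E t) (claw-block E′ t) (claws-apart q≢r E E′)

  -- The triangle `x a b` forces `K` to be a forest, because `x` is isolated in `K` and so lies on
  -- none of its cycles.
  from-degree-two : ∀ {x} → d x full ≤ 2 → ∃ Universal
  from-degree-two {x} h with d-witness (≤-trans (s≤s z≤n) (min₂ x))
  ... | a , xa , _ with d-witness≢ (min₂ x) a
  ...   | b , xb , _ , b≢a = pair-universal K forest t
    where
    adjacent = clique₂ h xa xb (≢-sym b≢a)
    K = full - a - b
    b∈ : b ∈ full - a
    b∈ = -⁺ ∈full b≢a
    deg : ∀ v → d v full ≡ d v K + (e v a + e v b)
    deg v = trans (d-remove ∈full v) (trans (cong (e v a +_) (d-remove b∈ v)) (lem (e v a) (e v b) (d v K)))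
      where
      lem : ∀ x y z → x + (y + z) ≡ z + (x + y)
      lem = solve-∀
    dx : d x K ≤ 0
    dx = +-cancelʳ-≤ 2 _ _ (≤-trans (≤-reflexive (sym (trans (deg x) (cong (d x K +_) (cong₂ _+_ (e≡1 xa) (e≡1 xb)))))) h)
    forest : Forest K
    forest (cyc Q i s dn) = clash (triangle xa adjacent (~sym xb)) (cyc Q (λ p → p) s dn) λ p q → case (listed p) q (-⁻ (i q))
      where
      case : ∀ {v} → v List.∈ x ∷ a ∷ b ∷ [] → v ∈ Q → v ∈ full - a × v ≢ b → ⊥
      case (here refl) q _ = absurd (≤-trans (≤-trans (s≤s z≤n) (dn q)) (≤-trans (d-mono i x) dx))
      case (there (here refl)) _ (r , _) = proj₂ (-⁻ r) refl
      case (there (there (here refl))) _ (_ , r) = r refl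
    t : Base K forest a b
    t = record { a≢b = ≢-sym b≢a ; out = λ p → let (q , r) = -⁻ p in proj₂ (-⁻ q) , r ; rest = λ p q → -⁺ (-⁺ ∈full p) q ; deg = deg }

irreducible-universal : ∀ {n} {G : Graph n} (sat : Pairs.Sat G) → 6 ≤ n → (∀ v → 2 ≤ Counting.d G v full) →
  (∀ {v x y} → Counting.d G v full ≤ 2 → Counting._~_ G v x → Counting._~_ G v y → x ≢ y → Counting._~_ G x y) →
  ∃ (Covers.Universal G sat)
irreducible-universal {n} {G} sat n≥6 min₂ clique₂ with any? (λ v → Counting.d G v full ≤? 2)
... | yes (x , h) = PairCase.from-degree-two G sat min₂ clique₂ h
... | no none = CubicCase.cubic-universal G sat (λ v → ≰⇒> λ h → none (v , h)) n≥6

-- A universal vertex whose complement is a tree.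

module Hub {n : ℕ} (G : Graph n) (sat : Pairs.Sat G) (min₂ : ∀ v → 2 ≤ Counting.d G v full) (n≥6 : 6 ≤ n)
           {h : Fin n} (hub : Covers.Universal G sat h) where
  open Covers G sat
  open Shortest G using (Least; least; regular; edges≡; exchange)

  J : VSet n
  J = full - h

  ∈J : ∀ {v} → v ≢ h → v ∈ J
  ∈J = -⁺ ∈full

  J≢h : ∀ {v} → v ∈ J → v ≢ h
  J≢h p = proj₂ (-⁻ p)

  h~ : ∀ {v} → v ∈ J → h ~ v
  h~ p = hub _ (J≢h p)

  card-J : n ≡ 1 + card J
  card-J = trans (sym (card-full n)) (card-remove ∈full)

  J≥5 : 5 ≤ card J
  J≥5 = ≤-pred (subst (6 ≤_) card-J n≥6)

  all-adjacent : ∀ {v X} → (∀ {u} → u ∈ X → v ~ u) → d v X ≡ card X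
  all-adjacent {v} {X} a = ≤-antisym (d≤card v X) (card-mono λ p → ∩⁺ (a p) p)

  total : D full full ≡ 2 * card J + D J J
  total = trans (D-remove ∈full) (cong (λ i → 2 * i + D J J) (trans (sym d-self) (all-adjacent h~)))

  d-J : ∀ {v} → v ∈ J → 1 ≤ d v J
  d-J {v} p = ≤-pred (subst (2 ≤_) (trans (d-remove ∈full v) (cong (_+ d v J) (e≡1 (~sym (h~ p))))) (min₂ v))

  path-end : ∀ {u v P} → u ≢ v → 2 ≤ d u P + (δ u u + δ u v) → 1 ≤ d u P
  path-end {u} {v} {P} u≢v le = ≤-pred (subst (2 ≤_) (trans (cong (d u P +_) (cong₂ _+_ (δ-refl u) (δ-≢ u≢v))) (+-comm _ 1)) le)

  path-end′ : ∀ {u v P} → u ≢ v → 2 ≤ d v P + (δ v u + δ v v) → 1 ≤ d v P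
  path-end′ {u} {v} {P} u≢v le = path-end (≢-sym u≢v) (subst (λ i → 2 ≤ d v P + i) (+-comm (δ v u) (δ v v)) le)

  path-mid : ∀ {u v x P} → x ≢ u → x ≢ v → 2 ≤ d x P + (δ x u + δ x v) → 2 ≤ d x P
  path-mid {x = x} {P} p q le = subst (2 ≤_) (trans (cong (d x P +_) (cong₂ _+_ (δ-≢ p) (δ-≢ q))) (+-identityʳ _)) le

  module Tree (forest : Forest J) where
    record PathIn (X : VSet n) (u v : Fin n) : Set where
      field
        P    : VSet n
        P⊆X  : P ⊆ X
        u∈P  : u ∈ P
        v∈P  : v ∈ P
        deg  : ∀ {x} → x ∈ P → 2 ≤ d x P + (δ x u + δ x v)

    -- As `J` is a forest, the cycle accompanying a path from `u` to `v` must pass through `h`, and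
    -- its other vertices contain an edge of `J` avoiding the path.
    record Free (u v : Fin n) : Set where
      field
        path-in : PathIn J u v
        {z w}   : Fin n
        z∈      : z ∈ J ∖ PathIn.P path-in
        w∈      : w ∈ J ∖ PathIn.P path-in
        zw      : z ~ w

    free : ∀ {u v} → u ≢ v → u ≁ v → Free u v
    free {u} {v} u≢v u≁v = from (path u≢v u≁v)
      where
      from : PathCyc u v → Free u v
      from pc with h ∈? PathCyc.Q pc
      ... | no h∉ = ⊥-elim (forest (cyc Q (λ p → ∈J (λ { refl → h∉ p })) some dense))
        where open PathCyc pc
      ... | yes h∈ = edge (d-witness (≤-trans (s≤s z≤n) (dense h∈)))
        where
        open PathCyc pc
        edge : (∃ λ z → h ~ z × z ∈ Q) → Free u v
        edge (z , hz , z∈) = let (w , zw , w∈ , w≢h) = d-witness≢ (dense z∈) h in record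
          { path-in = record { P = P ; P⊆X = λ p → ∈J (λ { refl → apart p h∈ }) ; u∈P = u∈P ; v∈P = v∈P ; deg = deg }
          ; z∈ = ∖⁺ (∈J (≢-sym (~⇒≢ hz))) (λ p → apart p z∈) ; w∈ = ∖⁺ (∈J w≢h) (λ p → apart p w∈) ; zw = zw }

    Connected : VSet n → Set
    Connected X = ∀ {u v} → u ∈ X → v ∈ X → u ≢ v → u ≁ v → PathIn X u v

    -- A vertex of degree at most one is never interior to a `PathIn`, so removing it preserves
    -- connectedness. It has degree exactly one, being joined to the others.
    tree-edges : ∀ X → Forest X → Nonempty X → Connected X → 2 * card X ≤ D X X + 2
    tree-edges = card-induction _ step
      where
      step : ∀ X → (∀ {x} → x ∈ X → Forest (X - x) → Nonempty (X - x) → Connected (X - x) → 2 * card (X - x) ≤ D (X - x) (X - x) + 2) →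
             Forest X → Nonempty X → Connected X → 2 * card X ≤ D X X + 2
      step X ih f (v , p) conn with forest-leaf f p
      ... | x , x∈ , low with nonempty? (X - x)
      ...   | no ¬ne = ≤-trans (*-monoʳ-≤ 2 (≤-trans (≤-reflexive (card-remove x∈)) (s≤s (none (X - x) ¬ne)))) (m≤n+m 2 _)
        where
        none : ∀ Y → ¬ Nonempty Y → card Y ≤ 0
        none Y e with 1 ≤? card Y
        ... | yes q = contradiction (card-witness q) e
        ... | no q = ≤-pred (≰⇒> q)
      ...   | yes ne@(u , u∈) = linear (card X ∷ card (X - x) ∷ D X X ∷ D (X - x) (X - x) ∷ d x X ∷ [])
              ((2 , x₀ , con 1 :+ x₁) ∷ (1 , 2 :* x₁ , x₃ :+ con 2) ∷ (2 , con 1 , x₄) ∷ (1 , 2 :* x₄ :+ x₃ , x₂) ∷ [])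
              (0 , 2 :* x₀ , x₂ :+ con 2)
              (≤-reflexive (card-remove x∈)) (ih x∈ (Forest-mono -⊆ f) ne smaller) attached (≤-reflexive (sym (D-remove x∈)))
        where
        smaller : Connected (X - x)
        smaller {u} {v} u∈ v∈ u≢v u≁v = shrink (conn (-⊆ u∈) (-⊆ v∈) u≢v u≁v)
          where
          shrink : PathIn X u v → PathIn (X - x) u v
          shrink π = record { P = P ; u∈P = u∈P ; v∈P = v∈P ; deg = deg ; P⊆X = λ p → -⁺ (P⊆X p) λ { refl →
              absurd (≤-pred (≤-trans (path-mid (≢-sym (proj₂ (-⁻ u∈))) (≢-sym (proj₂ (-⁻ v∈))) (deg p)) (≤-trans (d-mono P⊆X x) low))) } }
            where open PathIn π
        attached : 1 ≤ d x X
        attached with x ~? u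
        ... | yes xu = d≥1 xu (-⊆ u∈)
        ... | no x≁u = from (conn x∈ (-⊆ u∈) (≢-sym (proj₂ (-⁻ u∈))) x≁u)
          where
          from : PathIn X x u → 1 ≤ d x X
          from π = ≤-trans (path-end (≢-sym (proj₂ (-⁻ u∈))) (deg u∈P)) (d-mono P⊆X x)
            where open PathIn π

    J-nonempty : Nonempty J
    J-nonempty = card-witness (≤-trans (s≤s z≤n) J≥5)

    edges : D J J + 2 ≡ 2 * card J
    edges = ≤-antisym (forest-edges J forest J-nonempty)
      (tree-edges J forest J-nonempty λ _ _ u≢v u≁v → Free.path-in (free u≢v u≁v))

    path-edges : ∀ {X u v} (π : PathIn X u v) → let open PathIn π in 2 * card P ≤ D P P + 2
    path-edges {X} {u} {v} π = ≤-trans (sum-≥ 2 deg) (≤-reflexive (trans (sum-+ P _ _) (cong (D P P +_) (trans (sum-+ P _ _) (cong₂ _+_ (one u∈P) (one v∈P))))))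
      where
      open PathIn π
      one : ∀ {u} → u ∈ P → sum P (λ x → δ x u) ≡ 1
      one {u} p = trans (sum-remove p _) (cong₂ _+_ (δ-refl u) (n≤0⇒n≡0 (sum-≤ 0 λ q → ≤-reflexive (δ-≢ (proj₂ (-⁻ q))))))

    open Ends J

    not-flat : ¬ (∀ {v} → v ∈ J → d v J ≤ 1)
    not-flat low = absurd (linear (D J J ∷ card J ∷ []) ((1 , 2 :* x₁ , x₀ :+ con 2) ∷ (1 , x₀ , 1 :* x₁) ∷ (1 , con 5 , x₁) ∷ [])
      (0 , con 1 , con 0) (≤-reflexive (sym edges)) (sum-≤ 1 low) J≥5)

    -- The edge count makes `q` adjacent to all other vertices of `J`. A path between two leaves
    -- then contains `q`, and no edge can avoid it.
    not-star : ∀ {q} → End q → ¬ (∀ {v} → v ∈ J → v ≢ q → d v J ≤ 1)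
    not-star {q} E low = from (card-witness (≤-trans (s≤s z≤n) rest≥2))
      where
      open End E
      rest≥2 : 2 ≤ card (J - q)
      rest≥2 = ≤-pred (≤-trans (s≤s (s≤s (s≤s z≤n))) (≤-trans J≥5 (≤-reflexive (card-remove q∈F))))
      centre : card (J - q) ≤ d q (J - q)
      centre = linear (D J J ∷ card J ∷ card (J - q) ∷ d q (J - q) ∷ D (J - q) J ∷ [])
        ((1 , 2 :* x₁ , x₀ :+ con 2) ∷ (1 , x₀ , x₃ :+ x₄) ∷ (1 , x₄ , 1 :* x₂) ∷ (2 , con 1 :+ x₂ , x₁) ∷ [])
        (0 , x₂ , x₃)
        (≤-reflexive (sym edges)) (≤-reflexive (trans (sum-remove q∈F _) (cong (_+ D (J - q) J) (sym d-self))))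
        (sum-≤ 1 λ p → low (-⊆ p) (proj₂ (-⁻ p))) (≤-reflexive (sym (card-remove q∈F)))
      q~ : ∀ {v} → v ∈ J → v ≢ q → q ~ v
      q~ {v} p v≢q = proj₁ (∩⁻ (card-⊆-≡ {X = N q ∩ (J - q)} {J - q} (λ r → proj₂ (∩⁻ r)) centre (-⁺ p v≢q)))
      from : Nonempty (J - q) → ⊥
      from (l , l∈) = let (m , m∈ , m≢l) = card-witness≢ rest≥2 l in two m∈ m≢l
        where
        two : ∀ {m} → m ∈ J - q → m ≢ l → ⊥
        two {m} m∈ m≢l = contra (free (≢-sym m≢l) λ lm → proj₂ (-⁻ m∈) (sym (d≤1⇒≡ (low (-⊆ l∈) (proj₂ (-⁻ l∈))) (~sym (q~ (-⊆ l∈) (proj₂ (-⁻ l∈)))) lm q∈F (-⊆ m∈))))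
          where
          contra : Free l m → ⊥
          contra fr = last (d-witness (path-end (≢-sym m≢l) (deg u∈P)))
            where
            open Free fr
            open PathIn path-in
            last : (∃ λ x → l ~ x × x ∈ P) → ⊥
            last (x , lx , x∈) = ~⇒≢ (q~ (∖⊆ w∈) (ne w∈)) (d≤1⇒≡ (low (∖⊆ z∈) (ne z∈)) (~sym (q~ (∖⊆ z∈) (ne z∈))) zw q∈F (∖⊆ w∈))
              where
              x≡q : x ≡ q
              x≡q = d≤1⇒≡ (low (-⊆ l∈) (proj₂ (-⁻ l∈))) lx (~sym (q~ (-⊆ l∈) (proj₂ (-⁻ l∈)))) (P⊆X x∈) q∈F
              ne : ∀ {y} → y ∈ J ∖ P → y ≢ q
              ne p refl = proj₂ (∖⁻ p) (subst (_∈ P) x≡q x∈)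

    -- If q and r were the only ends, the path joining their leaves would contain
    -- all inner vertices and no edge could avoid it.
    third-end : ∀ {q r} → q ≢ r → End q → End r → ∃ λ s → End s × s ≢ q × s ≢ r
    third-end {q} {r} q≢r E E′ with any? (λ s → (s ∈? J) ×-dec ((2 ≤? d s J) ×-dec ((d s F′ ≤? 1) ×-dec (¬? (s ≟ q) ×-dec ¬? (s ≟ r)))))
    ... | yes (s , s∈ , b , f , s≢q , s≢r) = s , end s∈ b f , s≢q , s≢r
    ... | no none = ⊥-elim (contra (free l≢m l≁m))
      where
      L = proj₂ (a-leaf E)
      M = proj₂ (a-leaf E′)
      l = proj₁ (a-leaf E)
      m = proj₁ (a-leaf E′)
      m≢q : m ≢ q
      m≢q m≡q = absurd (≤-pred (≤-trans (End.big E) (subst (λ x → d x J ≤ 1) m≡q (proj₂ (proj₂ M)))))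
      l≢m : l ≢ m
      l≢m l≡m = claws-apart q≢r E E′ (leaf∈claw L) (subst (_∈ claw r) (sym l≡m) (leaf∈claw M))
      l≁m : l ≁ m
      l≁m lm = m≢q (leaf-nbr (End.q∈F E) L (proj₁ M) lm)
      contra : Free l m → ⊥
      contra fr = last inner⊆P
        where
        open Free fr
        open PathIn path-in
        through : ∀ {x y} → End y → Leaf y x → 1 ≤ d x P → y ∈ P
        through {x} {y} Ey Lx le = let (u , xu , u∈) = d-witness le in subst (_∈ P) (leaf-nbr (End.q∈F Ey) Lx (P⊆X u∈) xu) u∈
        q∈P : q ∈ P
        q∈P = through E L (path-end l≢m (deg u∈P))
        r∈P : r ∈ P
        r∈P = through E′ M (path-end′ l≢m (deg v∈P))
        A = F′ ∖ P
        A⊆J : A ⊆ J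
        A⊆J p = proj₁ (sep⁻ inner? (∖⊆ p))
        AP : Disjoint A P
        AP p s = proj₂ (∖⁻ p) s
        wide : ∀ {v} → v ∈ A → 2 ≤ d v A + d v P
        wide {v} p = ≤-trans (≰⇒> λ le → let (a , b) = sep⁻ inner? (∖⊆ p) in
            none (v , a , b , le , (λ { refl → AP p q∈P }) , (λ { refl → AP p r∈P })))
          (subst (d v F′ ≤_) (d-split (split-∪ AP) v) (d-mono (λ s → place (∈-or-∖ {A = P} s)) v))
          where
          place : ∀ {w} → w ∈ P ⊎ w ∈ A → w ∈ A ∪ P
          place (inj₁ s) = ∪ʳ s
          place (inj₂ s) = ∪ˡ s
        A-empty : ¬ Nonempty A
        A-empty ne = absurd (linear (D A A ∷ D A P ∷ D P P ∷ card A ∷ card P ∷ [])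
          ((2 , 2 :* x₃ , x₀ :+ x₁) ∷ (1 , x₀ :+ 2 :* x₁ :+ x₂ :+ con 2 , 2 :* (x₃ :+ x₄)) ∷ (1 , 2 :* x₄ , x₂ :+ con 2) ∷ (1 , x₀ :+ con 2 , 2 :* x₃) ∷ [])
          (0 , con 1 , con 0)
          (≤-trans (sum-≥ 2 wide) (≤-reflexive (sum-+ A _ _)))
          (subst₂ (λ i j → i + 2 ≤ 2 * j) (D-split (split-∪ AP)) (card-split (split-∪ AP))
            (forest-edges (A ∪ P) (Forest-mono (λ p → within (∪⁻ p)) forest) (_ , ∪ʳ u∈P)))
          (path-edges path-in) (forest-edges A (Forest-mono A⊆J forest) ne))
          where
          within : ∀ {v} → v ∈ A ⊎ v ∈ P → v ∈ J
          within (inj₁ p) = A⊆J p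
          within (inj₂ p) = P⊆X p
        inner⊆P : ∀ {v} → v ∈ F′ → v ∈ P
        inner⊆P {v} p with v ∈? P
        ... | yes s = s
        ... | no s = contradiction (v , ∖⁺ p s) A-empty
        last : (∀ {v} → v ∈ F′ → v ∈ P) → ⊥
        last inc = ending (free z≢l z≁l)
          where
          low : ∀ {x} → x ∈ J ∖ P → d x J ≤ 1
          low p = small (∖⊆ p) λ s → proj₂ (∖⁻ p) (inc s)
          z≢l : z ≢ l
          z≢l z≡l = proj₂ (∖⁻ z∈) (subst (_∈ P) (sym z≡l) u∈P)
          z≁l : z ≁ l
          z≁l zl = proj₂ (∖⁻ z∈) (subst (_∈ P) (sym (leaf-nbr (End.q∈F E) L (∖⊆ z∈) (~sym zl))) q∈P)
          ending : Free z l → ⊥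
          ending fr′ = go (d-witness (path-end z≢l (PathIn.deg π (PathIn.u∈P π))))
            where
            π = Free.path-in fr′
            go : (∃ λ x → z ~ x × x ∈ PathIn.P π) → ⊥
            go (x , zx , x∈) = absurd (≤-pred (≤-trans (path-mid (≢-sym (~⇒≢ zw)) w≢l (PathIn.deg π w∈π)) (≤-trans (d-mono (PathIn.P⊆X π) w) (low w∈))))
              where
              w∈π : w ∈ PathIn.P π
              w∈π = subst (_∈ PathIn.P π) (d≤1⇒≡ (low z∈) zx zw (PathIn.P⊆X π x∈) (∖⊆ w∈)) x∈
              w≢l : w ≢ l
              w≢l w≡l = proj₂ (∖⁻ w∈) (subst (_∈ P) (sym w≡l) u∈P)

    -- Three ends with a leaf each make six vertices. With no others, all degrees in `F′` would be
    -- at most one, and `J` would have fewer edges than a tree. The spider with three legs of length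
    -- two shows where seven comes from.
    three-ends : ∀ {q r s} → End q → End r → End s → q ≢ r → s ≢ q → s ≢ r → 7 ≤ card J
    three-ends {q} {r} {s} E E′ E″ q≢r s≢q s≢r with 7 ≤? card J
    ... | yes le = le
    ... | no gt = ⊥-elim (absurd (linear (D J J ∷ card J ∷ D F′ F′ ∷ D F′ O ∷ D O F′ ∷ D O O ∷ card F′ ∷ card O ∷ [])
        ((1 , 2 :* x₁ , x₀ :+ con 2) ∷ (1 , x₀ , x₂ :+ 2 :* x₃ :+ x₅) ∷ (1 , x₂ , 1 :* x₆) ∷ (2 , x₃ , x₄) ∷ (2 , x₄ :+ x₅ , 1 :* x₇) ∷ (2 , x₆ :+ x₇ , x₁) ∷ (1 , con 3 , x₆) ∷ [])
        (0 , con 1 , con 0)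
        (≤-reflexive (sym edges)) (≤-reflexive (D-split parts)) (sum-≤ 1 inner-low) (≤-reflexive (D-sym F′ O))
        (≤-trans (≤-reflexive (sym (sum-+ O _ _))) (sum-≤ 1 λ {v} p → ≤-trans (≤-reflexive (trans (+-comm _ (d v O)) (trans (+-comm (d v O) _) (sym (d-split parts v))))) (small (∖⊆ p) (proj₂ (∖⁻ p)))))
        (≤-reflexive (sym (card-split parts))) three-inner))
      where
      x₇ : ∀ {k} → Lin (8 + k)
      x₇ = var (suc (suc (suc (suc (suc (suc (suc zero)))))))
      O = J ∖ F′
      parts : Split J F′ O
      parts = split-∖ (λ p → proj₁ (sep⁻ inner? p))
      inner : ∀ {x} → End x → x ∈ F′
      inner Ex = sep⁺ inner? (End.q∈F Ex , End.big Ex)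
      outer-leaf : ∀ {x} (Ex : End x) → proj₁ (a-leaf Ex) ∈ O
      outer-leaf Ex = let (p , _ , low) = proj₂ (a-leaf Ex) in ∖⁺ p λ i → absurd (≤-pred (≤-trans (proj₂ (sep⁻ inner? i)) low))
      distinct : ∀ {x y} (Ex : End x) (Ey : End y) → x ≢ y → proj₁ (a-leaf Ex) ≢ proj₁ (a-leaf Ey)
      distinct {x} {y} Ex Ey x≢y eq = claws-apart x≢y Ex Ey (leaf∈claw (proj₂ (a-leaf Ex))) (subst (_∈ claw y) (sym eq) (leaf∈claw (proj₂ (a-leaf Ey))))
      three-inner : 3 ≤ card F′
      three-inner = card-unique ((q≢r ∷ ≢-sym s≢q ∷ []) ∷ (≢-sym s≢r ∷ []) ∷ [] ∷ []) (inner E ∷ inner E′ ∷ inner E″ ∷ [])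
      three-outer : 3 ≤ card O
      three-outer = card-unique ((distinct E E′ q≢r ∷ distinct E E″ (≢-sym s≢q) ∷ []) ∷ (distinct E′ E″ (≢-sym s≢r) ∷ []) ∷ [] ∷ [])
        (outer-leaf E ∷ outer-leaf E′ ∷ outer-leaf E″ ∷ [])
      inner-low : ∀ {v} → v ∈ F′ → d v F′ ≤ 1
      inner-low {v} p with v ≟ q | v ≟ r | v ≟ s
      ... | yes refl | _ | _ = End.few E
      ... | no _ | yes refl | _ = End.few E′
      ... | no _ | no _ | yes refl = End.few E″
      ... | no a | no b | no c = absurd (linear (card J ∷ card F′ ∷ card O ∷ []) ((1 , con 4 , x₁) ∷ (1 , con 3 , x₂) ∷ (1 , x₁ :+ x₂ , x₀) ∷ (1 , x₀ , con 6) ∷ []) (0 , con 1 , con 0)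
              (card-unique ((a ∷ b ∷ c ∷ []) ∷ (q≢r ∷ ≢-sym s≢q ∷ []) ∷ (≢-sym s≢r ∷ []) ∷ [] ∷ []) (p ∷ inner E ∷ inner E′ ∷ inner E″ ∷ []))
              three-outer (≤-reflexive (sym (card-split parts))) (≤-pred (≰⇒> gt)))

    J≥7 : 7 ≤ card J
    J≥7 with shape forest
    ... | flat low = ⊥-elim (not-flat low)
    ... | star q E low = ⊥-elim (not-star E low)
    ... | ends q r q≢r E E′ = let (s , E″ , s≢q , s≢r) = third-end q≢r E E′ in three-ends E E′ E″ q≢r s≢q s≢r

-- Saturated graphs with a universal vertex h: K₁ ∨ tree, a wheel whose hub edges
-- may be accompanied by triangles, or K₃ ∨ independent set.  Twice the number of
-- edges is measured against c = n - 1.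
data Outcome {n} (G : Graph n) (h : Fin n) : Set where
  tree  : let c = card (full - h) in 7 ≤ c → Counting.D G full full + 2 ≡ 4 * c → Outcome G h
  wheel : let c = card (full - h) in Counting.D G full full ≡ 4 * c →
          (c ≡ 5 → ∀ {v} → v ∈ full - h → Counting.Forest G (full - h - v)) → Outcome G h
  cone  : let c = card (full - h) in Counting.D G full full + 6 ≡ 6 * c → Outcome G h

-- A universal vertex whose complement contains a cycle.

module Rim {n : ℕ} (G : Graph n) (sat : Pairs.Sat G) (min₂ : ∀ v → 2 ≤ Counting.d G v full) (n≥6 : 6 ≤ n)
           {h : Fin n} (hub : Covers.Universal G sat h) where
  open Hub G sat min₂ n≥6 hub public
  open Covers G sat
  open Shortest G using (Least; least; regular; edges≡; exchange)

  module WithCycle {Q : VSet n} (L : Least J Q) where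
    open Least L

    Q-cyc : Cyc Q
    Q-cyc = cyc Q (λ p → p) some dense

    off : ∀ {z w} → z ∈ J ∖ Q → w ∈ J ∖ Q → z ≁ w
    off z∈ w∈ zw = clash (triangle (h~ (∖⊆ z∈)) zw (~sym (h~ (∖⊆ w∈)))) Q-cyc λ p q → case (listed p) q
      where
      case : ∀ {v} → v List.∈ h ∷ _ ∷ _ ∷ [] → v ∈ Q → ⊥
      case (here refl) q = J≢h (Q⊆X q) refl
      case (there (here refl)) q = proj₂ (∖⁻ z∈) q
      case (there (there (here refl))) q = proj₂ (∖⁻ w∈) q

    d-off : ∀ {y} → y ∈ J ∖ Q → d y J ≡ d y Q
    d-off {y} p = trans (d-split (split-∖ Q⊆X) y) (trans (cong (d y Q +_) (n≤0⇒n≡0 (≁⇒d≤0 λ q → off p q))) (+-identityʳ _))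

    on-rim : ∀ {y} → y ∈ J ∖ Q → 1 ≤ d y Q
    on-rim p = subst (1 ≤_) (d-off p) (d-J (∖⊆ p))

    card≤ : ∀ {xs} → Cyc ⟦ xs ⟧ˢ → All (_∈ J) xs → card Q ≤ length xs
    card≤ {xs} c a = ≤-trans (minimal c (λ p → all-in a p)) (list-card xs)

    edges-J : D J J ≡ 2 * card Q + 2 * D (J ∖ Q) Q
    edges-J = trans (D-split (split-∖ Q⊆X)) (trans (cong₂ (λ i j → i + 2 * j + D (J ∖ Q) (J ∖ Q)) (edges≡ L) (D-sym Q (J ∖ Q)))
      (trans (cong (2 * card Q + 2 * D (J ∖ Q) Q +_) (n≤0⇒n≡0 (sum-≤ 0 λ p → ≁⇒d≤0 λ q → off p q))) (+-identityʳ _)))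

    parts : card J ≡ card Q + card (J ∖ Q)
    parts = card-split (split-∖ Q⊆X)

    wheel-edges : (∀ {y} → y ∈ J ∖ Q → d y Q ≤ 1) → D full full ≡ 4 * card J
    wheel-edges low = ≤-antisym
      (linear ρ ((1 , x₀ , 2 :* x₁ :+ x₂) ∷ (1 , x₂ , 2 :* x₃ :+ 2 :* x₄) ∷ (2 , x₄ , 1 :* x₅) ∷ (2 , x₃ :+ x₅ , x₁) ∷ []) (0 , x₀ , 4 :* x₁)
        (≤-reflexive total) (≤-reflexive edges-J) (sum-≤ 1 low) (≤-reflexive (sym parts)))
      (linear ρ ((1 , 2 :* x₁ :+ x₂ , x₀) ∷ (1 , 2 :* x₃ :+ 2 :* x₄ , x₂) ∷ (2 , 1 :* x₅ , x₄) ∷ (2 , x₁ , x₃ :+ x₅) ∷ []) (0 , 4 :* x₁ , x₀)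
        (≤-reflexive (sym total)) (≤-reflexive (sym edges-J)) (sum-≥ 1 on-rim) (≤-reflexive parts))
      where ρ = D full full ∷ card J ∷ D J J ∷ card Q ∷ D (J ∖ Q) Q ∷ card (J ∖ Q) ∷ []

    cone-edges : ∀ {u v} → u ∈ J → v ∈ J → u ≢ v → Covering h u v → D full full + 6 ≡ 6 * card J
    cone-edges {u} {v} u∈ v∈ u≢v cov = ≤-antisym
      (linear ρ ((1 , x₀ , 2 :* x₁ :+ x₂) ∷ (1 , x₂ , 2 :* x₃ :+ (2 :* x₄ :+ con 0)) ∷ (4 , con 1 :+ x₃ , x₁) ∷ (2 , con 1 :+ x₄ , x₃) ∷ []) (0 , x₀ :+ con 6 , 6 :* x₁)
        (≤-reflexive total) (≤-reflexive J-edges) (≤-reflexive (sym (card-remove u∈))) (≤-reflexive (sym (card-remove v∈u))))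
      (linear ρ ((1 , 2 :* x₁ :+ x₂ , x₀) ∷ (1 , 2 :* x₃ :+ (2 :* x₄ :+ con 0) , x₂) ∷ (4 , x₁ , con 1 :+ x₃) ∷ (2 , x₃ , con 1 :+ x₄) ∷ []) (0 , 6 :* x₁ , x₀ :+ con 6)
        (≤-reflexive (sym total)) (≤-reflexive (sym J-edges)) (≤-reflexive (card-remove u∈)) (≤-reflexive (card-remove v∈u)))
      where
      ρ = D full full ∷ card J ∷ D J J ∷ card (J - u) ∷ card (J - u - v) ∷ []
      v∈u : v ∈ J - u
      v∈u = -⁺ v∈ (≢-sym u≢v)
      u-all : Universal u
      u-all = covering⇒universal (J≢h v∈) λ (p , q , r) (p′ , q′ , r′) → cov (r , p , q) (r′ , p′ , q′)
      v-all : Universal v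
      v-all = covering⇒universal (J≢h u∈) λ (p , q , r) (p′ , q′ , r′) → cov (r , q , p) (r′ , q′ , p′)
      J-edges : D J J ≡ 2 * card (J - u) + (2 * card (J - u - v) + 0)
      J-edges = trans (D-remove u∈) (cong₂ (λ i j → 2 * i + j) (trans (sym d-self) (all-adjacent λ p → u-all _ (proj₂ (-⁻ p))))
        (trans (D-remove v∈u) (cong₂ (λ i j → 2 * i + j) (trans (sym d-self) (all-adjacent λ p → v-all _ (proj₂ (-⁻ p)))) (n≤0⇒n≡0 (sum-≤ 0 λ p → ≁⇒d≤0 λ q → cov (place p) (place q))))))
        where
        place : ∀ {x} → x ∈ J - u - v → x ≢ h × x ≢ u × x ≢ v
        place p = let (q , b) = -⁻ p in let (r , a) = -⁻ q in J≢h r , a , b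

    module Two {y : Fin n} (y∈ : y ∈ J ∖ Q) (two : 2 ≤ d y Q) where
      y∉Q : y ∉ Q
      y∉Q = proj₂ (∖⁻ y∈)

      -- With two neighbours on `Q - c`, the vertex `y` closes a cycle there; an edge `w c` would
      -- form a triangle with `h` disjoint from it.
      exposed : ∀ {c w} → c ∈ Q → 2 ≤ d y (Q - c) → w ∈ J ∖ Q → w ≢ y → w ≁ c
      exposed {c} {w} c∈ le w∈ w≢y wc = clash Z-cyc (triangle (h~ (∖⊆ w∈)) wc (~sym (h~ (Q⊆X c∈)))) λ p q → case (∪⁻ p) (listed q)
        where
        y∉ : y ∉ Q - c
        y∉ p = y∉Q (-⊆ p)
        Z-cyc : Cyc (Q - c ∪ ｛ y ｝)
        Z-cyc = many-edges (y , ∪ʳ (x∈｛x｝ y)) (subst₂ (λ i j → 2 * i ≤ j + 1) (sym (card-∪｛｝ y∉)) (sym (D-∪｛｝ y∉))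
          (linear (card Q ∷ card (Q - c) ∷ D Q Q ∷ D (Q - c) (Q - c) ∷ d y (Q - c) ∷ d c Q ∷ [])
            ((2 , con 1 :+ x₁ , x₀) ∷ (1 , 2 :* x₀ , x₂) ∷ (1 , x₂ , 2 :* x₅ :+ x₃) ∷ (2 , x₅ , con 2) ∷ (2 , con 2 , x₄) ∷ [])
            (0 , 2 :* (x₁ :+ con 1) , x₃ :+ 2 :* x₄ :+ con 1)
            (≤-reflexive (sym (card-remove c∈))) (sum-≥ 2 dense) (≤-reflexive (D-remove c∈)) (regular L c∈) le))
        case : ∀ {v} → v ∈ Q - c ⊎ v ∈ ｛ y ｝ → v List.∈ h ∷ w ∷ c ∷ [] → ⊥
        case (inj₁ p) (here refl) = J≢h (Q⊆X (-⊆ p)) refl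
        case (inj₁ p) (there (here refl)) = proj₂ (∖⁻ w∈) (-⊆ p)
        case (inj₁ p) (there (there (here refl))) = proj₂ (-⁻ p) refl
        case (inj₂ p) (here refl) = J≢h (∖⊆ y∈) (sym (∈｛｝ p))
        case (inj₂ p) (there (here refl)) = w≢y (∈｛｝ p)
        case (inj₂ p) (there (there (here refl))) = y∉Q (subst (_∈ Q) (∈｛｝ p) c∈)

      -- If `y` saw all of `Q`, a triangle at `y` would bound `Q` by three vertices. Since `J` has
      -- at least five, some other `w` lies off `Q`, and its neighbour on `Q` contradicts `exposed`.
      not-all : ¬ (∀ {c} → c ∈ Q → y ~ c)
      not-all all = from (d-witness (≤-trans (s≤s z≤n) two))
        where
        from : (∃ λ u → y ~ u × u ∈ Q) → ⊥
        from (u , yu , u∈) = go (d-witness (≤-trans (s≤s z≤n) (dense u∈)))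
          where
          go : (∃ λ v → u ~ v × v ∈ Q) → ⊥
          go (v , uv , v∈) = pick (card-witness≢ more y)
            where
            Q≤3 : card Q ≤ 3
            Q≤3 = card≤ (triangle yu uv (~sym (all v∈))) (∖⊆ y∈ ∷ Q⊆X u∈ ∷ Q⊆X v∈ ∷ [])
            more : 2 ≤ card (J ∖ Q)
            more = linear (card J ∷ card Q ∷ card (J ∖ Q) ∷ []) ((1 , con 5 , x₀) ∷ (1 , x₀ , x₁ :+ x₂) ∷ (1 , x₁ , con 3) ∷ []) (0 , con 2 , x₂)
              J≥5 (≤-reflexive parts) Q≤3
            pick : (∃ λ w → w ∈ J ∖ Q × w ≢ y) → ⊥
            pick (w , w∈ , w≢y) = let (c , wc , c∈) = d-witness (on-rim w∈) in exposed c∈ (rest c∈) w∈ w≢y wc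
              where
              rest : ∀ {c} → c ∈ Q → 2 ≤ d y (Q - c)
              rest c∈ = subst (2 ≤_) (sym (all-adjacent λ p → all (-⊆ p))) (≤-pred (subst (3 ≤_) (card-remove c∈) (dense-card dense some)))

      module Quad {c u v : Fin n} (c∈ : c ∈ Q) (y≁c : y ≁ c) (cu : c ~ u) (cv : c ~ v) (u∈ : u ∈ Q) (v∈ : v ∈ Q) (u≢v : u ≢ v) where
        uy : u ~ y
        uy = exchange L (∖⊆ y∈) y∉Q two c∈ y≁c u∈ (~sym cu)
        vy : v ~ y
        vy = exchange L (∖⊆ y∈) y∉Q two c∈ y≁c v∈ (~sym cv)
        Q≤4 : card Q ≤ 4
        Q≤4 = card≤ (quad (~sym cu) cv vy (~sym uy) u≢v (λ { refl → y∉Q c∈ })) (Q⊆X u∈ ∷ Q⊆X c∈ ∷ Q⊆X v∈ ∷ ∖⊆ y∈ ∷ [])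
        c-nbr : ∀ {r} → r ∈ Q → c ~ r → r ≡ u ⊎ r ≡ v
        c-nbr {r} r∈ cr with r ≟ u | r ≟ v
        ... | yes p | _ = inj₁ p
        ... | no _ | yes p = inj₂ p
        ... | no p | no q = absurd (≤-pred (≤-pred (≤-trans (d-unique ((p ∷ q ∷ []) ∷ (u≢v ∷ []) ∷ [] ∷ []) (cr ∷ cu ∷ cv ∷ []) (r∈ ∷ u∈ ∷ v∈ ∷ [])) (regular L c∈))))
        fourth : ∀ {p r} → p ∈ Q → p ≢ u → p ≢ v → p ≢ c → r ∈ Q → p ~ r → r ≡ u ⊎ r ≡ v
        fourth {p} {r} p∈ p≢u p≢v p≢c r∈ pr with r ≟ u | r ≟ v | r ≟ c
        ... | yes a | _ | _ = inj₁ a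
        ... | no _ | yes a | _ = inj₂ a
        ... | no a | no b | no e = absurd (≤-pred (≤-pred (≤-pred (≤-pred (≤-trans
                (card-unique ((u≢v ∷ ~⇒≢ (~sym cu) ∷ ≢-sym p≢u ∷ ≢-sym a ∷ []) ∷ (~⇒≢ (~sym cv) ∷ ≢-sym p≢v ∷ ≢-sym b ∷ []) ∷ (≢-sym p≢c ∷ ≢-sym e ∷ []) ∷ (~⇒≢ pr ∷ []) ∷ [] ∷ [])
                  (u∈ ∷ v∈ ∷ c∈ ∷ p∈ ∷ r∈ ∷ [])) Q≤4)))))
        ... | no _ | no _ | yes refl with c-nbr p∈ (~sym pr)
        ...   | inj₁ x = contradiction x p≢u
        ...   | inj₂ x = contradiction x p≢v
        rim-nbr : ∀ {p r} → p ∈ Q → p ≢ u → p ≢ v → r ∈ Q → p ~ r → r ≡ u ⊎ r ≡ v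
        rim-nbr {p} p∈ p≢u p≢v r∈ pr with p ≟ c
        ... | yes refl = c-nbr r∈ pr
        ... | no p≢c = fourth p∈ p≢u p≢v p≢c r∈ pr
        y-nbr : ∀ {p} → p ∈ Q → p ≢ u → p ≢ v → y ≁ p
        y-nbr {p} p∈ p≢u p≢v yp with p ≟ c
        ... | yes refl = y≁c yp
        ... | no p≢c = go (d-witness (≤-trans (s≤s z≤n) (dense p∈)))
          where
          big : card Q ≤ 3 → ⊥
          big le = absurd (≤-pred (≤-pred (≤-pred (≤-trans (card-unique ((u≢v ∷ ~⇒≢ (~sym cu) ∷ ≢-sym p≢u ∷ []) ∷ (~⇒≢ (~sym cv) ∷ ≢-sym p≢v ∷ []) ∷ (≢-sym p≢c ∷ []) ∷ [] ∷ [])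
            (u∈ ∷ v∈ ∷ c∈ ∷ p∈ ∷ [])) le))))
          closes : ∀ {r} → r ∈ Q → p ~ r → r ~ y → ⊥
          closes r∈ pr ry = big (card≤ (triangle pr ry yp) (Q⊆X p∈ ∷ Q⊆X r∈ ∷ ∖⊆ y∈ ∷ []))
          go : (∃ λ r → p ~ r × r ∈ Q) → ⊥
          go (r , pr , r∈) with fourth p∈ p≢u p≢v p≢c r∈ pr
          ... | inj₁ refl = closes r∈ pr uy
          ... | inj₂ refl = closes r∈ pr vy
        spoke : ∀ {p r} → p ∈ Q → p ≢ u → p ≢ v → r ∈ J ∖ Q → r ≁ p
        spoke {p} {r} p∈ p≢u p≢v r∈ rp with r ≟ y
        ... | yes refl = y-nbr p∈ p≢u p≢v rp
        ... | no r≢y = exposed p∈ (subst (2 ≤_) (sym (d-≁- (y-nbr p∈ p≢u p≢v))) two) r∈ r≢y rp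
        -- The quadrilateral `u c v y` bounds `Q` by four vertices, so a vertex of `Q` other than
        -- `u` and `v` has only these as neighbours on `Q`. By `exposed` and `y-nbr` it has no
        -- neighbours off `Q` in `J`.
        cov : Covering h u v
        cov {p} {r} (p≢h , p≢u , p≢v) (r≢h , r≢u , r≢v) pr with ∈-or-∖ {A = Q} (∈J p≢h) | ∈-or-∖ {A = Q} (∈J r≢h)
        ... | inj₂ a | inj₂ b = off a b pr
        ... | inj₁ a | inj₂ b = spoke a p≢u p≢v b (~sym pr)
        ... | inj₂ a | inj₁ b = spoke b r≢u r≢v a pr
        ... | inj₁ a | inj₁ b with rim-nbr a p≢u p≢v b pr
        ...   | inj₁ x = r≢u x
        ...   | inj₂ x = r≢v x

      cone-total : D full full + 6 ≡ 6 * card J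
      cone-total with any? (λ c → (c ∈? Q) ×-dec ¬? (y ~? c))
      ... | no none = ⊥-elim (not-all λ {c} c∈ → by c∈)
        where
        by : ∀ {c} → c ∈ Q → y ~ c
        by {c} c∈ with y ~? c
        ... | yes p = p
        ... | no p = contradiction (c , c∈ , p) none
      ... | yes (c , c∈ , y≁c) = let (u , cu , u∈) = d-witness (≤-trans (s≤s z≤n) (dense c∈))
                                     (v , cv , v∈ , v≢u) = d-witness≢ (dense c∈) u
                                 in cone-edges (Q⊆X u∈) (Q⊆X v∈) (≢-sym v≢u) (Quad.cov c∈ y≁c cu cv u∈ v∈ (≢-sym v≢u))

    module Small (five : card J ≡ 5) (low : ∀ {y} → y ∈ J ∖ Q → d y Q ≤ 1) where
      private
        six : n ≡ 6
        six = trans card-J (cong suc five)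

      module _ {y u : Fin n} (y∈ : y ∈ J ∖ Q) (u∈ : u ∈ Q) (yu : y ~ u) where
        y-only : ∀ {v} → v ∈ J → y ~ v → v ≡ u
        y-only v∈J yv = d≤1⇒≡ (≤-trans (≤-reflexive (d-off y∈)) (low y∈)) yv yu v∈J (Q⊆X u∈)

        module _ {q : Fin n} (q∈ : q ∈ Q) (q≢u : q ≢ u) where
          y≢q : y ≢ q
          y≢q refl = proj₂ (∖⁻ y∈) q∈
          y≢u : y ≢ u
          y≢u refl = proj₂ (∖⁻ y∈) u∈
          module Path (pc : PathCyc y q) where
            open PathCyc pc renaming (Q to R; dense to R-dense; some to R-some)
            h∈R : h ∈ R
            h∈R with h ∈? R
            ... | yes p = p
            ... | no p = ⊥-elim (apart v∈P (card-⊆-≡ R⊆Q (minimal (cyc R (λ r → r) R-some R-dense) R⊆J) q∈))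
              where
              R⊆J : R ⊆ J
              R⊆J r = ∈J (λ { refl → p r })
              R⊆Q : R ⊆ Q
              R⊆Q {v} r with ∈-or-∖ {A = Q} (R⊆J r)
              ... | inj₁ s = s
              ... | inj₂ s = absurd (≤-pred (≤-trans (R-dense r) (≤-trans (d-mono R⊆J v) (≤-trans (≤-reflexive (d-off s)) (low s)))))
            P⊆J : P ⊆ J
            P⊆J p = ∈J (λ { refl → apart p h∈R })
            u∈path : u ∈ P
            u∈path = from (d-witness (path-end y≢q (deg u∈P)))
              where
              from : (∃ λ v → y ~ v × v ∈ P) → u ∈ P
              from (v , yv , v∈) = subst (_∈ P) (y-only (P⊆J v∈) yv) v∈
            both : card P + card R ≤ 6
            both = ≤-trans (≤-reflexive (sym (card-split (split-∪ apart)))) (≤-trans (card-mono (λ _ → ∈full)) (≤-reflexive (trans (card-full n) six)))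
            P≥3 : 3 ≤ card P
            P≥3 = card-unique ((y≢q ∷ y≢u ∷ []) ∷ (q≢u ∷ []) ∷ [] ∷ []) (u∈P ∷ v∈P ∷ u∈path ∷ [])
            P≤3 : card P ≤ 3
            P≤3 = +-cancelʳ-≤ 3 _ _ (≤-trans (+-monoʳ-≤ (card P) (dense-card R-dense R-some)) both)
            R≤3 : card R ≤ 3
            R≤3 = +-cancelˡ-≤ 3 _ _ (≤-trans (+-monoˡ-≤ (card R) P≥3) both)
            qu : q ~ u
            qu = from (d-witness (path-end′ y≢q (deg v∈P)))
              where
              from : (∃ λ v → q ~ v × v ∈ P) → q ~ u
              from (v , qv , v∈) with v ≟ u
              ... | yes refl = qv
              ... | no v≢u = absurd (≤-pred (≤-pred (≤-pred (≤-trans (card-unique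
                      (((λ { refl → q≢u (y-only (Q⊆X q∈) (~sym qv)) }) ∷ ≢-sym (~⇒≢ qv) ∷ v≢u ∷ []) ∷ (y≢q ∷ y≢u ∷ []) ∷ (q≢u ∷ []) ∷ [] ∷ [])
                      (v∈ ∷ u∈P ∷ v∈P ∷ u∈path ∷ [])) P≤3))))
            rest : ∀ {z} → z ∈ J → z ≢ y → z ≢ u → z ≢ q → z ∈ R
            rest {z} z∈ z≢y z≢u z≢q = from (∪⁻ (card-⊆-≡ {X = P ∪ R} {full} (λ _ → ∈full)
                (≤-trans (≤-reflexive (trans (card-full n) six)) (≤-trans (+-mono-≤ P≥3 (dense-card R-dense R-some)) (≤-reflexive (sym (card-split (split-∪ apart))))))
                ∈full))
              where
              from : z ∈ P ⊎ z ∈ R → z ∈ R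
              from (inj₂ r) = r
              from (inj₁ p) = absurd (≤-pred (≤-pred (≤-pred (≤-trans (card-unique ((z≢y ∷ z≢q ∷ z≢u ∷ []) ∷ (y≢q ∷ y≢u ∷ []) ∷ (q≢u ∷ []) ∷ [] ∷ [])
                (p ∷ u∈P ∷ v∈P ∷ u∈path ∷ [])) P≤3))))
            clique : ∀ {z w} → z ∈ R → w ∈ R → w ≢ z → z ~ w
            clique {z} {w} z∈ w∈ w≢z = proj₁ (∩⁻ (card-⊆-≡ {X = N z ∩ R} {R - z} (λ p → let (a , b) = ∩⁻ p in -⁺ b (≢-sym (~⇒≢ a)))
              (≤-trans (≤-pred (≤-trans (≤-reflexive (sym (card-remove z∈))) R≤3)) (R-dense z∈)) (-⁺ w∈ w≢z)))

          here-path : PathCyc y q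
          here-path = path y≢q λ yq → q≢u (y-only (Q⊆X q∈) yq)

          to-centre : q ~ u
          to-centre = Path.qu here-path

          others : ∀ {z w} → z ∈ J → z ≢ y → z ≢ u → z ≢ q → w ∈ J → w ≢ y → w ≢ u → w ≢ q → w ≢ z → z ~ w
          others z∈ a b e w∈ a′ b′ e′ w≢z = Path.clique here-path (Path.rest here-path z∈ a b e) (Path.rest here-path w∈ a′ b′ e′) w≢z

        -- For every rim vertex `q` other than `u`, the six vertices split into the path `y u q` and
        -- a triangle through `h`. So `q ~ u` for all of them, and as `u` has two rim neighbours,
        -- `Q` is the triangle `u a b`. The fifth vertex of `J` is then adjacent to both `a` and
        -- `b`, one neighbour too many.
        none : ⊥
        none = from (d-witness (≤-trans (s≤s z≤n) (dense u∈)))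
          where
          from : (∃ λ v → u ~ v × v ∈ Q) → ⊥
          from (a , ua , a∈) = two-rim (d-witness≢ (dense u∈) a)
            where
            two-rim : (∃ λ b → u ~ b × b ∈ Q × b ≢ a) → ⊥
            two-rim (b , ub , b∈ , b≢a) = last (card-witness fifth)
              where
              a≢u = ≢-sym (~⇒≢ ua)
              b≢u = ≢-sym (~⇒≢ ub)
              X = J - u - a - b - y
              a∈₁ : a ∈ J - u
              a∈₁ = -⁺ (Q⊆X a∈) a≢u
              b∈₂ : b ∈ J - u - a
              b∈₂ = -⁺ (-⁺ (Q⊆X b∈) b≢u) b≢a
              off-y : ∀ {v} → v ∈ Q → y ≢ v
              off-y p refl = proj₂ (∖⁻ y∈) p
              y∈₃ : y ∈ J - u - a - b
              y∈₃ = -⁺ (-⁺ (-⁺ (∖⊆ y∈) (off-y u∈)) (off-y a∈)) (off-y b∈)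
              fifth : 1 ≤ card X
              fifth = +-cancelˡ-≤ 4 _ _ (≤-reflexive (trans (sym five) (trans (card-remove (Q⊆X u∈)) (cong suc (trans (card-remove a∈₁) (cong suc (trans (card-remove b∈₂) (cong suc (card-remove y∈₃)))))))))
              only : ∀ {v} → v ∈ Q → v ≢ u → v ≡ a ⊎ v ≡ b
              only {v} v∈ v≢u with v ≟ a | v ≟ b
              ... | yes p | _ = inj₁ p
              ... | no _ | yes p = inj₂ p
              ... | no p | no r = absurd (≤-pred (≤-pred (≤-trans (d-unique ((p ∷ r ∷ []) ∷ (≢-sym b≢a ∷ []) ∷ [] ∷ [])
                      (~sym (to-centre v∈ v≢u) ∷ ua ∷ ub ∷ []) (v∈ ∷ a∈ ∷ b∈ ∷ [])) (regular L u∈))))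
              last : Nonempty X → ⊥
              last (x , x∈) = absurd (≤-pred (≤-trans (d≥2 (≢-sym b≢a) (~sym ax) (~sym bx) a∈ b∈) (low (∖⁺ x∈J x∉Q))))
                where
                x∈J = -⊆ (-⊆ (-⊆ (-⊆ x∈)))
                x≢u : x ≢ u
                x≢u = proj₂ (-⁻ (-⊆ (-⊆ (-⊆ x∈))))
                x≢a : x ≢ a
                x≢a = proj₂ (-⁻ (-⊆ (-⊆ x∈)))
                x≢b : x ≢ b
                x≢b = proj₂ (-⁻ (-⊆ x∈))
                x≢y : x ≢ y
                x≢y = proj₂ (-⁻ x∈)
                x∉Q : x ∉ Q
                x∉Q p with only p x≢u
                ... | inj₁ r = x≢a r
                ... | inj₂ r = x≢b r
                ax : a ~ x
                ax = others b∈ b≢u (Q⊆X a∈) (≢-sym (off-y a∈)) a≢u (≢-sym b≢a) x∈J x≢y x≢u x≢b x≢a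
                bx : b ~ x
                bx = others a∈ a≢u (Q⊆X b∈) (≢-sym (off-y b∈)) b≢u b≢a x∈J x≢y x≢u x≢a x≢b

      whole : J ⊆ Q
      whole {y} p with ∈-or-∖ {A = Q} p
      ... | inj₁ q = q
      ... | inj₂ y∈ = let (u , yu , u∈) = d-witness (on-rim y∈) in ⊥-elim (none y∈ u∈ yu)

      rim-minimal : ∀ {v} → v ∈ J → Forest (J - v)
      rim-minimal p c = 1+n≰n (≤-trans (≤-reflexive (sym (card-remove p))) (≤-trans (card-mono whole) (minimal c -⊆)))

  outcome : ¬ ¬ Outcome G h
  outcome k with cyc? J
  ... | no f = k (tree J≥7 (trans (cong (_+ 2) total) (trans (+-assoc (2 * card J) _ 2) (trans (cong (2 * card J +_) edges) (lem (card J))))))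
    where
    open Tree f using (J≥7; edges)
    lem : ∀ x → 2 * x + 2 * x ≡ 4 * x
    lem = solve-∀
  ... | yes c = least c λ (Q , L) → k (from L)
    where
    from : ∀ {Q} → Least J Q → Outcome G h
    from {Q} L with any? (λ y → (y ∈? J ∖ Q) ×-dec (2 ≤? d y Q))
    ... | yes (y , y∈ , two) = cone (WithCycle.Two.cone-total L y∈ two)
    ... | no none = wheel (WithCycle.wheel-edges L low) λ five → WithCycle.Small.rim-minimal L five low
      where
      low : ∀ {y} → y ∈ J ∖ Q → d y Q ≤ 1
      low {y} p = ≤-pred (≰⇒> λ le → none (y , p , le))

-- Suppressing a vertex of degree one or two.

module Reduction {n : ℕ} (G : Graph (suc n)) (v : Fin (suc n)) where
  open Pairs G

  p : Fin n → Fin (suc n)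
  p = punchIn v

  virtual : Fin n → Fin n → Bool
  virtual i j = not (eqb i j) ∧ (adj G v (p i) ∧ adj G v (p j))

  eqb-sym : ∀ (i j : Fin n) → eqb i j ≡ eqb j i
  eqb-sym i j with i ≟ j | j ≟ i
  ... | yes _ | yes _ = refl
  ... | no _ | no _ = refl
  ... | yes q | no r = contradiction (sym q) r
  ... | no q | yes r = contradiction (sym r) q

  -- Suppressing v turns paths through v into edges; if v has only one neighbour
  -- this is plain deletion.
  G⁻ : Graph n
  G⁻ = record
    { adj = λ i j → adj G (p i) (p j) ∨ virtual i j
    ; sym = λ i j → cong₂ _∨_ (adj-sym G (p i) (p j)) (cong₂ _∧_ (cong not (eqb-sym i j)) (∧-comm (adj G v (p i)) (adj G v (p j))))
    ; irrefl = no-loop }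
    where
    no-loop : ∀ i → adj G (p i) (p i) ∨ virtual i i ≡ false
    no-loop i rewrite irrefl G (p i) with i ≟ i
    ... | yes _ = refl
    ... | no q = contradiction refl q

  module M = Pairs G⁻

  real : ∀ {i j} → p i ~ p j → i M.~ j
  real {i} {j} (mem q) = mem (cong (_∨ virtual i j) q)

  joined : ∀ {i j} → i ≢ j → v ~ p i → v ~ p j → i M.~ j
  joined {i} {j} i≢j (mem q) (mem r) = mem (trans (cong (adj G (p i) (p j) ∨_) step) (∨-zeroʳ _))
    where
    step : virtual i j ≡ true
    step with i ≟ j
    ... | yes x = contradiction x i≢j
    ... | no _ = cong₂ _∧_ q r

  which : ∀ {i j} → i M.~ j → p i ~ p j ⊎ (i ≢ j × v ~ p i × v ~ p j)
  which {i} {j} (mem q) with adj G (p i) (p j) in eq | i ≟ j | adj G v (p i) in a | adj G v (p j) in b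
  ... | true | _ | _ | _ = inj₁ (mem eq)
  ... | false | no i≢j | true | true = inj₂ (i≢j , mem a , mem b)

  covered : ∀ {w} → w ≢ v → ∃ λ i → p i ≡ w
  covered w≢v = punchOut (≢-sym w≢v) , punchIn-punchOut (≢-sym w≢v)

  p≢v : ∀ {i} → p i ≢ v
  p≢v {i} = punchInᵢ≢i v i

  p-inj : ∀ {i j} → p i ≡ p j → i ≡ j
  p-inj = punchIn-injective v _ _

  from? : ∀ Y w → Dec (∃ λ i → p i ≡ w × i ∈ Y)
  from? Y w = any? λ i → (p i ≟ w) ×-dec (i ∈? Y)

  lift : VSet n → VSet (suc n)
  lift Y = sep (from? Y)

  p∈lift : ∀ {i Y} → i ∈ Y → p i ∈ lift Y
  p∈lift {i} {Y} q = sep⁺ (from? Y) (i , refl , q)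

  lift⁻ : ∀ {w Y} → w ∈ lift Y → ∃ λ i → p i ≡ w × i ∈ Y
  lift⁻ {Y = Y} = sep⁻ (from? Y)

  module _ (t≤2 : d v full ≤ 2) where
    thick? : ∀ Y w → Dec (w ∈ lift Y ⊎ (w ≡ v × 2 ≤ d v (lift Y)))
    thick? Y w = (w ∈? lift Y) ⊎-dec ((w ≟ v) ×-dec (2 ≤? d v (lift Y)))

    -- Subdivides the virtual edge again: `v` joins the lifted set exactly when it has two
    -- neighbours in it.
    thick : VSet n → VSet (suc n)
    thick Y = sep (thick? Y)

    lift⊆thick : ∀ {Y} → lift Y ⊆ thick Y
    lift⊆thick {Y} q = sep⁺ (thick? Y) (inj₁ q)

    not-three : ∀ {i j k} → i ≢ j → i ≢ k → j ≢ k → v ~ p i → v ~ p j → v ~ p k → ⊥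
    not-three ij ik jk a b c = absurd (≤-pred (≤-pred (≤-trans
      (d-unique ((ij ∘ p-inj ∷ ik ∘ p-inj ∷ []) ∷ (jk ∘ p-inj ∷ []) ∷ [] ∷ []) (a ∷ b ∷ c ∷ []) (∈full ∷ ∈full ∷ ∈full ∷ [])) t≤2)))

    thick-dense : ∀ {Y} → M.Dense Y → Dense (thick Y)
    thick-dense {Y} dn q with sep⁻ (thick? Y) q
    ... | inj₂ (refl , le) = ≤-trans le (d-mono lift⊆thick v)
    ... | inj₁ q′ with lift⁻ q′
    ...   | i , refl , i∈ = from (M.d-witness (≤-trans (s≤s z≤n) (dn i∈)))
      where
      back : ∀ {j k} → j ≢ i → v ~ p i → v ~ p j → j ∈ Y → k ∈ Y → p i ~ p k → 2 ≤ d (p i) (thick Y)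
      back j≢i a b j∈ k∈ r = d≥2 (p≢v ∘ sym) (~sym a) r
        (sep⁺ (thick? Y) (inj₂ (refl , d≥2 (j≢i ∘ p-inj) b a (p∈lift j∈) (p∈lift i∈)))) (lift⊆thick (p∈lift k∈))
      from : (∃ λ j → i M.~ j × j ∈ Y) → 2 ≤ d (p i) (thick Y)
      from (j , ij , j∈) with M.d-witness≢ (dn i∈) j
      ... | k , ik , k∈ , k≢j with which ij | which ik
      ...   | inj₁ r | inj₁ s = d≥2 (k≢j ∘ sym ∘ p-inj) r s (lift⊆thick (p∈lift j∈)) (lift⊆thick (p∈lift k∈))
      ...   | inj₂ (i≢j , a , b) | inj₁ s = back (≢-sym i≢j) a b j∈ k∈ s
      ...   | inj₁ r | inj₂ (i≢k , a , b) = back (≢-sym i≢k) a b k∈ j∈ r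
      ...   | inj₂ (i≢j , a , b) | inj₂ (i≢k , _ , c) = ⊥-elim (not-three i≢j i≢k (≢-sym k≢j) a b c)

    -- Degree at most two prevents `v` from being added to both sets.
    thick-apart : ∀ {Y Z} → Disjoint Y Z → Disjoint (thick Y) (thick Z)
    thick-apart {Y} {Z} dis q r with sep⁻ (thick? Y) q | sep⁻ (thick? Z) r
    ... | inj₁ a | inj₁ b with lift⁻ a | lift⁻ b
    ...   | i , refl , i∈ | j , eq , j∈ = dis i∈ (subst (_∈ Z) (p-inj eq) j∈)
    thick-apart dis q r | inj₁ a | inj₂ (refl , _) = p≢v (proj₁ (proj₂ (lift⁻ a)))
    thick-apart dis q r | inj₂ (refl , _) | inj₁ b = p≢v (proj₁ (proj₂ (lift⁻ b)))
    thick-apart {Y} {Z} dis q r | inj₂ (_ , a) | inj₂ (_ , b) = absurd (≤-pred (≤-pred (≤-trans (≤-trans (s≤s (s≤s (s≤s z≤n)))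
        (≤-trans (+-mono-≤ a b) (≤-reflexive (sym (d-split (split-∪ apart) v))))) (≤-trans (d-mono (λ _ → ∈full) v) t≤2))))
      where
      apart : Disjoint (lift Y) (lift Z)
      apart a b with lift⁻ a | lift⁻ b
      ... | i , refl , i∈ | j , eq , j∈ = dis i∈ (subst (_∈ Z) (p-inj eq) j∈)

    reduced-no-two : ¬ TwoCycles → ¬ M.TwoCycles
    reduced-no-two none (X , Y , M.cyc A i (a , a∈) dn , M.cyc B j (b , b∈) dm , dis) = none
      (thick A , thick B , cyc (thick A) (λ q → q) (p a , lift⊆thick (p∈lift a∈)) (thick-dense dn) ,
        cyc (thick B) (λ q → q) (p b , lift⊆thick (p∈lift b∈)) (thick-dense dm) , thick-apart (λ q r → dis (i q) (j r)))

  module _ (indep : ∀ {x y} → v ~ x → v ~ y → x ≁ y) where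
    restrict : VSet (suc n) → VSet n
    restrict X = set (λ i → has X (p i))

    ∈restrict : ∀ {X i} → p i ∈ X → i ∈ restrict X
    ∈restrict (mem q) = mem q

    restrict⁻ : ∀ {X i} → i ∈ restrict X → p i ∈ X
    restrict⁻ (mem q) = mem q

    e-real : ∀ i j → e (p i) (p j) ≤ M.e i j
    e-real i j with p i ~? p j
    ... | yes q = ≤-reflexive (trans (e≡1 q) (sym (M.e≡1 (real q))))
    ... | no q = ≤-trans (≤-reflexive (e≡0 q)) z≤n

    d-punch : ∀ w X → d w X ≡ e w v * χ (has X v) + ΣFin n (λ k → e w (p k) * χ (has X (p k)))
    d-punch w X = trans (d-def w X) (Σ-punch v (λ u → e w u * χ (has X u)))

    -- When `p i` loses its neighbour `v`, the second neighbour of `v` in `X` replaces it. By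
    -- `indep` that vertex was not adjacent to `p i` before, so no degree is lost.
    d-restrict : ∀ {X i} → (v ∈ X → 2 ≤ d v X) → d (p i) X ≤ M.d i (restrict X)
    d-restrict {X} {i} v-deg with (p i ~? v) ×-dec (v ∈? X)
    ... | no out = ≤-trans (≤-reflexive (trans (d-punch (p i) X) (cong (_+ ΣFin n (λ k → e (p i) (p k) * χ (has X (p k)))) zero-term)))
            (≤-trans (Σ-mono n (λ k → *-monoˡ-≤ (χ (has X (p k))) (e-real i k))) (≤-reflexive (sym (M.d-def i (restrict X)))))
      where
      zero-term : e (p i) v * χ (has X v) ≡ 0
      zero-term with p i ~? v | v ∈? X
      ... | no q | _ = cong (_* χ (has X v)) (e≡0 q)
      ... | yes _ | no r = trans (cong (e (p i) v *_) (∉⇒0 {X = X} r)) (*-zeroʳ (e (p i) v))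
      ... | yes q | yes r = contradiction (q , r) out
    ... | yes (iv , v∈X) = from (d-witness≢ (v-deg v∈X) (p i))
      where
      from : (∃ λ z → v ~ z × z ∈ X × z ≢ p i) → d (p i) X ≤ M.d i (restrict X)
      from (z , vz , z∈ , z≢) with covered (≢-sym (~⇒≢ vz))
      ... | k , refl = ≤-trans (≤-reflexive (trans (d-punch (p i) X) (trans (cong (_+ ΣFin n f) (cong₂ _*_ (e≡1 iv) (∈⇒1 v∈X)))
              (trans (cong (_+ ΣFin n f) (sym (Σ-δ k (λ _ → 1)))) (sym (Σ-+ n _ f))))))
            (≤-trans (Σ-mono n pointwise) (≤-reflexive (sym (M.d-def i (restrict X)))))
        where
        f : Fin n → ℕ
        f j = e (p i) (p j) * χ (has X (p j))
        pointwise : ∀ j → χ (eqb j k) * 1 + f j ≤ M.e i j * χ (has X (p j))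
        pointwise j with j ≟ k
        ... | no _ = *-monoˡ-≤ (χ (has X (p j))) (e-real i j)
        ... | yes refl = ≤-reflexive (trans (cong (λ a → 1 + a * χ (has X (p j))) (e≡0 {p i} {p j} (indep (~sym iv) vz)))
                (sym (cong₂ _*_ (M.e≡1 (joined (λ { refl → z≢ refl }) (~sym iv) vz)) (∈⇒1 z∈))))

    -- A cycle avoiding `v` survives in the reduced graph, where it would miss both the hub `h` and
    -- the rim vertex `y`.
    missing : ∀ h → (∀ {y} → y ≢ h → M.Forest (full - h - y)) → ∀ {Q y} → y ≢ h → Dense Q → Nonempty Q → v ∉ Q → p h ∉ Q → p y ∉ Q → ⊥
    missing h rim {Q} y≢h dn ne v∉ h∉ y∉ = rim y≢h (M.cyc (restrict Q)
      (λ q → -⁺ (-⁺ ∈full (λ { refl → h∉ (restrict⁻ q) })) (λ { refl → y∉ (restrict⁻ q) }))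
      (some ne) (λ q → ≤-trans (dn (restrict⁻ q)) (d-restrict λ r → contradiction r v∉)))
      where
      some : Nonempty Q → Nonempty (restrict Q)
      some (x , q) with covered {x} (λ { refl → v∉ q })
      ... | i , refl = i , ∈restrict q

    reduced-path : ∀ {i j} → i ≢ j → PathCyc (p i) (p j) → M.PathCyc i j
    reduced-path {i} {j} i≢j pc = record
      { P = restrict P ; Q = restrict Q ; u∈P = ∈restrict u∈P ; v∈P = ∈restrict v∈P
      ; deg = λ {x} x∈ → ≤-trans (deg (restrict⁻ x∈)) (+-mono-≤ (d-restrict v-deg) (≤-reflexive (cong₂ _+_ (δ-p x i) (δ-p x j))))
      ; dense = λ q → ≤-trans (dense (restrict⁻ q)) (d-restrict (λ r → dense r))
      ; some = non-empty some
      ; apart = λ q r → apart (restrict⁻ q) (restrict⁻ r) }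
      where
      open PathCyc pc
      δ-p : ∀ x i → δ (p x) (p i) ≡ M.δ x i
      δ-p x i with x ≟ i
      ... | yes refl = δ-refl (p x)
      ... | no q = δ-≢ (q ∘ p-inj)
      v-deg : v ∈ P → 2 ≤ d v P
      v-deg q = subst (2 ≤_) (trans (cong (d v P +_) (cong₂ _+_ (δ-≢ (p≢v ∘ sym)) (δ-≢ (p≢v ∘ sym)))) (+-identityʳ _)) (deg q)
      at : ∀ {w} → w ∈ Q → w ≢ v → Nonempty (restrict Q)
      at q w≢v with covered w≢v
      ... | k , refl = k , ∈restrict q
      non-empty : Nonempty Q → Nonempty (restrict Q)
      non-empty (w , q) with w ≟ v
      ... | no w≢v = at q w≢v
      ... | yes refl = let (z , vz , z∈) = d-witness (≤-trans (s≤s z≤n) (dense q)) in at z∈ (≢-sym (~⇒≢ vz))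

    module _ (t≥1 : 1 ≤ d v full) (t≤2 : d v full ≤ 2) where
      reduced-sat : Sat → M.Sat
      reduced-sat sat = record
        { no-two = reduced-no-two t≤2 no-two
        ; path = λ i≢j i≁j → reduced-path i≢j (path (i≢j ∘ p-inj) (i≁j ∘ real)) }
        where open Sat sat

      c : Fin n → ℕ
      c i = e v (p i)

      t : ℕ
      t = ΣFin n c

      extra : Fin n → Fin n → ℕ
      extra i j = χ (not (eqb i j)) * (c i * c j)

      e-reduced : ∀ i j → M.e i j ≡ e (p i) (p j) + extra i j
      e-reduced i j with adj G (p i) (p j) in eq | i ≟ j | adj G v (p i) in a | adj G v (p j) in b
      ... | true | _ | true | true = contradiction (mem eq) (indep (mem a) (mem b))
      ... | true | yes _ | _ | _ = refl
      ... | true | no _ | false | _ = refl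
      ... | true | no _ | true | false = refl
      ... | false | yes _ | _ | _ = refl
      ... | false | no _ | false | _ = refl
      ... | false | no _ | true | false = refl
      ... | false | no _ | true | true = refl

      V : ℕ
      V = ΣFin n (λ i → ΣFin n (extra i))

      S : ℕ
      S = ΣFin n (λ i → ΣFin n (λ j → e (p i) (p j)))

      D⁻ : M.D full full ≡ S + V
      D⁻ = trans (M.D-full) (trans (Σ-cong n λ i → trans (Σ-cong n (e-reduced i)) (Σ-+ n _ _)) (Σ-+ n _ _))

      D⁺ : D full full ≡ 2 * t + S
      D⁺ = trans D-full (trans (Σ-punch v (λ i → ΣFin (suc n) (e i))) (trans (cong₂ _+_
        (trans (Σ-punch v (e v)) (cong (_+ t) (e≡0 {v} {v} ~irrefl)))
        (trans (Σ-cong n λ i → Σ-punch v (e (p i))) (trans (Σ-+ n _ _) (cong (_+ S) (Σ-cong n λ i → cong χ (adj-sym G (p i) v))))))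
        (lem t S)))
        where
        lem : ∀ t s → t + (t + s) ≡ 2 * t + s
        lem = solve-∀

      V+t : V + t ≡ t * t
      V+t = trans (cong₂ _+_ refl diagonal) (trans (sym (Σ-+ n _ _)) (trans (Σ-cong n λ i → trans (sym (Σ-+ n _ _)) (trans (Σ-cong n (square i)) (Σ-* n (c i) c)))
        (trans (Σ-cong n λ i → *-comm (c i) t) (Σ-* n t c))))
        where
        diag : Fin n → Fin n → ℕ
        diag i j = χ (eqb j i) * c j
        diagonal : t ≡ ΣFin n (λ i → ΣFin n (diag i))
        diagonal = Σ-cong n λ i → sym (Σ-δ i c)
        square : ∀ i j → extra i j + diag i j ≡ c i * c j
        square i j with i ≟ j | j ≟ i
        ... | no _ | no _ = trans (+-identityʳ _) (+-identityʳ _)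
        ... | no x | yes y = contradiction (sym y) x
        ... | yes x | no y = contradiction (sym x) y
        ... | yes refl | yes _ with adj G v (p i)
        ...   | true = refl
        ...   | false = refl

      t-value : t ≡ d v full
      t-value = sym (trans (d-punch v full) (cong₂ _+_ (cong (_* χ (has (full {suc n}) v)) (e≡0 {v} {v} ~irrefl))
        (Σ-cong n λ i → trans (cong (c i *_) (∈⇒1 (∈full {v = p i}))) (*-identityʳ _))))

      -- Suppression removes `2 * t` from the doubled edge count and returns `V = t(t - 1)` for the
      -- virtual edges; the difference is 2 for `t = 1` as well as for `t = 2`.
      reduced-D : D full full ≡ M.D full full + 2
      reduced-D = trans D⁺ (trans (cases t (subst (1 ≤_) (sym t-value) t≥1) (subst (_≤ 2) (sym t-value) t≤2) V+t) (cong (_+ 2) (sym D⁻)))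
        where
        cases : ∀ t → 1 ≤ t → t ≤ 2 → V + t ≡ t * t → 2 * t + S ≡ S + V + 2
        cases 1 _ _ eq = trans (lem₁ S) (cong (λ x → S + x + 2) (sym (+-cancelʳ-≡ 1 V 0 eq)))
          where
          lem₁ : ∀ s → 2 * 1 + s ≡ s + 0 + 2
          lem₁ = solve-∀
        cases 2 _ _ eq = trans (lem₂ S) (cong (λ x → S + x + 2) (sym (+-cancelʳ-≡ 2 V 2 eq)))
          where
          lem₂ : ∀ s → 2 * 2 + s ≡ s + 2 + 2
          lem₂ = solve-∀
        cases (suc (suc (suc _))) _ (s≤s (s≤s ())) _

      reduced-edges : edgeCount G ≡ suc (edgeCount G⁻)
      reduced-edges = *-cancelˡ-≡ _ _ 2 (trans (edges-D G) (trans reduced-D (trans (cong (_+ 2) (sym (edges-D G⁻))) (lem (edgeCount G⁻)))))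
        where
        lem : ∀ m → 2 * m + 2 ≡ 2 * suc m
        lem = solve-∀

ends-degree : ∀ {n} (G : Graph n) {u v P} → u ≢ v → 2 ≤ Counting.d G u P + (Pairs.δ G u u + Pairs.δ G u v) → 1 ≤ Counting.d G u P
ends-degree G {u} {v} {P} u≢v le = ≤-pred (subst (2 ≤_) (trans (cong (d u P +_) (cong₂ _+_ (δ-refl u) (δ-≢ u≢v))) (+-comm _ 1)) le)
  where open Pairs G

-- Necessity: small orders and induction by suppression.

module Degrees {n : ℕ} (G : Graph n) (sat : Pairs.Sat G) where
  open Covers G sat

  Reducible : Fin n → Set
  Reducible v = d v full ≤ 2 × (∀ x y → v ~ x → v ~ y → x ≁ y)

  reducible? : ∀ v → Dec (Reducible v)
  reducible? v = (d v full ≤? 2) ×-dec all? λ x → all? λ y → (v ~? x) →-dec ((v ~? y) →-dec ¬? (x ~? y))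

  positive : 2 ≤ n → ∀ v → 1 ≤ d v full
  positive n≥2 v = from (card-witness≢ (subst (2 ≤_) (sym (card-full n)) n≥2) v)
    where
    from : (∃ λ y → y ∈ full × y ≢ v) → 1 ≤ d v full
    from (y , _ , y≢v) with v ~? y
    ... | yes p = d≥1 p ∈full
    ... | no p = ≤-trans (ends-degree G (≢-sym y≢v) (deg u∈P)) (d-mono (λ _ → ∈full) v)
      where open PathCyc (path (≢-sym y≢v) p)

  abstract
    search : ∃ Reducible ⊎ (∀ v → ¬ Reducible v)
    search with any? reducible?
    ... | yes p = inj₁ p
    ... | no none = inj₂ λ v r → none (v , r)

  module _ (none : ∀ v → ¬ Reducible v) where
    irreducible-min₂ : ∀ v → 2 ≤ d v full
    irreducible-min₂ v = ≰⇒> λ h → none v (≤-trans h (s≤s z≤n) , λ x y vx vy xy → ~⇒≢ xy (d≤1⇒≡ h vx vy ∈full ∈full))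

    irreducible-clique₂ : ∀ {v x y} → d v full ≤ 2 → v ~ x → v ~ y → x ≢ y → x ~ y
    irreducible-clique₂ {v} {x} {y} h vx vy x≢y with x ~? y
    ... | yes p = p
    ... | no p = ⊥-elim (none v (h , indep))
      where
      nbr : ∀ {z} → v ~ z → z ≡ x ⊎ z ≡ y
      nbr {z} vz with z ≟ x | z ≟ y
      ... | yes q | _ = inj₁ q
      ... | no _ | yes q = inj₂ q
      ... | no q | no r = absurd (≤-pred (≤-pred (≤-trans (d-unique ((q ∷ r ∷ []) ∷ (x≢y ∷ []) ∷ [] ∷ []) (vz ∷ vx ∷ vy ∷ []) (∈full ∷ ∈full ∷ ∈full ∷ [])) h)))
      indep : ∀ z w → v ~ z → v ~ w → z ≁ w
      indep z w vz vw zw with nbr vz | nbr vw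
      ... | inj₁ refl | inj₁ refl = ~irrefl zw
      ... | inj₁ refl | inj₂ refl = p zw
      ... | inj₂ refl | inj₁ refl = p (~sym zw)
      ... | inj₂ refl | inj₂ refl = ~irrefl zw

-- Keeps only what the exclusion on seven vertices uses: deleting the hub and one rim vertex
-- destroys all cycles.
Wheel : ∀ {n} → Graph n → Set
Wheel G = ∃ λ h → ∀ {y} → y ≢ h → Forest (full - h - y)
  where open Counting G

data Shape₆ (G : Graph 6) : Set where
  is-wheel : edgeCount G ≡ 10 → Wheel G → Shape₆ G
  is-11 : edgeCount G ≡ 11 → Shape₆ G
  is-12 : edgeCount G ≡ 12 → Shape₆ G

-- A path between non-adjacent vertices and a disjoint cycle need three vertices each, so on five
-- vertices no non-edge is possible.
edges₅ : ∀ {G : Graph 5} → Pairs.Sat G → edgeCount G ≡ 10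
edges₅ {G} sat = *-cancelˡ-≡ _ 10 2 (trans (edges-D G) (trans (sum-cong (λ {v} _ → degree v)) (trans (sum-const full 4) (cong (4 *_) (card-full 5)))))
  where
  open Covers G sat
  complete : ∀ {u v} → u ≢ v → u ~ v
  complete {u} {v} u≢v with u ~? v
  ... | yes p = p
  ... | no p = ⊥-elim (from (d-witness (ends-degree G u≢v (deg u∈P))))
    where
    open PathCyc (path u≢v p)
    from : (∃ λ w → u ~ w × w ∈ P) → ⊥
    from (w , uw , w∈) = absurd (≤-pred (≤-pred (≤-pred (≤-pred (≤-pred (≤-trans (+-mono-≤ P≥3 (dense-card dense some))
      (≤-trans (≤-reflexive (sym (card-split (split-∪ apart)))) (≤-trans (card-mono (λ _ → ∈full)) (≤-reflexive (card-full 5))))))))))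
      where
      P≥3 : 3 ≤ card P
      P≥3 = card-unique ((u≢v ∷ ~⇒≢ uw ∷ []) ∷ ((λ { refl → p uw }) ∷ []) ∷ [] ∷ []) (u∈P ∷ v∈P ∷ w∈ ∷ [])
  degree : ∀ v → d v full ≡ 4
  degree v = trans (sym d-self) (trans (≤-antisym (d≤card v _) (card-mono λ q → ∩⁺ (complete (≢-sym (proj₂ (-⁻ q)))) q))
    (+-cancelˡ-≡ 1 _ 4 (trans (sym (card-remove (∈full {v = v}))) (card-full 5))))

suppressed : ∀ {n} {G : Graph (suc n)} {v} (sat : Pairs.Sat G) → 2 ≤ suc n → Degrees.Reducible G sat v →
             Pairs.Sat (Reduction.G⁻ G v) × edgeCount G ≡ suc (edgeCount (Reduction.G⁻ G v))
suppressed {G = G} {v} sat n≥2 (h , indep) =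
  Reduction.reduced-sat G v (λ {x} {y} → indep x y) (Degrees.positive G sat n≥2 v) h sat ,
  Reduction.reduced-edges G v (λ {x} {y} → indep x y) (Degrees.positive G sat n≥2 v) h

irreducible₆ : ∀ {G : Graph 6} (sat : Pairs.Sat G) → (∀ v → ¬ Degrees.Reducible G sat v) → ¬ ¬ Shape₆ G
irreducible₆ {G} sat none k = from (irreducible-universal sat ≤-refl min₂ (Degrees.irreducible-clique₂ G sat none))
  where
  min₂ : ∀ v → 2 ≤ Counting.d G v full
  min₂ = Degrees.irreducible-min₂ G sat none
  from : ∃ (Covers.Universal G sat) → ⊥
  from (h , hub) = Rim.outcome G sat min₂ ≤-refl hub λ o → k (read o)
    where
    five : card (full - h) ≡ 5
    five = suc-injective (trans (sym (card-remove ∈full)) (card-full 6))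
    read : Outcome G h → Shape₆ G
    read (tree seven _) = contradiction (subst (7 ≤_) five seven) λ { (s≤s (s≤s (s≤s (s≤s (s≤s ()))))) }
    read (wheel D≡ w) = is-wheel (*-cancelˡ-≡ _ 10 2 (trans (edges-D G) (trans D≡ (cong (4 *_) five)))) (h , λ y≢h → w five (-⁺ ∈full y≢h))
    read (cone D≡) = is-12 (*-cancelˡ-≡ _ 12 2 (+-cancelʳ-≡ 6 _ 24 (trans (cong (_+ 6) (edges-D G)) (trans D≡ (cong (6 *_) five)))))

shape₆ : ∀ {G : Graph 6} → Pairs.Sat G → ¬ ¬ Shape₆ G
shape₆ {G} sat k = by (Degrees.search G sat)
  where
  by : ∃ (Degrees.Reducible G sat) ⊎ (∀ v → ¬ Degrees.Reducible G sat v) → ⊥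
  by (inj₁ (v , r)) = let (sat⁻ , m) = suppressed sat (s≤s (s≤s z≤n)) r in k (is-11 (trans m (cong suc (edges₅ sat⁻))))
  by (inj₂ none) = irreducible₆ sat none k

module _ {n} {G : Graph (suc n)} {v : Fin (suc n)} (sat : Pairs.Sat G) (n≥2 : 2 ≤ n) where
  open Pairs G
  open Reduction G v
  open Pairs.Sat sat using (path)

  -- In each case some non-edge has a path through `h` and a further vertex `y`, with `v` off the
  -- accompanying cycle, contradicting `missing`. If `v ≁ h`, join `v` to `h`, which passes through
  -- a neighbour of `v`. If `v` sees `h` and another `y`, join these two; a cycle avoiding `h`
  -- cannot use `v`. If `v` sees only `h`, join `v` to any other vertex.
  suppressed-wheel : Degrees.Reducible G sat v → ¬ Wheel G⁻
  suppressed-wheel (h≤2 , ind) (h , rim) with v ~? p h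
  ... | no v≁h = from (path (≢-sym p≢v) v≁h)
    where
    from : PathCyc v (p h) → ⊥
    from pc = at (d-witness (ends-degree G (≢-sym p≢v) (deg u∈P)))
      where
      open PathCyc pc
      at : (∃ λ w → v ~ w × w ∈ P) → ⊥
      at (w , vw , w∈) with covered (≢-sym (~⇒≢ vw))
      ... | y , refl = missing (λ {x} {y} → ind x y) h rim (λ { refl → v≁h vw }) dense some (apart u∈P) (apart v∈P) (apart w∈)
  ... | yes vh = from-nbr (any? λ y → (v ~? y) ×-dec ¬? (y ≟ p h))
    where
    from-nbr : Dec (∃ λ y → v ~ y × y ≢ p h) → ⊥
    from-nbr (yes (y , vy , y≢)) with covered (≢-sym (~⇒≢ vy))
    ... | y′ , refl = at (path (≢-sym y≢) (ind _ _ vh vy))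
      where
      at : PathCyc (p h) (p y′) → ⊥
      at pc = missing (λ {x} {y} → ind x y) h rim (λ { refl → y≢ refl }) dense some v∉Q (apart u∈P) (apart v∈P)
        where
        open PathCyc pc
        v∉Q : v ∉ Q
        v∉Q q = let (a , va , a∈) = d-witness (≤-trans (s≤s z≤n) (dense q))
                    (b , vb , b∈ , b≢a) = d-witness≢ (dense q) a in
          absurd (≤-pred (≤-pred (≤-trans (d-unique (((λ h≡a → apart u∈P (subst (_∈ Q) (sym h≡a) a∈)) ∷ (λ h≡b → apart u∈P (subst (_∈ Q) (sym h≡b) b∈)) ∷ []) ∷ (≢-sym b≢a ∷ []) ∷ [] ∷ [])
            (vh ∷ va ∷ vb ∷ []) (∈full ∷ ∈full ∷ ∈full ∷ [])) h≤2)))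
    from-nbr (no none) = pick (card-witness≢ (≤-trans n≥2 (≤-reflexive (sym (card-full n)))) h)
      where
      pick : (∃ λ y → y ∈ full × y ≢ h) → ⊥
      pick (y , _ , y≢h) = at (path (≢-sym p≢v) λ vy → none (p y , vy , y≢h ∘ p-inj))
        where
        at : PathCyc v (p y) → ⊥
        at pc = go (d-witness (ends-degree G (≢-sym p≢v) (deg u∈P)))
          where
          open PathCyc pc
          go : (∃ λ w → v ~ w × w ∈ P) → ⊥
          go (w , vw , w∈) with w ≟ p h
          ... | no w≢ = none (w , vw , w≢)
          ... | yes refl = missing (λ {x} {y} → ind x y) h rim y≢h dense some (apart u∈P) (apart w∈) (apart v∈P)

InSpectrum : ℕ → ℕ → Set
InSpectrum n m = (n + 5 ≤ m × m ≤ 2 * n ∸ 2) ⊎ Σ ℕ (λ t → 3 ≤ t × t ≤ n ∸ 3 × m ≡ n + 2 * t)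

-- Decidability is what discharges the double negation stemming from shortest cycles.
inSpectrum? : ∀ n m → Dec (InSpectrum n m)
inSpectrum? n m = ((n + 5 ≤? m) ×-dec (m ≤? 2 * n ∸ 2)) ⊎-dec bounded
  where
  bounded : Dec (Σ ℕ (λ t → 3 ≤ t × t ≤ n ∸ 3 × m ≡ n + 2 * t))
  bounded with anyUpTo? (λ t → (3 ≤? t) ×-dec (m ℕ.≟ n + 2 * t)) (suc (n ∸ 3))
  ... | yes (t , t< , h , eq) = yes (t , h , ≤-pred t< , eq)
  ... | no none = no λ (t , h , t≤ , eq) → none (t , s≤s t≤ , h , eq)

spectrum-suc : ∀ k m → InSpectrum (7 + k) m → InSpectrum (8 + k) (suc m)
spectrum-suc k m (inj₁ (a , b)) = inj₁ (s≤s a , ≤-trans (s≤s b) (≤-reflexive′ k))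
  where
  ≤-reflexive′ : ∀ k → suc (2 * (7 + k) ∸ 2) ≤ 2 * (8 + k) ∸ 2
  ≤-reflexive′ k = subst₂ _≤_ (cong (λ x → suc (x ∸ 2)) (sym (*-distribˡ-+ 2 7 k))) (cong (_∸ 2) (sym (*-distribˡ-+ 2 8 k))) (n≤1+n _)
spectrum-suc k m (inj₂ (t , a , b , eq)) = inj₂ (t , a , m≤n⇒m≤1+n b , cong suc eq)

irreducible-spectrum : ∀ k {G : Graph (7 + k)} (sat : Pairs.Sat G) → (∀ v → ¬ Degrees.Reducible G sat v) → ¬ ¬ InSpectrum (7 + k) (edgeCount G)
irreducible-spectrum k {G} sat none out = from (irreducible-universal sat n≥6 min₂ (Degrees.irreducible-clique₂ G sat none))
  where
  n≥6 : 6 ≤ 7 + k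
  n≥6 = m≤m+n 6 (suc k)
  min₂ : ∀ v → 2 ≤ Counting.d G v full
  min₂ = Degrees.irreducible-min₂ G sat none
  m = edgeCount G
  upper : ∀ c → m ≤ c → c ≡ 12 + 2 * k → m ≤ 2 * (7 + k) ∸ 2
  upper c le eq = ≤-trans le (≤-reflexive (trans eq (cong (_∸ 2) (sym (*-distribˡ-+ 2 7 k)))))
  from : ∃ (Covers.Universal G sat) → ⊥
  from (h , hub) = Rim.outcome G sat min₂ n≥6 hub λ o → out (read o)
    where
    c≡ : card (full - h) ≡ 6 + k
    c≡ = suc-injective (trans (sym (card-remove ∈full)) (card-full (7 + k)))
    read : Outcome G h → InSpectrum (7 + k) m
    -- Here m = 2n - 3, and n + 5 ≤ m amounts to `c ≥ 7` for `c = n - 1`, the bound supplied by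
    -- `tree`.
    read (tree seven D≡) = inj₁
      ( linear (m ∷ k ∷ []) ((1 , 4 :* (con 6 :+ x₁) , 2 :* x₀ :+ con 2) ∷ (2 , con 7 , con 6 :+ x₁) ∷ []) (1 , con 7 :+ x₁ :+ con 5 , x₀) (≤-reflexive (sym eq)) (subst (7 ≤_) c≡ seven)
      , upper (12 + 2 * k) (linear (m ∷ k ∷ []) ((1 , 2 :* x₀ :+ con 2 , 4 :* (con 6 :+ x₁)) ∷ []) (1 , x₀ , con 12 :+ 2 :* x₁) (≤-reflexive eq)) refl )
      where
      eq : 2 * m + 2 ≡ 4 * (6 + k)
      eq = trans (cong (_+ 2) (edges-D G)) (trans D≡ (cong (4 *_) c≡))
    read (wheel D≡ _) = inj₁
      ( linear (m ∷ k ∷ []) ((1 , 4 :* (con 6 :+ x₁) , 2 :* x₀) ∷ []) (1 , con 7 :+ x₁ :+ con 5 , x₀) (≤-reflexive (sym eq))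
      , upper (12 + 2 * k) (linear (m ∷ k ∷ []) ((1 , 2 :* x₀ , 4 :* (con 6 :+ x₁)) ∷ []) (1 , x₀ , con 12 :+ 2 :* x₁) (≤-reflexive eq)) refl )
      where
      eq : 2 * m ≡ 4 * (6 + k)
      eq = trans (edges-D G) (trans D≡ (cong (4 *_) c≡))
    -- Here m = 3n - 6 = n + 2(n - 3), the extreme value `t = n - 3`.
    read (cone D≡) = inj₂ (4 + k , s≤s (s≤s (s≤s z≤n)) , ≤-refl , *-cancelˡ-≡ _ _ 2 (+-cancelʳ-≡ 6 _ _ (trans (cong (_+ 6) (edges-D G)) (trans D≡ (trans (cong (6 *_) c≡) (lem k))))))
      where
      lem : ∀ k → 6 * (6 + k) ≡ 2 * (7 + k + 2 * (4 + k)) + 6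
      lem = solve-∀

necessary : ∀ k {G : Graph (7 + k)} → Pairs.Sat G → ¬ ¬ InSpectrum (7 + k) (edgeCount G)

suppressible : ∀ k {G : Graph (7 + k)} (sat : Pairs.Sat G) → ∃ (Degrees.Reducible G sat) → ¬ ¬ InSpectrum (7 + k) (edgeCount G)
suppressible zero {G} sat (v , r) out = shape₆ (proj₁ (suppressed sat (s≤s (s≤s z≤n)) r)) read
  where
  m : edgeCount G ≡ suc (edgeCount (Reduction.G⁻ G v))
  m = proj₂ (suppressed sat (s≤s (s≤s z≤n)) r)
  read : Shape₆ (Reduction.G⁻ G v) → ⊥
  -- This wheel would give 11 = n + 4 edges on seven vertices, one below the spectrum.
  read (is-wheel _ w) = suppressed-wheel sat (s≤s (s≤s z≤n)) r w
  read (is-11 eq) = out (subst (InSpectrum 7) (sym (trans m (cong suc eq))) (inj₁ (≤-refl , ≤-refl)))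
  read (is-12 eq) = out (subst (InSpectrum 7) (sym (trans m (cong suc eq))) (inj₂ (3 , ≤-refl , n≤1+n 3 , refl)))
suppressible (suc k) {G} sat (v , r) out = necessary k (proj₁ (suppressed sat (s≤s (s≤s z≤n)) r))
  λ s → out (subst (InSpectrum (8 + k)) (sym (proj₂ (suppressed sat (s≤s (s≤s z≤n)) r))) (spectrum-suc k _ s))

necessary k {G} sat out = by (Degrees.search G sat)
  where
  by : ∃ (Degrees.Reducible G sat) ⊎ (∀ v → ¬ Degrees.Reducible G sat v) → ⊥
  by (inj₁ r) = suppressible k sat r out
  by (inj₂ none) = irreducible-spectrum k sat none out

necessary₆ : ∀ {G : Graph 6} → Pairs.Sat G → ¬ ¬ (10 ≤ edgeCount G × edgeCount G ≤ 12)
necessary₆ {G} sat out = shape₆ sat λ s → out (read s)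
  where
  bounds : ∀ {m} k → m ≡ 10 + k → k ≤ 2 → 10 ≤ m × m ≤ 12
  bounds k refl k≤2 = m≤m+n 10 k , +-monoʳ-≤ 10 k≤2
  read : Shape₆ G → 10 ≤ edgeCount G × edgeCount G ≤ 12
  read (is-wheel eq _) = bounds 0 eq z≤n
  read (is-11 eq) = bounds 1 eq (s≤s z≤n)
  read (is-12 eq) = bounds 2 eq ≤-refl

path-sym : ∀ {n} {G : Graph n} {u v} → Pairs.PathCyc G u v → Pairs.PathCyc G v u
path-sym {G = G} {u} {v} pc = record
  { P = P ; Q = Q ; u∈P = v∈P ; v∈P = u∈P ; dense = dense ; some = some ; apart = apart
  ; deg = λ {x} q → subst (λ k → 2 ≤ d x P + k) (+-comm (δ x u) (δ x v)) (deg q) }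
  where
  open Pairs G
  open PathCyc pc

-- Sufficiency: attaching a vertex to a saturated graph.

module Attach {n : ℕ} (G : Graph n) (A : VSet n) where
  open Pairs G

  G⁺ᵃ : Graph (suc n)
  G⁺ᵃ = record { adj = adj′ ; sym = sym′ ; irrefl = irrefl′ }
    where
    adj′ : Fin (suc n) → Fin (suc n) → Bool
    adj′ zero zero = false
    adj′ zero (suc j) = has A j
    adj′ (suc i) zero = has A i
    adj′ (suc i) (suc j) = adj G i j
    sym′ : ∀ i j → adj′ i j ≡ adj′ j i
    sym′ zero zero = refl
    sym′ zero (suc j) = refl
    sym′ (suc i) zero = refl
    sym′ (suc i) (suc j) = adj-sym G i j
    irrefl′ : ∀ i → adj′ i i ≡ false
    irrefl′ zero = refl
    irrefl′ (suc i) = irrefl G i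

  module A⁺ = Pairs G⁺ᵃ

  attach-edges : edgeCount G⁺ᵃ ≡ card A + edgeCount G
  attach-edges = *-cancelˡ-≡ _ _ 2 (trans (edges-D G⁺ᵃ) (trans A⁺.D-full (trans
    (cong₂ _+_ (sym (card-def A)) (trans (Σ-+ n (λ i → χ (has A i)) (λ i → ΣFin n (e i))) (cong₂ _+_ (sym (card-def A)) (trans (sym D-full) (sym (edges-D G))))))
    (lem (card A) (edgeCount G)))))
    where
    lem : ∀ a m → a + (a + 2 * m) ≡ 2 * (a + m)
    lem = solve-∀

  infixr 5 _◂_

  _◂_ : Bool → VSet n → VSet (suc n)
  b ◂ X = set λ { zero → b ; (suc i) → has X i }

  tail : VSet (suc n) → VSet n
  tail X = set (λ i → has X (suc i))

  ∈tail : ∀ {X i} → suc i ∈ X → i ∈ tail X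
  ∈tail (mem q) = mem q

  tail⁻ : ∀ {X i} → i ∈ tail X → suc i ∈ X
  tail⁻ (mem q) = mem q

  ∈◂ : ∀ {b X i} → i ∈ X → suc i ∈ b ◂ X
  ∈◂ (mem q) = mem q

  ◂⁻ : ∀ {b X i} → suc i ∈ b ◂ X → i ∈ X
  ◂⁻ (mem q) = mem q

  d-suc : ∀ i X → A⁺.d (suc i) X ≡ χ (has A i) * χ (has X zero) + d i (tail X)
  d-suc i X = trans (A⁺.d-def (suc i) X) (cong (χ (has A i) * χ (has X zero) +_) (sym (d-def i (tail X))))

  d-new : ∀ X → A⁺.d zero X ≡ card (A ∩ tail X)
  d-new X = trans (A⁺.d-def zero X) (trans (Σ-cong n pointwise) (sym (card-def (A ∩ tail X))))
    where
    pointwise : ∀ j → χ (has A j) * χ (has X (suc j)) ≡ χ (has (A ∩ tail X) j)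
    pointwise j with j ∈? A | j ∈? tail X
    ... | yes p | yes q = trans (cong₂ _*_ (∈⇒1 p) (∈⇒1 {X = tail X} q)) (sym (∈⇒1 (∩⁺ p q)))
    ... | yes p | no q = trans (cong₂ _*_ (∈⇒1 p) (∉⇒0 {X = tail X} q)) (sym (∉⇒0 {X = A ∩ tail X} (q ∘ proj₂ ∘ ∩⁻)))
    ... | no p | _ = trans (cong (_* χ (has X (suc j))) (∉⇒0 {X = A} p)) (sym (∉⇒0 {X = A ∩ tail X} (p ∘ proj₁ ∘ ∩⁻)))

  d-old : ∀ i X → d i X ≤ A⁺.d (suc i) (false ◂ X)
  d-old i X = ≤-trans (m≤n+m _ _) (≤-reflexive (sym (d-suc i (false ◂ X))))

  lift-dense : ∀ {Q} → Dense Q → A⁺.Dense (false ◂ Q)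
  lift-dense dn {suc i} q = ≤-trans (dn (◂⁻ q)) (d-old i _)
  lift-dense dn {zero} (mem ())

  δ-suc : ∀ x i → A⁺.δ (suc x) (suc i) ≡ δ x i
  δ-suc x i = by (x ≟ i)
    where
    by : Dec (x ≡ i) → A⁺.δ (suc x) (suc i) ≡ δ x i
    by (yes refl) = trans (A⁺.δ-refl (suc x)) (sym (δ-refl x))
    by (no q) = trans (A⁺.δ-≢ λ { refl → q refl }) (sym (δ-≢ q))

  lift-path : ∀ {i j} → PathCyc i j → A⁺.PathCyc (suc i) (suc j)
  lift-path {i} {j} pc = record
    { P = false ◂ P ; Q = false ◂ Q ; u∈P = ∈◂ u∈P ; v∈P = ∈◂ v∈P
    ; deg = λ { {suc x} q → ≤-trans (deg (◂⁻ q)) (+-mono-≤ (d-old x P) (≤-reflexive (sym (cong₂ _+_ (δ-suc x i) (δ-suc x j))))) ; {zero} (mem ()) }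
    ; dense = lift-dense dense ; some = let (x , q) = some in suc x , ∈◂ q
    ; apart = λ { {suc x} q r → apart (◂⁻ q) (◂⁻ r) ; {zero} (mem ()) } }
    where open PathCyc pc

  δ≤ : ∀ {r} → r ∈ A → ∀ x → δ x r ≤ χ (has A x)
  δ≤ {r} r∈ x with x ≟ r
  ... | yes refl = ≤-reflexive (sym (∈⇒1 r∈))
  ... | no _ = z≤n

  -- Prepends the new vertex to a path from `r`: the degree that `r` was granted as an endpoint is
  -- now supplied by its edge to the new vertex.
  new-path : ∀ {r j} → r ∈ A → PathCyc r j → A⁺.PathCyc zero (suc j)
  new-path {r} {j} r∈A pc = record
    { P = true ◂ P ; Q = false ◂ Q ; u∈P = mem refl ; v∈P = ∈◂ v∈P
    ; deg = new-deg
    ; dense = lift-dense dense ; some = let (x , q) = some in suc x , ∈◂ q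
    ; apart = λ { {suc x} q r → apart (◂⁻ q) (◂⁻ r) ; {zero} _ (mem ()) } }
    where
    open PathCyc pc
    new-deg : ∀ {x} → x ∈ true ◂ P → 2 ≤ A⁺.d x (true ◂ P) + (A⁺.δ x zero + A⁺.δ x (suc j))
    new-deg {zero} _ = +-mono-≤ (≤-trans (card-≥1 (∩⁺ r∈A (∈tail {true ◂ P} (∈◂ u∈P)))) (≤-reflexive (sym (d-new (true ◂ P))))) (m≤m+n 1 _)
    new-deg {suc x} q = ≤-trans (deg (◂⁻ q)) (≤-trans (≤-reflexive (lem (d x P) (δ x r) (δ x j)))
      (+-mono-≤ (≤-trans (+-monoˡ-≤ (d x P) (≤-trans (δ≤ r∈A x) (≤-reflexive (sym (*-identityʳ _))))) (≤-reflexive (sym (d-suc x (true ◂ P)))))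
        (≤-reflexive (sym (δ-suc x j)))))
      where
      lem : ∀ a b c → a + (b + c) ≡ b + a + c
      lem = solve-∀

  -- Every cycle misses at most one vertex of `A`, while a cycle through the new vertex uses at
  -- least two of them; hence these are never disjoint.
  Hits : Set
  Hits = ∀ {Y} → Dense Y → Nonempty Y → card (A ∖ Y) ≤ 1

  tail-dense : ∀ {Y} → zero ∉ Y → A⁺.Dense Y → Dense (tail Y)
  tail-dense {Y} z∉ dn {i} q = ≤-trans (dn (tail⁻ q)) (≤-reflexive (trans (d-suc i Y) (cong (_+ d i (tail Y)) (trans (cong (χ (has A i) *_) (∉⇒0 {X = Y} z∉)) (*-zeroʳ (χ (has A i)))))))

  tail-some : ∀ {Y} → zero ∉ Y → Nonempty Y → Nonempty (tail Y)
  tail-some z∉ (zero , q) = contradiction q z∉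
  tail-some z∉ (suc i , q) = i , ∈tail q

  touches : ∀ {Y} → A⁺.Dense Y → zero ∈ Y → 2 ≤ card (A ∩ tail Y)
  touches {Y} dn q = ≤-trans (dn q) (≤-reflexive (d-new Y))

  module _ (no-two : ¬ TwoCycles) (hits : Hits) where
    one-side : ∀ {X Y} → A⁺.Dense X → A⁺.Dense Y → Nonempty Y → Disjoint X Y → zero ∈ X → ⊥
    one-side {X} {Y} dX dY neY dis z∈ = absurd (≤-pred (≤-trans (touches dX z∈) (≤-trans (card-mono away) (hits (tail-dense z∉ dY) (tail-some z∉ neY)))))
      where
      z∉ : zero ∉ Y
      z∉ q = dis z∈ q
      away : A ∩ tail X ⊆ A ∖ tail Y
      away q = let (a , b) = ∩⁻ q in ∖⁺ a λ r → dis (tail⁻ b) (tail⁻ r)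

    attach-no-two : ¬ A⁺.TwoCycles
    attach-no-two (X , Y , A⁺.cyc B i s dn , A⁺.cyc C j t dm , dis) with zero ∈? B | zero ∈? C
    ... | yes q | _ = one-side dn dm t (λ a b → dis (i a) (j b)) q
    ... | no _ | yes r = one-side dm dn s (λ a b → dis (i b) (j a)) r
    ... | no q | no r = no-two (tail B , tail C , cyc (tail B) (λ x → x) (tail-some q s) (tail-dense q dn) ,
            cyc (tail C) (λ x → x) (tail-some r t) (tail-dense r dm) , λ a b → dis (i (tail⁻ a)) (j (tail⁻ b)))

  module _ (sat : Sat) (hits : Hits) {r : Fin n} (r∈ : r ∈ A) (paths : ∀ {y} → y ∉ A → PathCyc r y) where
    open Sat sat

    attach-sat : A⁺.Sat
    attach-sat = record { no-two = attach-no-two no-two hits ; path = connect }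
      where
      fresh : ∀ {j} → j ∉ A → A⁺.PathCyc zero (suc j)
      fresh j∉ = new-path r∈ (paths j∉)
      connect : ∀ {u v} → u ≢ v → u A⁺.≁ v → A⁺.PathCyc u v
      connect {zero} {zero} u≢v _ = contradiction refl u≢v
      connect {zero} {suc j} _ n = fresh (λ { (mem q) → n (mem q) })
      connect {suc i} {zero} _ n = path-sym (fresh (λ { (mem q) → n (mem q) }))
      connect {suc i} {suc j} u≢v n = lift-path (path (u≢v ∘ cong suc) λ { (mem q) → n (mem q) })

-- The field paths is exactly what keeps the graph saturated when leaves are
-- attached at w, and it survives each attachment.
record Rooted (n m : ℕ) : Set where
  field
    G     : Graph n
    sat   : Pairs.Sat G
    count : edgeCount G ≡ m
    w     : Fin n
    paths : ∀ y → Pairs.PathCyc G w y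

add-leaf : ∀ {n m} → Rooted n m → Rooted (suc n) (suc m)
add-leaf R = record
  { G = G⁺ᵃ ; w = suc w
  ; sat = attach-sat sat (λ _ _ → ≤-trans (card-mono ∖⊆) (≤-reflexive (card-｛｝ w))) (x∈｛x｝ w) (λ {y} _ → paths y)
  ; count = trans attach-edges (cong₂ _+_ (card-｛｝ w) count)
  ; paths = λ { zero → path-sym (new-path (x∈｛x｝ w) (paths w)) ; (suc y) → lift-path (paths y) } }
  where
  open Rooted R
  open Attach G ｛ w ｝

add-leaves : ∀ q {n m} → Rooted n m → Rooted (q + n) (q + m)
add-leaves zero R = R
add-leaves (suc q) R = add-leaf (add-leaves q R)

-- Attaching a vertex with neighbourhood A preserves these conditions, since a
-- dense set through the new vertex already contains two of at most three elements of A.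
record Stem (n m a : ℕ) : Set where
  field
    G     : Graph n
    sat   : Pairs.Sat G
    count : edgeCount G ≡ m
    A     : VSet n
    size  : card A ≡ a
    a≤3   : a ≤ 3
    hits  : Attach.Hits G A
    r     : Fin n
    r∈A   : r ∈ A
    paths : ∀ {y} → y ∉ A → Pairs.PathCyc G r y
    loop  : Pairs.PathCyc G r r

module Grow {n m a : ℕ} (S : Stem n m a) where
  open Stem S
  open Attach G A

  grow-stem : Stem (suc n) (a + m) a
  grow-stem = record
    { G = G⁺ᵃ ; A = false ◂ A ; a≤3 = a≤3 ; r = suc r ; r∈A = ∈◂ r∈A
    ; sat = attach-sat sat hits r∈A paths
    ; count = trans attach-edges (cong₂ _+_ size count)
    ; size = trans (card-def (false ◂ A)) (trans (sym (card-def A)) size)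
    ; hits = hits′
    -- The vertex just attached is reached from `r` by an edge, and `loop` provides the cycle
    -- avoiding `r`.
    ; paths = λ { {zero} _ → path-sym (new-path r∈A loop) ; {suc y} q → lift-path (paths (q ∘ ∈◂)) }
    ; loop = lift-path loop }
    where
    shift : ∀ Y → card ((false ◂ A) ∖ Y) ≤ card (A ∖ tail Y)
    shift Y = ≤-trans (≤-reflexive (trans (card-def ((false ◂ A) ∖ Y)) (trans (cong₂ _+_ (∉⇒0 {X = (false ◂ A) ∖ Y} {zero} (λ q → no-zero (∖⊆ q))) (sym (card-def (tail ((false ◂ A) ∖ Y))))) refl)))
      (card-mono λ q → let (x , y) = ∖⁻ (tail⁻ q) in ∖⁺ (◂⁻ x) (y ∘ tail⁻))
      where
      no-zero : zero ∉ false ◂ A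
      no-zero (mem ())
    hits′ : Attach.Hits G⁺ᵃ (false ◂ A)
    hits′ {Y} dn ne with zero ∈? Y
    ... | no z∉ = ≤-trans (shift Y) (hits (tail-dense z∉ dn) (tail-some z∉ ne))
    ... | yes z∈ = ≤-trans (shift Y) (+-cancelˡ-≤ 2 _ _ (≤-trans (+-monoˡ-≤ (card (A ∖ tail Y)) (touches dn z∈))
            (≤-trans (≤-reflexive (sym (trans (card-split parts) refl))) (≤-trans (≤-reflexive size) a≤3))))
      where
      parts : Split A (A ∩ tail Y) (A ∖ tail Y)
      parts = split place (proj₁ ∘ ∩⁻) ∖⊆ (λ p q → proj₂ (∖⁻ q) (proj₂ (∩⁻ p)))
        where
        place : ∀ {v} → v ∈ A → v ∈ A ∩ tail Y ⊎ v ∈ A ∖ tail Y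
        place p with ∈-or-∖ {A = tail Y} p
        ... | inj₁ q = inj₁ (∩⁺ p q)
        ... | inj₂ q = inj₂ q

-- Finite verification of the starting graphs.

module Decide {n : ℕ} (G : Graph n) where
  open Pairs G

  Fun : Set
  Fun = Fin n → Bool

  -- A transparent copy of `d`, which is opaque; the finite checks have to evaluate it.
  degree : Fin n → Fun → ℕ
  degree v X = ΣFin n (λ u → e v u * χ (X u))

  Thick : Fun → Set
  Thick X = (∀ v → X v ≡ true → 2 ≤ degree v X) × ∃ λ v → X v ≡ true

  thick? : ∀ X → Dec (Thick X)
  thick? X = all? (λ v → (X v ≟ᵇ true) →-dec (2 ≤? degree v X)) ×-dec any? λ v → X v ≟ᵇ true

  -- On these small graphs the complement of a suitable path is already dense, so
  -- only the path has to be searched for.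
  co : Fun → Fun
  co X v = not (X v)

  Linked : Fin n → Fin n → Fun → Set
  Linked u v X = X u ≡ true × X v ≡ true × (∀ x → X x ≡ true → 2 ≤ degree x X + (δ x u + δ x v)) × Thick (co X)

  linked? : ∀ u v X → Dec (Linked u v X)
  linked? u v X = (X u ≟ᵇ true) ×-dec ((X v ≟ᵇ true) ×-dec (all? (λ x → (X x ≟ᵇ true) →-dec (2 ≤? degree x X + (δ x u + δ x v))) ×-dec thick? (co X)))

  Path : Fin n → Fin n → Set
  Path u v = ∃ λ (S : Subset n) → Linked u v (lookup S)

  path? : ∀ u v → Dec (Path u v)
  path? u v = anySubset? λ S → linked? u v (lookup S)

  path⇒ : ∀ {u v} → Path u v → PathCyc u v
  path⇒ {u} {v} (S , a , b , deg , dense , x , some) = record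
    { P = set X ; Q = set (co X) ; u∈P = mem a ; v∈P = mem b
    ; deg = λ {x} q → subst (λ k → 2 ≤ k + (δ x u + δ x v)) (sym (d-def x (set X))) (deg x (true? q))
    ; dense = λ {x} q → subst (2 ≤_) (sym (d-def x (set (co X)))) (dense x (true? q))
    ; some = x , mem some
    ; apart = λ {x} p q → true≢false (true? q) (cong not (true? p)) }
    where X = lookup S

  Sparse : (Fun → Set) → Set
  Sparse B = ¬ ∃ λ (S : Subset n) → Thick (lookup S) × B (lookup S)

  thick⇐ : ∀ {X : VSet n} → Dense X → Nonempty X → let S = tabulate (has X) in Thick (lookup S) × (∀ v → lookup S v ≡ has X v)
  thick⇐ {X} dn (v , p) = ((λ x q → subst (2 ≤_) (trans (d-def x X) (Σ-cong n λ u → cong (λ b → e x u * χ b) (sym (same u)))) (dn (mem (trans (sym (same x)) q))))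
                          , v , trans (same v) (true? p)) , same
    where
    same : ∀ v → lookup (tabulate (has X)) v ≡ has X v
    same = lookup∘tabulate (has X)

  Meets : Fun → Set
  Meets X = ∃ λ (T : Subset n) → Thick (lookup T) × (∀ v → X v ≡ true → lookup T v ≡ false)

  meets? : ∀ X → Dec (Meets X)
  meets? X = anySubset? λ T → thick? (lookup T) ×-dec all? λ v → (X v ≟ᵇ true) →-dec (lookup T v ≟ᵇ false)

  Misses : Fun → Fun → Set
  Misses A X = 2 ≤ ΣFin n (λ v → χ (A v ∧ not (X v)))

  sparse? : ∀ {B : Fun → Set} → (∀ X → Dec (B X)) → Dec (Sparse B)
  sparse? B? = ¬? (anySubset? λ S → thick? (lookup S) ×-dec B? (lookup S))

  sparse-no-two : Sparse Meets → ¬ TwoCycles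
  sparse-no-two none (X , Y , cyc B i s dn , cyc C j t dm , dis) with thick⇐ dn s | thick⇐ dm t
  ... | b , same | c , same′ = none (tabulate (has B) , b , tabulate (has C) , c , λ v q → trans (same′ v) (¬true λ r → dis (i (mem (trans (sym (same v)) q))) (j (mem r))))

  sparse-hits : ∀ {A} → Sparse (Misses A) → Attach.Hits G (set A)
  sparse-hits {A} none {Y} dn ne with thick⇐ dn ne
  ... | b , same = ≤-pred (≰⇒> λ le → none (tabulate (has Y) , b , ≤-trans le (≤-reflexive (trans (card-def (set A ∖ Y)) (Σ-cong n λ v → pointwise v)))))
    where
    pointwise : ∀ v → χ (has (set A ∖ Y) v) ≡ χ (A v ∧ not (lookup (tabulate (has Y)) v))
    pointwise v rewrite same v with v ∈? set A | v ∈? Y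
    ... | yes (mem a) | yes (mem y) rewrite a | y = ∉⇒0 {X = set A ∖ Y} λ q → proj₂ (∖⁻ q) (mem y)
    ... | yes (mem a) | no y rewrite a | ¬true (y ∘ mem) = ∈⇒1 (∖⁺ {X = set A} (mem a) y)
    ... | no a | _ rewrite ¬true (a ∘ mem) = ∉⇒0 {X = set A ∖ Y} λ q → a (∖⊆ q)

  Joined : Set
  Joined = ∀ u v → u ≢ v → adj G u v ≡ false → Path u v

  joined? : Dec Joined
  joined? = all? λ u → all? λ v → ¬? (u ≟ v) →-dec ((adj G u v ≟ᵇ false) →-dec path? u v)

  decide-sat : True (sparse? meets?) → True joined? → Sat
  decide-sat s j = record { no-two = sparse-no-two (toWitness s) ; path = λ u≢v u≁v → path⇒ (toWitness j _ _ u≢v (¬true (u≁v ∘ mem))) }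

  decide-hits : ∀ A → True (sparse? (λ X → 2 ≤? ΣFin n (λ v → χ (A v ∧ not (X v))))) → Attach.Hits G (set A)
  decide-hits A h = sparse-hits (toWitness h)

  decide-paths : ∀ w → True (all? (path? w)) → ∀ y → PathCyc w y
  decide-paths w h y = path⇒ (toWitness h y)

  decide-paths-off : ∀ (A : Fun) r → True (all? λ y → (A y ≟ᵇ false) →-dec path? r y) → ∀ {y} → y ∉ set A → PathCyc r y
  decide-paths-off A r h y∉ = path⇒ (toWitness h _ (¬true (y∉ ∘ mem)))

  decide-loops : ∀ (A : Fun) → True (all? λ y → (A y ≟ᵇ true) →-dec path? y y) → ∀ {y} → y ∈ set A → PathCyc y y
  decide-loops A h y∈ = path⇒ (toWitness h _ (true? y∈))

-- The starting graphs and the families realising the spectrum.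

no-vertices : Graph 0
no-vertices = record { adj = λ () ; sym = λ () ; irrefl = λ () }

-- A row lists the adjacencies of the new vertex `zero` to the earlier ones, the most recent first.
_▹_ : ∀ {n} → Graph n → Vec Bool n → Graph (suc n)
G ▹ xs = Attach.G⁺ᵃ G (set (lookup xs))

infixl 4 _▹_

pattern T = true
pattern F = false

K₃ : Graph 3
K₃ = no-vertices ▹ [] ▹ T ∷ [] ▹ T ∷ T ∷ []

K₃∨K₁ : Graph 4
K₃∨K₁ = K₃ ▹ T ∷ T ∷ T ∷ []

K₅ : Graph 5
K₅ = K₃∨K₁ ▹ T ∷ T ∷ T ∷ T ∷ []

cone₆ : Graph 6
cone₆ = K₃∨K₁ ▹ F ∷ T ∷ T ∷ T ∷ [] ▹ F ∷ F ∷ T ∷ T ∷ T ∷ []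

wheel₆ : Graph 6
wheel₆ = no-vertices ▹ [] ▹ T ∷ [] ▹ T ∷ F ∷ [] ▹ T ∷ F ∷ F ∷ [] ▹ T ∷ F ∷ F ∷ T ∷ [] ▹ T ∷ T ∷ T ∷ T ∷ T ∷ []

K₅-rooted : Rooted 5 10
K₅-rooted = record { G = K₅ ; sat = decide-sat _ _ ; count = refl ; w = zero ; paths = decide-paths zero _ }
  where open Decide K₅

base : Fin 6 → Bool
base = lookup (F ∷ F ∷ F ∷ T ∷ T ∷ T ∷ [])

cone-stem : Stem 6 12 3
cone-stem = record
  { G = cone₆ ; sat = decide-sat _ _ ; count = refl ; A = set base ; size = card-def (set base) ; a≤3 = ≤-refl
  ; hits = decide-hits base _ ; r = suc (suc (suc zero)) ; r∈A = mem refl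
  ; paths = decide-paths-off base _ _ ; loop = decide-loops base _ (mem refl) }
  where open Decide cone₆

spoke : Fin 6 → Bool
spoke = lookup (T ∷ T ∷ F ∷ F ∷ F ∷ F ∷ [])

wheel-stem : Stem 6 10 2
wheel-stem = record
  { G = wheel₆ ; sat = decide-sat _ _ ; count = refl ; A = set spoke ; size = card-def (set spoke) ; a≤3 = n≤1+n 2
  -- `r` is the rim end of the spoke: deleting the hub and a rim vertex leaves no cycle, so no
  -- suitable paths start at the hub.
  ; hits = decide-hits spoke _ ; r = suc zero ; r∈A = mem refl
  ; paths = decide-paths-off spoke _ _ ; loop = decide-loops spoke _ (mem refl) }
  where open Decide wheel₆

record RootedStem (n m a : ℕ) : Set where
  field
    stem  : Stem n m a
    w     : Fin n
    w∉A   : w ∉ Stem.A stem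
    paths : ∀ y → Pairs.PathCyc (Stem.G stem) w y

grow-root : ∀ {n m a} → RootedStem n m a → RootedStem (suc n) (a + m) a
grow-root R = record
  { stem = Grow.grow-stem stem ; w = suc w ; w∉A = w∉A ∘ ◂⁻
  ; paths = λ { zero → path-sym (new-path (Stem.r∈A stem) (Stem.paths stem w∉A)) ; (suc y) → lift-path (paths y) } }
  where
  open RootedStem R
  open Attach (Stem.G stem) (Stem.A stem)

grows : ∀ s {n m a} → RootedStem n m a → RootedStem (s + n) (s * a + m) a
grows zero R = R
grows (suc s) {n} {m} {a} R = subst (λ k → RootedStem (suc s + n) k a) (sym (+-assoc a (s * a) m)) (grow-root (grows s R))

rooted : ∀ {n m a} → RootedStem n m a → Rooted n m
rooted R = record { G = Stem.G stem ; sat = Stem.sat stem ; count = Stem.count stem ; w = w ; paths = paths }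
  where open RootedStem R

cone-root : RootedStem 6 12 3
cone-root = record { stem = cone-stem ; w = zero ; w∉A = λ { (mem ()) } ; paths = Decide.decide-paths cone₆ zero _ }

-- The wheel itself has no root, since a path containing the hub and a rim vertex meets every cycle.
-- The first vertex attached to the spoke serves instead; it reaches `y` through an end of the
-- spoke, which is `y` itself when `y` lies there.
wheel-root : RootedStem 7 12 2
wheel-root = record { stem = Grow.grow-stem wheel-stem ; w = zero ; w∉A = λ { (mem ()) } ; paths = from-new }
  where
  open Stem wheel-stem
  open Attach G A
  open Pairs.PathCyc loop using (Q; dense; some)
  from-new : ∀ y → A⁺.PathCyc zero y
  from-new zero = record
    { P = true ◂ set (λ _ → false) ; Q = false ◂ Q ; u∈P = mem refl ; v∈P = mem refl
    ; deg = λ { {zero} _ → m≤n+m 2 _ ; {suc x} (mem ()) }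
    ; dense = lift-dense dense ; some = let (x , q) = some in suc x , ∈◂ q ; apart = λ { {zero} _ (mem ()) ; {suc x} (mem ()) } }
  from-new (suc y) with y ∈? A
  ... | yes y∈ = new-path y∈ (Decide.decide-loops wheel₆ spoke _ y∈)
  ... | no y∉ = new-path (mem refl) (paths y∉)

rooted⇒InES : ∀ {n m} → Rooted n m → InES n m
rooted⇒InES R = G , Sat⇒Saturated sat , count
  where open Rooted R

cone-family : ∀ q s → InES (q + (s + 6)) (q + (s * 3 + 12))
cone-family q s = rooted⇒InES (add-leaves q (rooted (grows s cone-root)))

wheel-family : ∀ q s → InES (q + (s + 7)) (q + (s * 2 + 12))
wheel-family q s = rooted⇒InES (add-leaves q (rooted (grows s wheel-root)))

sufficient : ∀ {n m} → 7 ≤ n → InSpectrum n m → InES n m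
sufficient {n} {m} n≥7 (inj₁ (lo , hi)) with m≤n⇒∃[o]m+o≡n n≥7 | m≤n⇒∃[o]m+o≡n lo
... | k , refl | s , refl with m≤n⇒∃[o]m+o≡n s≤k
  where
  s≤k : s ≤ k
  s≤k = linear (s ∷ k ∷ []) ((1 , con 7 :+ x₁ :+ con 5 :+ x₀ , con 12 :+ 2 :* x₁) ∷ []) (0 , x₀ , x₁)
    (subst (7 + k + 5 + s ≤_) (cong (_∸ 2) (*-distribˡ-+ 2 7 k)) hi)
-- Of the n - 7 vertices added to the seven-vertex graph, `s = m - (n + 5)` have degree two and add
-- 2 edges each; the other `q` are leaves.
...   | q , refl = subst₂ InES (lem₁ q s) (lem₂ q s) (wheel-family q s)
  where
  lem₁ : ∀ q s → q + (s + 7) ≡ 7 + (s + q)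
  lem₁ = solve-∀
  lem₂ : ∀ q s → q + (s * 2 + 12) ≡ 7 + (s + q) + 5 + s
  lem₂ = solve-∀
sufficient {n} n≥7 (inj₂ (t , t≥3 , t≤ , refl)) with m≤n⇒∃[o]m+o≡n n≥7 | m≤n⇒∃[o]m+o≡n t≥3 | m≤n⇒∃[o]m+o≡n t≤
-- The six-vertex cone accounts for `t = 3`; each of the `s = t - 3` vertices of degree three raises
-- m - n by two, and each leaf preserves it.
... | k , refl | s , refl | q , eq = subst₂ InES n≡ (trans (lem₂ q s) (cong (_+ 2 * (3 + s)) n≡)) (cone-family q s)
  where
  lem₁ : ∀ q s → q + (s + 6) ≡ 3 + (3 + s + q)
  lem₁ = solve-∀
  n≡ : q + (s + 6) ≡ 7 + k
  n≡ = trans (lem₁ q s) (cong (3 +_) eq)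
  lem₂ : ∀ q s → q + (s * 3 + 12) ≡ q + (s + 6) + 2 * (3 + s)
  lem₂ = solve-∀

sufficient₆ : ∀ {m} → 10 ≤ m → m ≤ 12 → InES 6 m
sufficient₆ {m} lo hi with m≤n⇒∃[o]m+o≡n lo
... | 0 , refl = wheel₆ , Sat⇒Saturated (Stem.sat wheel-stem) , refl
-- Eleven edges come from `K₅`, which has ten, with a pendant vertex.
... | 1 , refl = rooted⇒InES (add-leaf K₅-rooted)
... | 2 , refl = cone-family 0 0
... | suc (suc (suc _)) , refl = contradiction hi (<⇒≱ (m≤m+n 13 _))

theorem1p4 : (∀ m → InES 6 m ⇔ (10 ≤ m × m ≤ 12)) ×
    (∀ n → 7 ≤ n → ∀ m →
    InES n m ⇔ ((n + 5 ≤ m × m ≤ 2 * n ∸ 2) ⊎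
    Σ ℕ (λ t → 3 ≤ t × t ≤ n ∸ 3 × m ≡ n + 2 * t)))
theorem1p4 = (λ m → mk⇔ forth₆ λ (lo , hi) → sufficient₆ lo hi) , λ n n≥7 m → mk⇔ (forth n≥7) (sufficient n≥7)
  where
  forth₆ : ∀ {m} → InES 6 m → 10 ≤ m × m ≤ 12
  forth₆ {m} (G , saturated , refl) = decidable-stable ((10 ≤? m) ×-dec (m ≤? 12)) (necessary₆ (Saturated⇒Sat saturated))
  forth : ∀ {n m} → 7 ≤ n → InES n m → InSpectrum n m
  forth {n} {m} n≥7 (G , saturated , refl) with m≤n⇒∃[o]m+o≡n n≥7
  ... | k , refl = decidable-stable (inSpectrum? n m) (necessary k (Saturated⇒Sat saturated))
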